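{- There exist constants $C > 0$ and $x_0$ such that for all real $x \ge x_0$, $$\frac{1}{x}\sum_{1\le n\le x} M(n) \le C\,(\log\log x)^3,$$ where the sum runs over positive integers $n$.
   Context: For a positive integer $m$, $s_2(m)$ denotes the number of $1$'s in the binary expansion of $m$ (the Hamming weight of $m$). For a positive integer $n$, $M(n) := \min_{k\ge 1} s_2(kn)$, the minimum being over all positive integers $k$. Here $\log$ is the natural logarithm. -}

module Defs where

open import Data.Digit using (Expansion; fromDigits; toDigits; 0b; 1b)
open import Data.Empty using (⊥-elim)
open import Data.Fin.Base as Fin using (Fin; zero; suc; toℕ)
import Data.Fin.Properties as Fin
open import Data.List.Base using (List; []; _∷_; length; filter; map; upTo)
open import Data.Nat.Base as ℕ using (ℕ; zero; suc; _!)
open import Data.Nat.Properties as ℕ using (_!≢0)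
open import Data.Product.Base using (∃; ∃₂; ∃-syntax; _×_; _,_; proj₁; proj₂)
open import Data.Sum.Base using (inj₁; inj₂)
open import Relation.Binary.PropositionalEquality
open import Relation.Nullary using (Dec; yes; no)
open import Relation.Nullary.Decidable using (map′)

module _ where
  open import Data.Nat.ListAction using (sum)
  open import Data.List.Properties using (length-map)
  open import Data.Nat.Base
  open import Data.Nat.DivMod
  open import Data.Nat.Divisibility using (m%n≡0⇒n∣m; divides)
  open import Data.Nat.Induction using (<-rec)
  open import Data.Nat.Properties
  open import Data.Nat.Tactic.RingSolver using (solve-∀)

  ones : Expansion 2 → ℕ
  ones ds = length (filter (1b Fin.≟_) ds)

  s₂ : ℕ → ℕ
  s₂ m = ones (proj₁ (toDigits 2 m))

  IsMinWeight : ℕ → ℕ → Set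
  IsMinWeight n w = (∃[ k ] 1 ≤ k × s₂ (k * n) ≡ w) × (∀ k → 1 ≤ k → w ≤ s₂ (k * n))

  private
    m*2≢1+n*2 : ∀ m n → m * 2 ≢ 1 + n * 2
    m*2≢1+n*2 m n eq with trans (sym (m*n%n≡0 m 2)) (trans (cong (_% 2) eq) ([m+kn]%n≡m%n 1 n 2))
    ... | ()

    ones-unique : ∀ ds es → fromDigits ds ≡ fromDigits es → ones ds ≡ ones es
    ones-unique []             []             eq = refl
    ones-unique []             (zero ∷ es)     eq = ones-unique [] es (*-cancelʳ-≡ 0 (fromDigits es) 2 eq)
    ones-unique (zero ∷ ds)     []             eq = ones-unique ds [] (*-cancelʳ-≡ (fromDigits ds) 0 2 eq)
    ones-unique (zero ∷ ds)     (zero ∷ es)     eq = ones-unique ds es (*-cancelʳ-≡ (fromDigits ds) (fromDigits es) 2 eq)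
    ones-unique (suc zero ∷ ds) (suc zero ∷ es) eq =
      cong suc (ones-unique ds es (*-cancelʳ-≡ (fromDigits ds) (fromDigits es) 2 (suc-injective eq)))
    ones-unique (zero ∷ ds)     (suc zero ∷ es) eq = ⊥-elim (m*2≢1+n*2 (fromDigits ds) (fromDigits es) eq)
    ones-unique (suc zero ∷ ds) (zero ∷ es)     eq = ⊥-elim (m*2≢1+n*2 (fromDigits es) (fromDigits ds) (sym eq))

    s₂-fromDigits : ∀ ds → s₂ (fromDigits ds) ≡ ones ds
    s₂-fromDigits ds = ones-unique (proj₁ (toDigits 2 (fromDigits ds))) ds (proj₂ (toDigits 2 (fromDigits ds)))

    add2^ : ℕ → Expansion 2 → Expansion 2
    add2^ zero    []              = 1b ∷ []
    add2^ zero    (zero ∷ ds)     = 1b ∷ ds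
    add2^ zero    (suc zero ∷ ds) = 0b ∷ add2^ zero ds
    add2^ (suc a) []              = 0b ∷ add2^ a []
    add2^ (suc a) (d ∷ ds)        = d ∷ add2^ a ds

    fromDigits-add2^ : ∀ a ds → fromDigits (add2^ a ds) ≡ 2 ^ a + fromDigits ds
    fromDigits-add2^ zero    []              = refl
    fromDigits-add2^ zero    (zero ∷ ds)     = refl
    fromDigits-add2^ zero    (suc zero ∷ ds) = cong (_* 2) (fromDigits-add2^ zero ds)
    fromDigits-add2^ (suc a) []              = trans (cong (_* 2) (fromDigits-add2^ a [])) (shuffle (2 ^ a))
      where
      shuffle : ∀ p → (p + 0) * 2 ≡ 2 * p + 0
      shuffle = solve-∀
    fromDigits-add2^ (suc a) (d ∷ ds)        =
      trans (cong (λ u → toℕ d + u * 2) (fromDigits-add2^ a ds)) (shuffle (toℕ d) (2 ^ a) (fromDigits ds))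
      where
      shuffle : ∀ d p f → d + (p + f) * 2 ≡ 2 * p + (d + f * 2)
      shuffle = solve-∀

    ones-add2^ : ∀ a ds → ones (add2^ a ds) ≤ suc (ones ds)
    ones-add2^ zero    []              = ≤-refl
    ones-add2^ zero    (zero ∷ ds)     = ≤-refl
    ones-add2^ zero    (suc zero ∷ ds) = ≤-trans (ones-add2^ zero ds) (n≤1+n _)
    ones-add2^ (suc a) []              = ones-add2^ a []
    ones-add2^ (suc a) (zero ∷ ds)     = ones-add2^ a ds
    ones-add2^ (suc a) (suc zero ∷ ds) = s≤s (ones-add2^ a ds)

    sum2^ : List ℕ → ℕ
    sum2^ as = sum (map (2 ^_) as)

    s₂-sum2^ : ∀ as → s₂ (sum2^ as) ≤ length as
    s₂-sum2^ as = go as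
      where
      build : List ℕ → Expansion 2
      build []       = []
      build (a ∷ as) = add2^ a (build as)
      value : ∀ as → fromDigits (build as) ≡ sum2^ as
      value []       = refl
      value (a ∷ as) = trans (fromDigits-add2^ a (build as)) (cong (2 ^ a +_) (value as))
      weight : ∀ as → ones (build as) ≤ length as
      weight []       = z≤n
      weight (a ∷ as) = ≤-trans (ones-add2^ a (build as)) (s≤s (weight as))
      go : ∀ as → s₂ (sum2^ as) ≤ length as
      go as = subst (_≤ length as) (trans (sym (s₂-fromDigits (build as))) (cong s₂ (value as))) (weight as)

    sum2^-suc : ∀ as → sum2^ (map suc as) ≡ sum2^ as * 2
    sum2^-suc []       = refl
    sum2^-suc (a ∷ as) = trans (cong (2 * 2 ^ a +_) (sum2^-suc as)) (shuffle (2 ^ a) (sum2^ as))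
      where
      shuffle : ∀ p s → 2 * p + s * 2 ≡ (p + s) * 2
      shuffle = solve-∀

    exponents : ∀ m → ∃[ as ] sum2^ as ≡ m × length as ≡ s₂ m
    exponents m = let as , p , q = go (proj₁ (toDigits 2 m)) in as , trans p (proj₂ (toDigits 2 m)) , q
      where
      go : ∀ ds → ∃[ as ] sum2^ as ≡ fromDigits ds × length as ≡ ones ds
      go []              = [] , refl , refl
      go (zero ∷ ds)     = let as , p , q = go ds in
        map suc as , trans (sum2^-suc as) (cong (_* 2) p) , trans (length-map suc as) q
      go (suc zero ∷ ds) = let as , p , q = go ds in
        0 ∷ map suc as , cong suc (trans (sum2^-suc as) (cong (_* 2) p)) , cong suc (trans (length-map suc as) q)

    module Periodicity (n : ℕ) .{{_ : NonZero n}} where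
      +-cong-% : ∀ {a b c d} → a % n ≡ b % n → c % n ≡ d % n → (a + c) % n ≡ (b + d) % n
      +-cong-% {a} {b} {c} {d} p q = trans (%-distribˡ-+ a c n)
        (trans (cong₂ (λ u v → (u + v) % n) p q) (sym (%-distribˡ-+ b d n)))

      *-cong-% : ∀ c {a b} → a % n ≡ b % n → (c * a) % n ≡ (c * b) % n
      *-cong-% zero    p = refl
      *-cong-% (suc c) {a} {b} p = +-cong-% {a} {b} p (*-cong-% c p)

      collision : ∃₂ λ i j → i < j × j ≤ n × 2 ^ i % n ≡ 2 ^ j % n
      collision with Fin.pigeonhole ≤-refl (λ (i : Fin (suc n)) → Fin.fromℕ< (m%n<n (2 ^ toℕ i) n))
      ... | i , j , i<j , eq = toℕ i , toℕ j , i<j , ≤-pred (Fin.toℕ<n j) ,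
        trans (sym (Fin.toℕ-fromℕ< (m%n<n (2 ^ toℕ i) n)))
              (trans (cong toℕ eq) (Fin.toℕ-fromℕ< (m%n<n (2 ^ toℕ j) n)))

      reduce : ∀ a → ∃[ b ] b ≤ n × 2 ^ b % n ≡ 2 ^ a % n
      reduce with collision
      ... | i , j , i<j , j≤n , 2^i≡2^j = <-rec _ step
        where
        step : ∀ a → (∀ {c} → c < a → ∃[ b ] b ≤ n × 2 ^ b % n ≡ 2 ^ c % n) →
               ∃[ b ] b ≤ n × 2 ^ b % n ≡ 2 ^ a % n
        step a rec with ≤-total a j
        ... | inj₁ a≤j = a , ≤-trans a≤j j≤n , refl
        ... | inj₂ j≤a = let b , b≤n , eq = rec c<a in b , b≤n , trans eq 2^c≡2^a
          where
          c : ℕ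
          c = (a ∸ j) + i
          c<a : c < a
          c<a = subst (c <_) (m∸n+n≡m j≤a) (+-monoʳ-< (a ∸ j) i<j)
          2^c≡2^a : 2 ^ c % n ≡ 2 ^ a % n
          2^c≡2^a = begin-equality
            2 ^ c % n                   ≡⟨ cong (_% n) (^-distribˡ-+-* 2 (a ∸ j) i) ⟩
            (2 ^ (a ∸ j) * 2 ^ i) % n   ≡⟨ *-cong-% (2 ^ (a ∸ j)) 2^i≡2^j ⟩
            (2 ^ (a ∸ j) * 2 ^ j) % n   ≡⟨ cong (_% n) (^-distribˡ-+-* 2 (a ∸ j) j) ⟨
            2 ^ ((a ∸ j) + j) % n       ≡⟨ cong (λ e → 2 ^ e % n) (m∸n+n≡m j≤a) ⟩
            2 ^ a % n                   ∎
            where open ≤-Reasoning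

      reduceAll : ∀ as → ∃[ bs ] length bs ≡ length as × sum2^ bs ≤ length as * 2 ^ n ×
                                 sum2^ bs % n ≡ sum2^ as % n
      reduceAll []       = [] , refl , z≤n , refl
      reduceAll (a ∷ as) =
        let b , b≤n , eq = reduce a
            bs , len , bound , eqs = reduceAll as
        in b ∷ bs , cong suc len , +-mono-≤ (^-monoʳ-≤ 2 b≤n) bound , +-cong-% {2 ^ b} {2 ^ a} eq eqs

      sum2^-pos : ∀ as → 1 ≤ length as → 1 ≤ sum2^ as
      sum2^-pos (a ∷ as) _ = ≤-trans (m^n>0 2 a) (m≤m+n (2 ^ a) (sum2^ as))

      s₂-pos : ∀ m → 1 ≤ m → 1 ≤ s₂ m
      s₂-pos m 1≤m with exponents m
      ... | []     , p , q = ⊥-elim (n≮0 (subst (1 ≤_) (sym p) 1≤m))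
      ... | a ∷ as , p , q = subst (1 ≤_) q (s≤s z≤n)

      -- This bounds the search for a minimum over all k.
      shrinkMultiple : ∀ k → 1 ≤ k → ∃[ l ] 1 ≤ l × l ≤ s₂ (k * n) * 2 ^ n × s₂ (l * n) ≤ s₂ (k * n)
      shrinkMultiple k 1≤k
        with exponents (k * n)
      ... | as , sum≡ , len≡ with reduceAll as
      ... | bs , len , bound , eqs with m%n≡0⇒n∣m (sum2^ bs) n (trans eqs (trans (cong (_% n) sum≡) (m*n%n≡0 k n)))
      ... | divides l bs≡l*n = l , 1≤l ,
            ≤-trans (≤-trans (m≤m*n l n) (≤-reflexive (sym bs≡l*n))) (subst (λ w → sum2^ bs ≤ w * 2 ^ n) len≡ bound) ,
            subst₂ (λ u w → s₂ u ≤ w) bs≡l*n (trans len len≡) (s₂-sum2^ bs)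
        where
        1≤kn : 1 ≤ k * n
        1≤kn = *-mono-≤ 1≤k (>-nonZero⁻¹ n)
        1≤bs : 1 ≤ sum2^ bs
        1≤bs = sum2^-pos bs (subst (1 ≤_) (sym (trans len len≡)) (s₂-pos (k * n) 1≤kn))
        positiveFactor : ∀ l → 1 ≤ l * n → 1 ≤ l
        positiveFactor (suc _) _ = s≤s z≤n
        1≤l : 1 ≤ l
        1≤l = positiveFactor l (subst (1 ≤_) bs≡l*n 1≤bs)

      HasWeight≤ : ℕ → Set
      HasWeight≤ w = ∃[ k ] 1 ≤ k × s₂ (k * n) ≤ w

      hasWeight≤? : ∀ w → Dec (HasWeight≤ w)
      hasWeight≤? w = map′
        (λ (i , _ , p) → suc i , s≤s z≤n , p)
        (λ (k , 1≤k , p) → find k 1≤k p)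
        (anyUpTo? (λ i → s₂ (suc i * n) ≤? w) (w * 2 ^ n))
        where
        find : ∀ k → 1 ≤ k → s₂ (k * n) ≤ w → ∃ λ i → i < w * 2 ^ n × s₂ (suc i * n) ≤ w
        find k 1≤k p with shrinkMultiple k 1≤k
        ... | suc l , _ , l≤ , q = l , ≤-trans l≤ (*-monoˡ-≤ (2 ^ n) p) , ≤-trans q p

      least : ∀ v → HasWeight≤ v → ∃[ w ] HasWeight≤ w × (∀ k → 1 ≤ k → w ≤ s₂ (k * n))
      least zero    h = zero , h , λ _ _ → z≤n
      least (suc v) h with hasWeight≤? v
      ... | yes h′ = least v h′
      ... | no ¬h′ = suc v , h , λ k 1≤k → ≰⇒> (λ p → ¬h′ (k , 1≤k , p))

  minWeight : ∀ n .{{_ : NonZero n}} → ∃[ w ] IsMinWeight n w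
  minWeight n with Periodicity.least n (s₂ (1 * n)) (1 , ≤-refl , ≤-refl)
  ... | w , (k , 1≤k , p) , lower = w , (k , 1≤k , ≤-antisym p (lower k 1≤k)) , lower

  M : ∀ n .{{_ : NonZero n}} → ℕ
  M n = proj₁ (minWeight n)

  -- The sum of M n over 1 ≤ n ≤ N.
  sumM : ℕ → ℕ
  sumM N = sum (map (λ i → M (suc i)) (upTo N))

module _ where
  open import Data.Integer.Base as ℤ using (+_; -[1+_]; +[1+_])
  import Data.Integer.Properties as ℤ
  open import Data.Rational
  open import Data.Rational.Properties
  open import Data.Rational.Unnormalised.Base using (mkℚᵘ)
  import Data.Rational.Unnormalised as ℚᵘ
  import Data.Rational.Unnormalised.Properties as ℚᵘ
  open import Data.Rational.Solver using (module +-*-Solver)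
  open +-*-Solver using (solve; _:+_; _:-_; _:*_; :-_; con; _:=_)

  Cauchy : (ℕ → ℚ) → Set
  Cauchy s = ∀ ε → 0ℚ < ε → ∃[ N ] ∀ m n → N ℕ.≤ m → N ℕ.≤ n → ∣ s m - s n ∣ ≤ ε

  -- Real numbers are Cauchy sequences of rationals, with equality _≃ᴿ_.
  record ℝ : Set where
    constructor mkℝ
    field
      seq    : ℕ → ℚ
      cauchy : Cauchy seq
  open ℝ public

  infix 4 _≃ᴿ_ _≤ᴿ_ _<ᴿ_

  _≃ᴿ_ _≤ᴿ_ _<ᴿ_ : ℝ → ℝ → Set
  x ≃ᴿ y = ∀ ε → 0ℚ < ε → ∃[ N ] ∀ n → N ℕ.≤ n → ∣ seq x n - seq y n ∣ ≤ ε
  x ≤ᴿ y = ∀ ε → 0ℚ < ε → ∃[ N ] ∀ n → N ℕ.≤ n → seq x n ≤ seq y n + ε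
  x <ᴿ y = ∃[ ε ] 0ℚ < ε × ∃[ N ] ∀ n → N ℕ.≤ n → seq x n + ε ≤ seq y n

  private
    0<½ : 0ℚ < ½
    0<½ = positive⁻¹ ½

    *-pos : ∀ {p q} → 0ℚ < p → 0ℚ < q → 0ℚ < p * q
    *-pos {p} {q} 0<p 0<q =
      positive⁻¹ (p * q) {{pos*pos⇒pos p {{positive 0<p}} q {{positive 0<q}}}}

    halves : ∀ p → p * ½ + p * ½ ≡ p
    halves = solve 1 (λ p → p :* con ½ :+ p :* con ½ := p) refl

    *-mono : ∀ {a b c d} → 0ℚ ≤ c → 0ℚ ≤ b → a ≤ b → c ≤ d → a * c ≤ b * d
    *-mono {a} {b} {c} {d} 0≤c 0≤b a≤b c≤d = ≤-trans
      (*-monoʳ-≤-nonNeg c {{nonNegative 0≤c}} a≤b)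
      (*-monoˡ-≤-nonNeg b {{nonNegative 0≤b}} c≤d)

    1+∣-∣-pos : ∀ q → 0ℚ < 1ℚ + ∣ q ∣
    1+∣-∣-pos q = subst (_< 1ℚ + ∣ q ∣) (+-identityʳ 0ℚ) (+-mono-<-≤ (positive⁻¹ 1ℚ) (0≤∣p∣ q))

    bounded : ∀ x → ∃[ B ] 0ℚ < B × ∃[ N ] ∀ n → N ℕ.≤ n → ∣ seq x n ∣ ≤ B
    bounded x with cauchy x 1ℚ (positive⁻¹ 1ℚ)
    ... | N , close = 1ℚ + ∣ seq x N ∣ , 1+∣-∣-pos (seq x N) , N , λ n N≤n → begin
      ∣ seq x n ∣                         ≡⟨ cong ∣_∣ (split (seq x n) (seq x N)) ⟩
      ∣ (seq x n - seq x N) + seq x N ∣   ≤⟨ ∣p+q∣≤∣p∣+∣q∣ (seq x n - seq x N) (seq x N) ⟩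
      ∣ seq x n - seq x N ∣ + ∣ seq x N ∣ ≤⟨ +-monoˡ-≤ ∣ seq x N ∣ (close n N N≤n ℕ.≤-refl) ⟩
      1ℚ + ∣ seq x N ∣                    ∎
      where
      open ≤-Reasoning
      split : ∀ a b → a ≡ (a - b) + b
      split = solve 2 (λ a b → a := (a :- b) :+ b) refl

  fromℚ : ℚ → ℝ
  fromℚ q = mkℝ (λ _ → q) λ ε 0<ε → 0 , λ _ _ _ _ →
    subst (_≤ ε) (cong ∣_∣ (sym (+-inverseʳ q))) (<⇒≤ 0<ε)

  0ᴿ : ℝ
  0ᴿ = fromℚ 0ℚ

  fromℕ : ℕ → ℝ
  fromℕ n = fromℚ (+ n / 1)

  infixl 6 _+ᴿ_
  infixl 7 _*ᴿ_
  infixr 8 _^ᴿ_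

  _+ᴿ_ : ℝ → ℝ → ℝ
  x +ᴿ y = mkℝ (λ n → seq x n + seq y n) +-cauchy
    where
    shuffle : ∀ a b c d → (a + b) - (c + d) ≡ (a - c) + (b - d)
    shuffle = solve 4 (λ a b c d → (a :+ b) :- (c :+ d) := (a :- c) :+ (b :- d)) refl

    +-cauchy : Cauchy (λ n → seq x n + seq y n)
    +-cauchy ε 0<ε with cauchy x (ε * ½) (*-pos 0<ε 0<½) | cauchy y (ε * ½) (*-pos 0<ε 0<½)
    ... | N , x-close | K , y-close = N ℕ.⊔ K , λ m n p q → begin
      ∣ (seq x m + seq y m) - (seq x n + seq y n) ∣
        ≡⟨ cong ∣_∣ (shuffle (seq x m) (seq y m) (seq x n) (seq y n)) ⟩
      ∣ (seq x m - seq x n) + (seq y m - seq y n) ∣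
        ≤⟨ ∣p+q∣≤∣p∣+∣q∣ (seq x m - seq x n) (seq y m - seq y n) ⟩
      ∣ seq x m - seq x n ∣ + ∣ seq y m - seq y n ∣
        ≤⟨ +-mono-≤ (x-close m n (ℕ.m⊔n≤o⇒m≤o N K p) (ℕ.m⊔n≤o⇒m≤o N K q))
                    (y-close m n (ℕ.m⊔n≤o⇒n≤o N K p) (ℕ.m⊔n≤o⇒n≤o N K q)) ⟩
      ε * ½ + ε * ½
        ≡⟨ halves ε ⟩
      ε ∎
      where open ≤-Reasoning

  private
    shrink : ∀ {ε B} → 0ℚ < ε → 0ℚ < B → ∃[ η ] 0ℚ < η × B * η ≡ ε * ½
    shrink {ε} {B} 0<ε 0<B = ε * ½ * i , *-pos (*-pos 0<ε 0<½) 0<i , (begin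
      B * (ε * ½ * i)   ≡⟨ shuffle ε B i ⟩
      ε * ½ * (B * i)   ≡⟨ cong (ε * ½ *_) (*-inverseʳ B {{>-nonZero 0<B}}) ⟩
      ε * ½ * 1ℚ        ≡⟨ *-identityʳ (ε * ½) ⟩
      ε * ½             ∎)
      where
      open ≡-Reasoning
      i : ℚ
      i = (1/ B) {{>-nonZero 0<B}}
      0<i : 0ℚ < i
      0<i = positive⁻¹ i {{1/pos⇒pos B {{positive 0<B}}}}
      shuffle : ∀ e b i → b * (e * ½ * i) ≡ e * ½ * (b * i)
      shuffle = solve 3 (λ e b i → b :* (e :* con ½ :* i) := e :* con ½ :* (b :* i)) refl

    product-close : ∀ a b c d {B D θ η} → 0ℚ < B → 0ℚ < D → ∣ a ∣ ≤ B → ∣ d ∣ ≤ D →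
                    ∣ a - c ∣ ≤ θ → ∣ b - d ∣ ≤ η → ∣ a * b - c * d ∣ ≤ B * η + D * θ
    product-close a b c d {B} {D} {θ} {η} 0<B 0<D a≤B d≤D a-c≤θ b-d≤η = begin
      ∣ a * b - c * d ∣                       ≡⟨ cong ∣_∣ (shuffle a b c d) ⟩
      ∣ a * (b - d) + d * (a - c) ∣           ≤⟨ ∣p+q∣≤∣p∣+∣q∣ (a * (b - d)) (d * (a - c)) ⟩
      ∣ a * (b - d) ∣ + ∣ d * (a - c) ∣       ≡⟨ cong₂ _+_ (∣p*q∣≡∣p∣*∣q∣ a (b - d)) (∣p*q∣≡∣p∣*∣q∣ d (a - c)) ⟩
      ∣ a ∣ * ∣ b - d ∣ + ∣ d ∣ * ∣ a - c ∣   ≤⟨ +-mono-≤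
        (*-mono (0≤∣p∣ (b - d)) (<⇒≤ 0<B) a≤B b-d≤η)
        (*-mono (0≤∣p∣ (a - c)) (<⇒≤ 0<D) d≤D a-c≤θ) ⟩
      B * η + D * θ                           ∎
      where
      open ≤-Reasoning
      shuffle : ∀ a b c d → a * b - c * d ≡ a * (b - d) + d * (a - c)
      shuffle = solve 4 (λ a b c d → a :* b :- c :* d := a :* (b :- d) :+ d :* (a :- c)) refl

  _*ᴿ_ : ℝ → ℝ → ℝ
  x *ᴿ y = mkℝ (λ n → seq x n * seq y n) *-cauchy
    where
    *-cauchy : Cauchy (λ n → seq x n * seq y n)
    *-cauchy ε 0<ε =
      let B , 0<B , N₁ , x≤B = bounded x
          D , 0<D , N₂ , y≤D = bounded y
          η , 0<η , Bη≡ε/2   = shrink 0<ε 0<B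
          θ , 0<θ , Dθ≡ε/2   = shrink 0<ε 0<D
          N₃ , x-close       = cauchy x θ 0<θ
          N₄ , y-close       = cauchy y η 0<η
      in (N₁ ℕ.⊔ N₂) ℕ.⊔ (N₃ ℕ.⊔ N₄) , λ m n p q →
        let p₁₂ = ℕ.m⊔n≤o⇒m≤o (N₁ ℕ.⊔ N₂) (N₃ ℕ.⊔ N₄) p
            p₃₄ = ℕ.m⊔n≤o⇒n≤o (N₁ ℕ.⊔ N₂) (N₃ ℕ.⊔ N₄) p
            q₁₂ = ℕ.m⊔n≤o⇒m≤o (N₁ ℕ.⊔ N₂) (N₃ ℕ.⊔ N₄) q
            q₃₄ = ℕ.m⊔n≤o⇒n≤o (N₁ ℕ.⊔ N₂) (N₃ ℕ.⊔ N₄) q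
        in ≤-trans
          (product-close (seq x m) (seq y m) (seq x n) (seq y n) 0<B 0<D
            (x≤B m (ℕ.m⊔n≤o⇒m≤o N₁ N₂ p₁₂)) (y≤D n (ℕ.m⊔n≤o⇒n≤o N₁ N₂ q₁₂))
            (x-close m n (ℕ.m⊔n≤o⇒m≤o N₃ N₄ p₃₄) (ℕ.m⊔n≤o⇒m≤o N₃ N₄ q₃₄))
            (y-close m n (ℕ.m⊔n≤o⇒n≤o N₃ N₄ p₃₄) (ℕ.m⊔n≤o⇒n≤o N₃ N₄ q₃₄)))
          (≤-reflexive (trans (cong₂ _+_ Bη≡ε/2 Dθ≡ε/2) (halves ε)))

  _^ᴿ_ : ℝ → ℕ → ℝ
  x ^ᴿ zero  = fromℚ 1ℚ
  x ^ᴿ suc k = x *ᴿ x ^ᴿ k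

  -- From index N₁ on the sequence of x is at least δ, so the maximum with δ
  -- changes only finitely many terms; it makes every term invertible.
  recip : (x : ℝ) → 0ᴿ <ᴿ x → ℝ
  recip x (δ , 0<δ , N₁ , x≥δ) = mkℝ (λ n → inv (seq x n)) inv-cauchy
    where
    open ≤-Reasoning
    pos⊔ : ∀ q → 0ℚ < q ⊔ δ
    pos⊔ q = <-≤-trans 0<δ (p≤q⊔p q δ)

    inv : ℚ → ℚ
    inv q = (1/ (q ⊔ δ)) {{>-nonZero (pos⊔ q)}}

    inv-inverse : ∀ q → (q ⊔ δ) * inv q ≡ 1ℚ
    inv-inverse q = *-inverseʳ (q ⊔ δ) {{>-nonZero (pos⊔ q)}}

    below : ∀ n → N₁ ℕ.≤ n → seq x n ⊔ δ ≡ seq x n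
    below n p = p≥q⇒p⊔q≡p (subst (_≤ seq x n) (+-identityˡ δ) (x≥δ n p))

    shuffle : ∀ a b i j → (i - j) * (a * b) ≡ (a * i) * b - (b * j) * a
    shuffle = solve 4 (λ a b i j → (i :- j) :* (a :* b) := (a :* i) :* b :- (b :* j) :* a) refl

    cross : ∀ a b i j → a * i ≡ 1ℚ → b * j ≡ 1ℚ → (i - j) * (a * b) ≡ b - a
    cross a b i j ai bj = begin-equality
      (i - j) * (a * b)           ≡⟨ shuffle a b i j ⟩
      (a * i) * b - (b * j) * a   ≡⟨ cong₂ (λ u v → u * b - v * a) ai bj ⟩
      1ℚ * b - 1ℚ * a             ≡⟨ cong₂ _-_ (*-identityˡ b) (*-identityˡ a) ⟩
      b - a                       ∎

    0<ε*δ*δ : ∀ {ε} → 0ℚ < ε → 0ℚ < ε * (δ * δ)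
    0<ε*δ*δ 0<ε = *-pos 0<ε (*-pos 0<δ 0<δ)

    inv-cauchy : Cauchy (λ n → inv (seq x n))
    inv-cauchy ε 0<ε with cauchy x (ε * (δ * δ)) (0<ε*δ*δ 0<ε)
    ... | N₂ , close = N₁ ℕ.⊔ N₂ , λ m n p q →
      let a = seq x m ⊔ δ; b = seq x n ⊔ δ
          i = inv (seq x m); j = inv (seq x n)
          0<ab = *-pos (pos⊔ (seq x m)) (pos⊔ (seq x n))
      in *-cancelʳ-≤-pos (a * b) {{positive 0<ab}} (begin
        ∣ i - j ∣ * (a * b)     ≡⟨ cong (∣ i - j ∣ *_) (0≤p⇒∣p∣≡p (<⇒≤ 0<ab)) ⟨
        ∣ i - j ∣ * ∣ a * b ∣   ≡⟨ ∣p*q∣≡∣p∣*∣q∣ (i - j) (a * b) ⟨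
        ∣ (i - j) * (a * b) ∣   ≡⟨ cong ∣_∣ (cross a b i j (inv-inverse (seq x m)) (inv-inverse (seq x n))) ⟩
        ∣ b - a ∣               ≡⟨ cong₂ (λ u v → ∣ u - v ∣) (below n (ℕ.m⊔n≤o⇒m≤o N₁ N₂ q)) (below m (ℕ.m⊔n≤o⇒m≤o N₁ N₂ p)) ⟩
        ∣ seq x n - seq x m ∣   ≤⟨ close n m (ℕ.m⊔n≤o⇒n≤o N₁ N₂ q) (ℕ.m⊔n≤o⇒n≤o N₁ N₂ p) ⟩
        ε * (δ * δ)             ≤⟨ *-monoˡ-≤-nonNeg ε {{nonNegative (<⇒≤ 0<ε)}}
                                   (*-mono (<⇒≤ 0<δ) (<⇒≤ (pos⊔ (seq x m))) (p≤q⊔p (seq x m) δ) (p≤q⊔p (seq x n) δ)) ⟩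
        ε * (a * b)             ∎)

  -- The sum of x ^ i / i ! over i < k.
  expSum : ℕ → ℝ → ℝ
  expSum zero    x = fromℚ 0ℚ
  expSum (suc k) x = expSum k x +ᴿ x ^ᴿ k *ᴿ fromℚ ((+ 1 / k !) {{k !≢0}})


  private
    pow : ℚ → ℕ → ℚ
    pow q zero    = 1ℚ
    pow q (suc k) = q * pow q k

    1/! : ℕ → ℚ
    1/! k = (+ 1 / k !) {{k !≢0}}

    term : ℚ → ℕ → ℚ
    term q k = pow q k * 1/! k

    partialSum : ℚ → ℕ → ℚ
    partialSum q zero    = 0ℚ
    partialSum q (suc k) = partialSum q k + term q k

    seq-pow : ∀ x k n → seq (x ^ᴿ k) n ≡ pow (seq x n) k
    seq-pow x zero    n = refl
    seq-pow x (suc k) n = cong (seq x n *_) (seq-pow x k n)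

    seq-expSum : ∀ x k n → seq (expSum k x) n ≡ partialSum (seq x n) k
    seq-expSum x zero    n = refl
    seq-expSum x (suc k) n = cong₂ (λ u v → u + v * 1/! k) (seq-expSum x k n) (seq-pow x k n)

    1/-homo : ∀ m n .{{_ : ℕ.NonZero m}} .{{_ : ℕ.NonZero n}} .{{_ : ℕ.NonZero (m ℕ.* n)}} →
              + 1 / (m ℕ.* n) ≡ (+ 1 / m) * (+ 1 / n)
    1/-homo (suc m) (suc n) = toℚᵘ-injective (ℚᵘ.≃-trans
      (toℚᵘ-fromℚᵘ (mkℚᵘ (+ 1) (n ℕ.+ m ℕ.* suc n)))
      (ℚᵘ.≃-sym (ℚᵘ.≃-trans (toℚᵘ-homo-* (+ 1 / suc m) (+ 1 / suc n))
        (ℚᵘ.*-cong (toℚᵘ-fromℚᵘ (mkℚᵘ (+ 1) m)) (toℚᵘ-fromℚᵘ (mkℚᵘ (+ 1) n))))))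

    n/1*1/n : ∀ n .{{_ : ℕ.NonZero n}} → (+ n / 1) * (+ 1 / n) ≡ 1ℚ
    n/1*1/n (suc n) = toℚᵘ-injective (ℚᵘ.≃-trans
      (ℚᵘ.≃-trans (toℚᵘ-homo-* (+ suc n / 1) (+ 1 / suc n))
        (ℚᵘ.*-cong (toℚᵘ-fromℚᵘ (mkℚᵘ (+ suc n) 0)) (toℚᵘ-fromℚᵘ (mkℚᵘ (+ 1) n))))
      (ℚᵘ.*≡* (cong +_ (cong suc (trans (ℕ.*-identityʳ (n ℕ.* 1)) (trans (ℕ.*-identityʳ n)
        (sym (trans (ℕ.+-identityʳ (n ℕ.+ 0)) (ℕ.+-identityʳ n)))))))))


    /1-mono : ∀ {m n} → m ℕ.≤ n → (+ m / 1) ≤ (+ n / 1)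
    /1-mono {m} {n} m≤n = toℚᵘ-cancel-≤ (begin
      toℚᵘ (+ m / 1)   ≃⟨ toℚᵘ-fromℚᵘ (mkℚᵘ (+ m) 0) ⟩
      mkℚᵘ (+ m) 0     ≤⟨ ℚᵘ.*≤* (ℤ.*-monoʳ-≤-nonNeg (+ 1) (ℤ.+≤+ m≤n)) ⟩
      mkℚᵘ (+ n) 0     ≃⟨ toℚᵘ-fromℚᵘ (mkℚᵘ (+ n) 0) ⟨
      toℚᵘ (+ n / 1)   ∎)
      where open ℚᵘ.≤-Reasoning

    /1-suc : ∀ n → + suc n / 1 ≡ 1ℚ + (+ n / 1)
    /1-suc n = toℚᵘ-injective (ℚᵘ.≃-trans (toℚᵘ-fromℚᵘ (mkℚᵘ (+ suc n) 0)) (ℚᵘ.≃-sym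
      (ℚᵘ.≃-trans (toℚᵘ-homo-+ 1ℚ (+ n / 1))
        (ℚᵘ.≃-trans (ℚᵘ.+-congʳ (toℚᵘ 1ℚ) (toℚᵘ-fromℚᵘ (mkℚᵘ (+ n) 0)))
          (ℚᵘ.*≡* (cong (ℤ._* (+ 1)) (cong (λ i → + 1 ℤ.+ i) (ℤ.*-identityʳ (+ n)))))))))

    archimedean : ∀ q → ∃[ n ] q ≤ (+ n / 1)
    archimedean q@(mkℚ n d _) = ℤ.∣ n ∣ , toℚᵘ-cancel-≤ (begin
      toℚᵘ q                   ≤⟨ ℚᵘ.*≤* (bound n) ⟩
      mkℚᵘ (+ ℤ.∣ n ∣) 0       ≃⟨ toℚᵘ-fromℚᵘ (mkℚᵘ (+ ℤ.∣ n ∣) 0) ⟨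
      toℚᵘ (+ ℤ.∣ n ∣ / 1)     ∎)
      where
      open ℚᵘ.≤-Reasoning
      bound : ∀ n → n ℤ.* + 1 ℤ.≤ + ℤ.∣ n ∣ ℤ.* +[1+ d ]
      bound (+ k)    = ℤ.*-monoˡ-≤-nonNeg (+ k) (ℤ.+≤+ (ℕ.s≤s ℕ.z≤n))
      bound -[1+ k ] = ℤ.-≤+

    ½^j*j≤1 : ∀ j → pow ½ j ≤ 1ℚ × 0ℚ ≤ pow ½ j × pow ½ j * (+ j / 1) ≤ 1ℚ
    ½^j*j≤1 zero    = ≤-refl , <⇒≤ (positive⁻¹ 1ℚ) , <⇒≤ (positive⁻¹ 1ℚ)
    ½^j*j≤1 (suc j) with ½^j*j≤1 j
    ... | h≤1 , 0≤h , hj≤1 =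
        ≤-trans (*-mono 0≤h (<⇒≤ (positive⁻¹ 1ℚ)) ½≤1 h≤1) (≤-reflexive (*-identityˡ 1ℚ))
      , subst (_≤ ½ * pow ½ j) (*-zeroʳ ½) (*-monoˡ-≤-nonNeg ½ 0≤h)
      , (begin
        ½ * pow ½ j * (+ suc j / 1)       ≡⟨ cong (½ * pow ½ j *_) (/1-suc j) ⟩
        ½ * pow ½ j * (1ℚ + (+ j / 1))      ≡⟨ shuffle (pow ½ j) (+ j / 1) ⟩
        ½ * (pow ½ j + pow ½ j * (+ j / 1)) ≤⟨ *-monoˡ-≤-nonNeg ½ (+-mono-≤ h≤1 hj≤1) ⟩
        ½ * (1ℚ + 1ℚ)                     ≡⟨⟩
        1ℚ                                ∎)
      where
      open ≤-Reasoning
      ½≤1 : ½ ≤ 1ℚ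
      ½≤1 = *≤* (ℤ.+≤+ (ℕ.s≤s ℕ.z≤n))
      shuffle : ∀ h j → ½ * h * (1ℚ + j) ≡ ½ * (h + h * j)
      shuffle = solve 2 (λ h j → con ½ :* h :* (con 1ℚ :+ j) := con ½ :* (h :+ h :* j)) refl

    ½^j-small : ∀ A {η} → 0ℚ < η → ∃[ j ] pow ½ j * A ≤ η
    ½^j-small A {η} 0<η = j , (begin
      h * A                   ≡⟨ cong (h *_) A≡ ⟩
      h * (A * i * η)         ≤⟨ *-monoˡ-≤-nonNeg h {{nonNegative 0≤h}} (*-monoʳ-≤-nonNeg η {{nonNegative (<⇒≤ 0<η)}} (proj₂ (archimedean (A * i)))) ⟩
      h * ((+ j / 1) * η)     ≡⟨ *-assoc h (+ j / 1) η ⟨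
      h * (+ j / 1) * η       ≤⟨ *-monoʳ-≤-nonNeg η {{nonNegative (<⇒≤ 0<η)}} (proj₂ (proj₂ (½^j*j≤1 j))) ⟩
      1ℚ * η                  ≡⟨ *-identityˡ η ⟩
      η                       ∎)
      where
      open ≤-Reasoning
      i : ℚ
      i = (1/ η) {{>-nonZero 0<η}}
      j : ℕ
      j = proj₁ (archimedean (A * i))
      h : ℚ
      h = pow ½ j
      0≤h : 0ℚ ≤ h
      0≤h = proj₁ (proj₂ (½^j*j≤1 j))
      A≡ : A ≡ A * i * η
      A≡ = sym (trans (*-assoc A i η) (trans (cong (A *_) (*-inverseˡ η {{>-nonZero 0<η}})) (*-identityʳ A)))

    -- Once k ≥ 2B, consecutive terms of the series at |q| ≤ B at least halve.
    module Tail {B : ℚ} (0<B : 0ℚ < B) (K : ℕ) (2B≤K : B + B ≤ (+ K / 1))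
                (q : ℚ) (q≤B : ∣ q ∣ ≤ B) where
      open ≤-Reasoning

      halving : ∀ k → K ℕ.≤ k → ∣ term q (suc k) ∣ ≤ ½ * ∣ term q k ∣
      halving k K≤k = begin
        ∣ q * pow q k * 1/! (suc k) ∣       ≡⟨ cong (λ c → ∣ q * pow q k * c ∣) (1/-homo (suc k) (k !) {{_}} {{k !≢0}} {{suc k !≢0}}) ⟩
        ∣ q * pow q k * (r * 1/! k) ∣       ≡⟨ cong ∣_∣ (shuffle q (pow q k) r (1/! k)) ⟩
        ∣ (q * r) * term q k ∣              ≡⟨ ∣p*q∣≡∣p∣*∣q∣ (q * r) (term q k) ⟩
        ∣ q * r ∣ * ∣ term q k ∣            ≤⟨ *-monoʳ-≤-nonNeg ∣ term q k ∣ {{∣-∣-nonNeg (term q k)}} qr≤½ ⟩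
        ½ * ∣ term q k ∣                    ∎
        where
        r : ℚ
        r = + 1 / suc k
        0≤r : 0ℚ ≤ r
        0≤r = nonNegative⁻¹ r {{normalize-nonNeg 1 (suc k)}}
        shuffle : ∀ q p r c → q * p * (r * c) ≡ (q * r) * (p * c)
        shuffle = solve 4 (λ q p r c → q :* p :* (r :* c) := (q :* r) :* (p :* c)) refl
        double : ∀ b r → b * r ≡ ½ * ((b + b) * r)
        double = solve 2 (λ b r → b :* r := con ½ :* ((b :+ b) :* r)) refl
        qr≤½ : ∣ q * r ∣ ≤ ½
        qr≤½ = begin
          ∣ q * r ∣                      ≡⟨ trans (∣p*q∣≡∣p∣*∣q∣ q r) (cong (∣ q ∣ *_) (0≤p⇒∣p∣≡p 0≤r)) ⟩
          ∣ q ∣ * r                      ≤⟨ *-monoʳ-≤-nonNeg r {{nonNegative 0≤r}} q≤B ⟩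
          B * r                          ≡⟨ double B r ⟩
          ½ * ((B + B) * r)              ≤⟨ *-monoˡ-≤-nonNeg ½ (*-monoʳ-≤-nonNeg r {{nonNegative 0≤r}} (≤-trans 2B≤K (/1-mono (ℕ.m≤n⇒m≤1+n K≤k)))) ⟩
          ½ * ((+ suc k / 1) * r)        ≡⟨ cong (½ *_) (n/1*1/n (suc k)) ⟩
          ½ * 1ℚ                         ≡⟨ *-identityʳ ½ ⟩
          ½                              ∎

      decay : ∀ j → ∣ term q (j ℕ.+ K) ∣ ≤ pow ½ j * ∣ term q K ∣
      decay zero    = ≤-reflexive (sym (*-identityˡ ∣ term q K ∣))
      decay (suc j) = begin
        ∣ term q (suc (j ℕ.+ K)) ∣        ≤⟨ halving (j ℕ.+ K) (ℕ.m≤n+m K j) ⟩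
        ½ * ∣ term q (j ℕ.+ K) ∣          ≤⟨ *-monoˡ-≤-nonNeg ½ (decay j) ⟩
        ½ * (pow ½ j * ∣ term q K ∣)      ≡⟨ *-assoc ½ (pow ½ j) ∣ term q K ∣ ⟨
        ½ * pow ½ j * ∣ term q K ∣        ∎

      2∣term∣ : ℕ → ℚ
      2∣term∣ k = ∣ term q k ∣ + ∣ term q k ∣

      tail+ : ∀ n → K ℕ.≤ n → ∀ j →
              ∣ partialSum q (j ℕ.+ n) - partialSum q n ∣ + 2∣term∣ (j ℕ.+ n) ≤ 2∣term∣ n
      tail+ n K≤n zero = ≤-reflexive (trans
        (cong (λ u → ∣ u ∣ + 2∣term∣ n) (+-inverseʳ (partialSum q n))) (+-identityˡ (2∣term∣ n)))
      tail+ n K≤n (suc j) = begin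
        ∣ (s + t) - s₀ ∣ + (∣ t′ ∣ + ∣ t′ ∣)   ≡⟨ cong (λ u → ∣ u ∣ + (∣ t′ ∣ + ∣ t′ ∣)) (swap s t s₀) ⟩
        ∣ (s - s₀) + t ∣ + (∣ t′ ∣ + ∣ t′ ∣)   ≤⟨ +-mono-≤ (∣p+q∣≤∣p∣+∣q∣ (s - s₀) t) (+-mono-≤ t′≤t/2 t′≤t/2) ⟩
        (∣ s - s₀ ∣ + ∣ t ∣) + (½ * ∣ t ∣ + ½ * ∣ t ∣) ≡⟨ regroup ∣ s - s₀ ∣ ∣ t ∣ ⟩
        ∣ s - s₀ ∣ + (∣ t ∣ + ∣ t ∣)           ≤⟨ tail+ n K≤n j ⟩
        2∣term∣ n                              ∎
        where
        s s₀ t t′ : ℚ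
        s  = partialSum q (j ℕ.+ n)
        s₀ = partialSum q n
        t  = term q (j ℕ.+ n)
        t′ = term q (suc (j ℕ.+ n))
        t′≤t/2 : ∣ t′ ∣ ≤ ½ * ∣ t ∣
        t′≤t/2 = halving (j ℕ.+ n) (ℕ.≤-trans K≤n (ℕ.m≤n+m n j))
        swap : ∀ a b c → (a + b) - c ≡ (a - c) + b
        swap = solve 3 (λ a b c → (a :+ b) :- c := (a :- c) :+ b) refl
        regroup : ∀ d t → (d + t) + (½ * t + ½ * t) ≡ d + (t + t)
        regroup = solve 2 (λ d t → (d :+ t) :+ (con ½ :* t :+ con ½ :* t) := d :+ (t :+ t)) refl

      tail : ∀ {n m} → K ℕ.≤ n → n ℕ.≤ m → ∣ partialSum q m - partialSum q n ∣ ≤ 2∣term∣ n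
      tail {n} {m} K≤n n≤m = begin
        ∣ partialSum q m - partialSum q n ∣                       ≡⟨ cong (λ k → ∣ partialSum q k - partialSum q n ∣) (ℕ.m∸n+n≡m n≤m) ⟨
        ∣ partialSum q (j ℕ.+ n) - partialSum q n ∣               ≡⟨ +-identityʳ _ ⟨
        ∣ partialSum q (j ℕ.+ n) - partialSum q n ∣ + 0ℚ          ≤⟨ +-monoʳ-≤ ∣ partialSum q (j ℕ.+ n) - partialSum q n ∣ 0≤2t ⟩
        ∣ partialSum q (j ℕ.+ n) - partialSum q n ∣ + 2∣term∣ (j ℕ.+ n)   ≤⟨ tail+ n K≤n j ⟩
        2∣term∣ n                                   ∎
        where
        j : ℕ
        j = m ℕ.∸ n
        0≤2t : 0ℚ ≤ 2∣term∣ (j ℕ.+ n)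
        0≤2t = subst (_≤ 2∣term∣ (j ℕ.+ n)) (+-identityʳ 0ℚ) (+-mono-≤ (0≤∣p∣ (term q (j ℕ.+ n))) (0≤∣p∣ (term q (j ℕ.+ n))))

  -- The diagonal of the partial sums represents the sum of the exponential
  -- series, by the tail estimate above.
  exp : ℝ → ℝ
  exp x = mkℝ (λ n → seq (expSum n x) n) exp-cauchy
    where
    open ≤-Reasoning
    exp-cauchy : Cauchy (λ n → seq (expSum n x) n)
    exp-cauchy ε 0<ε =
      let B , 0<B , N₁ , x≤B = bounded x
          K , 2B≤K           = archimedean (B + B)
          A , 0<A , N₂ , t≤A = bounded (x ^ᴿ K *ᴿ fromℚ (1/! K))
          J , small          = ½^j-small A (*-pos (*-pos (*-pos 0<ε 0<½) 0<½) 0<½)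
          L                  = J ℕ.+ K
          N₃ , close         = cauchy (expSum L x) (ε * ½) (*-pos 0<ε 0<½)
          N                  = (N₁ ℕ.⊔ N₂) ℕ.⊔ (N₃ ℕ.⊔ L)
          tail≤ : ∀ m → N ℕ.≤ m → ∣ partialSum (seq x m) m - partialSum (seq x m) L ∣ ≤ ε * ½ * ½
          tail≤ m N≤m =
            let q     = seq x m
                N₁₂≤m = ℕ.m⊔n≤o⇒m≤o (N₁ ℕ.⊔ N₂) (N₃ ℕ.⊔ L) N≤m
                N₃L≤m = ℕ.m⊔n≤o⇒n≤o (N₁ ℕ.⊔ N₂) (N₃ ℕ.⊔ L) N≤m
                q≤B   = x≤B m (ℕ.m⊔n≤o⇒m≤o N₁ N₂ N₁₂≤m)
                tK≤A  = subst (λ p → ∣ p * 1/! K ∣ ≤ A) (seq-pow x K m) (t≤A m (ℕ.m⊔n≤o⇒n≤o N₁ N₂ N₁₂≤m))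
                tL≤   = ≤-trans (Tail.decay 0<B K 2B≤K q q≤B J)
                          (≤-trans (*-monoˡ-≤-nonNeg (pow ½ J) {{nonNegative (proj₁ (proj₂ (½^j*j≤1 J)))}} tK≤A) small)
            in ≤-trans (Tail.tail 0<B K 2B≤K q q≤B (ℕ.m≤n+m K J) (ℕ.m⊔n≤o⇒n≤o N₃ L N₃L≤m))
                 (≤-trans (+-mono-≤ tL≤ tL≤) (≤-reflexive (halves (ε * ½ * ½))))
          middle≤ : ∀ m n → N ℕ.≤ m → N ℕ.≤ n → ∣ partialSum (seq x m) L - partialSum (seq x n) L ∣ ≤ ε * ½
          middle≤ m n N≤m N≤n = subst₂ (λ u v → ∣ u - v ∣ ≤ ε * ½) (seq-expSum x L m) (seq-expSum x L n)
            (close m n (ℕ.m⊔n≤o⇒m≤o N₃ L (ℕ.m⊔n≤o⇒n≤o (N₁ ℕ.⊔ N₂) (N₃ ℕ.⊔ L) N≤m))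
                       (ℕ.m⊔n≤o⇒m≤o N₃ L (ℕ.m⊔n≤o⇒n≤o (N₁ ℕ.⊔ N₂) (N₃ ℕ.⊔ L) N≤n)))
      in N , λ m n N≤m N≤n → subst₂ (λ u v → ∣ u - v ∣ ≤ ε)
        (sym (seq-expSum x m m)) (sym (seq-expSum x n n))
        (three (partialSum (seq x m) m) (partialSum (seq x m) L) (partialSum (seq x n) L) (partialSum (seq x n) n) ε
          (tail≤ m N≤m) (middle≤ m n N≤m N≤n) (tail≤ n N≤n))
      where
      shuffle : ∀ a b c d → a - d ≡ (a - b) + ((b - c) + - (d - c))
      shuffle = solve 4 (λ a b c d → a :- d := (a :- b) :+ ((b :- c) :+ :- (d :- c))) refl
      quarters : ∀ ε → ε * ½ * ½ + (ε * ½ + ε * ½ * ½) ≡ ε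
      quarters = solve 1 (λ ε → ε :* con ½ :* con ½ :+ (ε :* con ½ :+ ε :* con ½ :* con ½) := ε) refl
      three : ∀ a b c d ε → ∣ a - b ∣ ≤ ε * ½ * ½ → ∣ b - c ∣ ≤ ε * ½ → ∣ d - c ∣ ≤ ε * ½ * ½ → ∣ a - d ∣ ≤ ε
      three a b c d ε p q r = begin
        ∣ a - d ∣                                   ≡⟨ cong ∣_∣ (shuffle a b c d) ⟩
        ∣ (a - b) + ((b - c) + - (d - c)) ∣         ≤⟨ ∣p+q∣≤∣p∣+∣q∣ (a - b) ((b - c) + - (d - c)) ⟩
        ∣ a - b ∣ + ∣ (b - c) + - (d - c) ∣         ≤⟨ +-monoʳ-≤ ∣ a - b ∣ (∣p+q∣≤∣p∣+∣q∣ (b - c) (- (d - c))) ⟩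
        ∣ a - b ∣ + (∣ b - c ∣ + ∣ - (d - c) ∣)     ≡⟨ cong (λ u → ∣ a - b ∣ + (∣ b - c ∣ + u)) (∣-p∣≡∣p∣ (d - c)) ⟩
        ∣ a - b ∣ + (∣ b - c ∣ + ∣ d - c ∣)         ≤⟨ +-mono-≤ p (+-mono-≤ q r) ⟩
        ε * ½ * ½ + (ε * ½ + ε * ½ * ½)             ≡⟨ quarters ε ⟩
        ε                                           ∎

  -- The natural logarithm as the inverse of exp: a partial function, given by
  -- its graph.
  IsLog : ℝ → ℝ → Set
  IsLog x y = exp y ≃ᴿ x

  IsFloor : ℝ → ℕ → Set
  IsFloor x N = fromℕ N ≤ᴿ x × x <ᴿ fromℕ (suc N)

{-# OPTIONS --safe #-}
-- Write n ≤ x as b r, where the prime factors of b are below y and those of r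
-- are not, with log y of order (log log x)². Since M is submultiplicative and
-- M(b) ≤ 1 + log₂ b, whose average is O(log y) by Mertens' argument, it suffices
-- that r divides a sum of a bounded number of powers of 2, outside a set of n of
-- density O(1 / log x), where M(n) = O(log x) is enough.
--
-- A prime p divides a sum of boundedly many powers of 2 ^ V unless there are
-- many coincidences modulo p between sums of H powers of 2 ^ V: this is a second
-- moment estimate for point-line incidences over ℤ/p. Each coincidence makes p
-- divide a nonzero integer with few prime factors, so such primes are rare.
--
-- For most n, the numbers p − 1 for the primes p dividing r have small pairwise
-- greatest common divisors. Hence V = gcd (p − 1) (∏ (q − 1)), over the other
-- primes q, is small, and the solutions for the single p, whose exponents are
-- multiples of V and matter modulo p − 1, combine to one for r by the Chinese
-- remainder theorem, without more summands.
module Submission where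

open import Defs
open import Data.Product using (∃-syntax; _×_; proj₁; proj₂)

-- The size of `V` is the obstacle that fixes y. A typical r has O(log log x) prime factors, and
-- their pairwise gcds are only known to be below a fixed power of log x, so `V` may be as large as
-- 2 to a multiple of (log log x)². Since `V` depends on all primes of r, a prime is acceptable only
-- if it works for every `V` up to some Z of that size, and the counting argument applies to primes
-- of about Z ^ e. All smaller primes are left to b. The exponents obey three constraints. Let every
-- sum have H powers, with Z choices for each exponent, and let there be Z ^ u multipliers. The
-- second moment needs p ^ 3 below Z ^ (u + 3 H). Coincidences exclude about Z ^ (H + 3) primes of a
-- block, and a small order of 2 ^ `V` excludes about Z ^ (2 u + 2). Both numbers have to be at most
-- Z ^ (e - 1): then the reciprocals of the excluded primes of a block add up to O(1 / Z), and those
-- of all blocks to O(1 / log x). Large u, with H close to 2 u and e close to H, makes this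
-- possible, because u then outweighs the constant losses.

-- Finite sums, double counting and counts of multiples.

module Sums where

  open import Data.List.Base using (List; []; _∷_; _++_; length; map; upTo; cartesianProductWith)
  open import Data.List.Membership.Propositional using (_∈_)
  open import Data.List.Membership.Propositional.Properties using (∈-upTo⁻)
  open import Data.List.Properties using (length-upTo; map-++; map-∘; upTo-∷ʳ)
  open import Data.List.Relation.Unary.All as All using (All)
  open import Data.List.Relation.Unary.AllPairs.Core using ([]; _∷_)
  open import Data.List.Relation.Unary.Any using (here; there)
  open import Data.List.Relation.Unary.Unique.Propositional using (Unique)
  open import Data.Nat.Base
  open import Data.Nat.DivMod
  open import Data.Nat.Divisibility using (_∣_; _∣?_; divides)
  open import Data.Nat.ListAction using (sum)
  open import Data.Nat.ListAction.Properties using (sum-++)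
  open import Data.Nat.Properties
  open import Algebra.Properties.CommutativeSemigroup +-commutativeSemigroup using (interchange)
  open import Data.Product.Base using (_×_; _,_)
  open import Function.Base using (_∘_)
  open import Relation.Binary.PropositionalEquality
  open import Relation.Nullary using (Dec; yes; no; ¬_; contradiction)

  private variable
    A B C : Set
    P Q : Set

  ∑ : List A → (A → ℕ) → ℕ
  ∑ xs f = sum (map f xs)

  infix 5 ∑
  syntax ∑ xs (λ x → e) = ∑[ x ∈ xs ] e

  -- The Iverson bracket. Primes, divisors and coincidences are all counted by sums of brackets, so
  -- that double counting becomes an instance of `∑-swap`.
  ⟦_⟧ : Dec P → ℕ
  ⟦ yes _ ⟧ = 1
  ⟦ no  _ ⟧ = 0

  ⟦⟧≤1 : (d : Dec P) → ⟦ d ⟧ ≤ 1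
  ⟦⟧≤1 (yes _) = ≤-refl
  ⟦⟧≤1 (no  _) = z≤n

  ⟦⟧-true : (d : Dec P) → P → ⟦ d ⟧ ≡ 1
  ⟦⟧-true (yes _) p = refl
  ⟦⟧-true (no ¬p) p = contradiction p ¬p

  ⟦⟧-false : (d : Dec P) → ¬ P → ⟦ d ⟧ ≡ 0
  ⟦⟧-false (yes p) ¬p = contradiction p ¬p
  ⟦⟧-false (no _)  ¬p = refl

  ⟦⟧≡0⇒¬ : (d : Dec P) → ⟦ d ⟧ ≡ 0 → ¬ P
  ⟦⟧≡0⇒¬ (no ¬p) _ = ¬p

  ⟦⟧-bound : (d : Dec P) → ∀ {n} → (P → 1 ≤ n) → ⟦ d ⟧ ≤ n
  ⟦⟧-bound (yes p) f = f p
  ⟦⟧-bound (no _)  f = z≤n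

  ⟦⟧-mono : (d : Dec P) (e : Dec Q) → (P → Q) → ⟦ d ⟧ ≤ ⟦ e ⟧
  ⟦⟧-mono d e f = ⟦⟧-bound d (λ p → ≤-reflexive (sym (⟦⟧-true e (f p))))

  ∑-mono : ∀ (xs : List A) {f g : A → ℕ} → (∀ {x} → x ∈ xs → f x ≤ g x) → ∑ xs f ≤ ∑ xs g
  ∑-mono []       h = z≤n
  ∑-mono (x ∷ xs) h = +-mono-≤ (h (here refl)) (∑-mono xs (h ∘ there))

  ∑-cong : ∀ (xs : List A) {f g : A → ℕ} → (∀ {x} → x ∈ xs → f x ≡ g x) → ∑ xs f ≡ ∑ xs g
  ∑-cong []       h = refl
  ∑-cong (x ∷ xs) h = cong₂ _+_ (h (here refl)) (∑-cong xs (h ∘ there))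

  ∑-+ : ∀ (xs : List A) (f g : A → ℕ) → ∑ xs (λ x → f x + g x) ≡ ∑ xs f + ∑ xs g
  ∑-+ []       f g = refl
  ∑-+ (x ∷ xs) f g = trans (cong (f x + g x +_) (∑-+ xs f g)) (interchange (f x) (g x) (∑ xs f) (∑ xs g))

  ∑-*ˡ : ∀ (xs : List A) c (f : A → ℕ) → ∑ xs (λ x → c * f x) ≡ c * ∑ xs f
  ∑-*ˡ []       c f = sym (*-zeroʳ c)
  ∑-*ˡ (x ∷ xs) c f = trans (cong (c * f x +_) (∑-*ˡ xs c f)) (sym (*-distribˡ-+ c (f x) (∑ xs f)))

  ∑-*ʳ : ∀ (xs : List A) (f : A → ℕ) c → ∑ xs (λ x → f x * c) ≡ ∑ xs f * c
  ∑-*ʳ xs f c = trans (∑-cong xs (λ {x} _ → *-comm (f x) c)) (trans (∑-*ˡ xs c f) (*-comm c (∑ xs f)))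

  ∑-const : ∀ (xs : List A) c → ∑ xs (λ _ → c) ≡ length xs * c
  ∑-const []       c = refl
  ∑-const (x ∷ xs) c = cong (c +_) (∑-const xs c)

  ∑-bound : ∀ (xs : List A) {f : A → ℕ} {c} → (∀ {x} → x ∈ xs → f x ≤ c) → ∑ xs f ≤ length xs * c
  ∑-bound xs {f} {c} h = ≤-trans (∑-mono xs h) (≤-reflexive (∑-const xs c))

  ∑-swap : ∀ (xs : List A) (ys : List B) (f : A → B → ℕ) →
           ∑ xs (λ x → ∑ ys (f x)) ≡ ∑ ys (λ y → ∑ xs (λ x → f x y))
  ∑-swap []       ys f = trans (sym (*-zeroʳ (length ys))) (sym (∑-const ys 0))
  ∑-swap (x ∷ xs) ys f = trans (cong (∑ ys (f x) +_) (∑-swap xs ys f)) (sym (∑-+ ys (f x) _))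

  ∑-++ : ∀ (xs ys : List A) (f : A → ℕ) → ∑ (xs ++ ys) f ≡ ∑ xs f + ∑ ys f
  ∑-++ xs ys f = trans (cong sum (map-++ f xs ys)) (sum-++ (map f xs) (map f ys))

  ∑-map : ∀ (g : A → B) xs (f : B → ℕ) → ∑ (map g xs) f ≡ ∑ xs (f ∘ g)
  ∑-map g xs f = cong sum (sym (map-∘ xs))

  ∑-cartesian : ∀ (g : A → B → C) xs ys (f : C → ℕ) →
                ∑ (cartesianProductWith g xs ys) f ≡ ∑ xs (λ x → ∑ ys (λ y → f (g x y)))
  ∑-cartesian g []       ys f = refl
  ∑-cartesian g (x ∷ xs) ys f = trans (∑-++ (map (g x) ys) _ f)
    (cong₂ _+_ (∑-map (g x) ys f) (∑-cartesian g xs ys f))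

  ∑*∑ : ∀ (xs : List A) (ys : List B) f g → ∑ xs f * ∑ ys g ≡ ∑ xs (λ x → ∑ ys (λ y → f x * g y))
  ∑*∑ xs ys f g = trans (sym (∑-*ʳ xs f (∑ ys g))) (∑-cong xs (λ {x} _ → sym (∑-*ˡ ys (f x) g)))

  term≤∑ : ∀ {xs : List A} (f : A → ℕ) {x} → x ∈ xs → f x ≤ ∑ xs f
  term≤∑ f (here refl)       = m≤m+n _ _
  term≤∑ {xs = y ∷ xs} f (there x∈xs) = ≤-trans (term≤∑ f x∈xs) (m≤n+m _ (f y))

  ∑≡0⇒ : ∀ {xs : List A} (f : A → ℕ) {x} → ∑ xs f ≡ 0 → x ∈ xs → f x ≡ 0
  ∑≡0⇒ f eq x∈xs = n≤0⇒n≡0 (subst (f _ ≤_) eq (term≤∑ f x∈xs))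

  ∑-upTo-suc : ∀ n (f : ℕ → ℕ) → ∑ (upTo (suc n)) f ≡ ∑ (upTo n) f + f n
  ∑-upTo-suc n f = trans (cong (λ xs → ∑ xs f) (sym (upTo-∷ʳ n)))
    (trans (∑-++ (upTo n) (n ∷ []) f) (cong (∑ (upTo n) f +_) (+-identityʳ (f n))))

  ∑-upTo-+ : ∀ m n (f : ℕ → ℕ) → ∑ (upTo (m + n)) f ≡ ∑ (upTo m) f + ∑ (upTo n) (λ i → f (m + i))
  ∑-upTo-+ m zero    f = trans (cong (λ k → ∑ (upTo k) f) (+-identityʳ m)) (sym (+-identityʳ _))
  ∑-upTo-+ m (suc n) f = begin
    ∑ (upTo (m + suc n)) f  ≡⟨ cong (λ k → ∑ (upTo k) f) (+-suc m n) ⟩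
    ∑ (upTo (suc (m + n))) f  ≡⟨ ∑-upTo-suc (m + n) f ⟩
    ∑ (upTo (m + n)) f + f (m + n)  ≡⟨ cong (_+ f (m + n)) (∑-upTo-+ m n f) ⟩
    ∑ (upTo m) f + ∑ (upTo n) (λ i → f (m + i)) + f (m + n)  ≡⟨ +-assoc (∑ (upTo m) f) _ _ ⟩
    ∑ (upTo m) f + (∑ (upTo n) (λ i → f (m + i)) + f (m + n))  ≡⟨ cong (∑ (upTo m) f +_) (∑-upTo-suc n (λ i → f (m + i))) ⟨
    ∑ (upTo m) f + ∑ (upTo (suc n)) (λ i → f (m + i))  ∎
    where open ≡-Reasoning

  ∑-upTo-bound : ∀ n {f : ℕ → ℕ} {c} → (∀ {i} → i < n → f i ≤ c) → ∑ (upTo n) f ≤ n * c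
  ∑-upTo-bound n {f} {c} h = subst (λ k → ∑ (upTo n) f ≤ k * c) (length-upTo n) (∑-bound (upTo n) (λ i∈ → h (∈-upTo⁻ i∈)))

  ∑-unique : ∀ {xs : List A} → Unique xs → ∀ {R : A → Set} (R? : ∀ x → Dec (R x)) →
             (∀ {x y} → x ∈ xs → y ∈ xs → R x → R y → x ≡ y) → ∑ xs (λ x → ⟦ R? x ⟧) ≤ 1
  ∑-unique []         R? eq = z≤n
  ∑-unique {xs = x ∷ xs} (x∉ ∷ un) R? eq with R? x
  ... | no _  = ∑-unique un R? (λ x∈ y∈ → eq (there x∈) (there y∈))
  ... | yes r = ≤-reflexive (cong suc (trans (∑-cong xs (λ {y} y∈ → ⟦⟧-false (R? y)
                  (λ s → All.lookup x∉ y∈ (eq (here refl) (there y∈) r s))))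
                  (trans (∑-const xs 0) (*-zeroʳ (length xs)))))

  -- Counts the pairs of equal entries in two ways: each entry of `xs` occurs in `ys`, and without
  -- repetitions in `xs` each entry of `ys` is hit at most once.
  length≤∑ : ∀ {xs ys : List ℕ} → Unique xs → ∀ {R : ℕ → Set} (R? : ∀ x → Dec (R x)) →
             (∀ {x} → x ∈ xs → x ∈ ys × R x) → length xs ≤ ∑[ y ∈ ys ] ⟦ R? y ⟧
  length≤∑ {xs} {ys} un R? sub = begin
    length xs  ≡⟨ trans (∑-const xs 1) (*-identityʳ _) ⟨
    (∑[ x ∈ xs ] 1)  ≤⟨ ∑-mono xs hit ⟩
    (∑[ x ∈ xs ] ∑[ y ∈ ys ] (⟦ x ≟ y ⟧ * ⟦ R? y ⟧))  ≡⟨ ∑-swap xs ys _ ⟩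
    (∑[ y ∈ ys ] ∑[ x ∈ xs ] (⟦ x ≟ y ⟧ * ⟦ R? y ⟧))  ≡⟨ ∑-cong ys (λ {y} _ → ∑-*ʳ xs (λ x → ⟦ x ≟ y ⟧) ⟦ R? y ⟧) ⟩
    (∑[ y ∈ ys ] (∑[ x ∈ xs ] ⟦ x ≟ y ⟧) * ⟦ R? y ⟧)  ≤⟨ ∑-mono ys (λ {y} _ → *-monoˡ-≤ ⟦ R? y ⟧
                                                                (∑-unique un (_≟ y) (λ _ _ p q → trans p (sym q)))) ⟩
    (∑[ y ∈ ys ] 1 * ⟦ R? y ⟧)  ≡⟨ ∑-cong ys (λ _ → *-identityˡ _) ⟩
    (∑[ y ∈ ys ] ⟦ R? y ⟧)  ∎
    where
    open ≤-Reasoning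
    hit : ∀ {x} → x ∈ xs → 1 ≤ ∑[ y ∈ ys ] (⟦ x ≟ y ⟧ * ⟦ R? y ⟧)
    hit {x} x∈ with sub x∈
    ... | x∈ys , r = ≤-trans
      (≤-reflexive (sym (cong₂ _*_ (⟦⟧-true (x ≟ x) refl) (⟦⟧-true (R? x) r))))
      (term≤∑ (λ y → ⟦ x ≟ y ⟧ * ⟦ R? y ⟧) x∈ys)

  -- Block k + 1 ∈ [2 ^ h, 2 ^ (h + 1)) has 2 ^ h terms, each at most X / 2 ^ h.
  ∑-harmonic : ∀ X h n → n < 2 ^ h → ∑[ k ∈ upTo n ] (X / suc k) ≤ X * h
  ∑-harmonic X zero    zero    _ = z≤n
  ∑-harmonic X zero    (suc n) (s≤s ())
  ∑-harmonic X (suc h) n n<2^ with n <? 2 ^ h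
  ... | yes n<2^h = ≤-trans (∑-harmonic X h n n<2^h) (*-monoʳ-≤ X (n≤1+n h))
  ... | no  n≮2^h = begin
    ∑ (upTo n) f  ≡⟨ cong (λ k → ∑ (upTo k) f) n≡ ⟨
    ∑ (upTo (m + d)) f  ≡⟨ ∑-upTo-+ m d f ⟩
    ∑ (upTo m) f + ∑ (upTo d) (λ i → f (m + i))  ≤⟨ +-mono-≤ (∑-harmonic X h m m<2^h) (∑-upTo-bound d (λ {i} _ → block i)) ⟩
    X * h + d * (X / 2 ^ h)  ≤⟨ +-monoʳ-≤ (X * h) (≤-trans (*-monoˡ-≤ (X / 2 ^ h) d≤) (≤-trans (≤-reflexive (*-comm (2 ^ h) _)) (m/n*n≤m X (2 ^ h)))) ⟩
    X * h + X  ≡⟨ trans (+-comm (X * h) X) (sym (*-suc X h)) ⟩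
    X * suc h  ∎
    where
    open ≤-Reasoning
    instance
      2^h≢0 : NonZero (2 ^ h)
      2^h≢0 = m^n≢0 2 h
    f : ℕ → ℕ
    f k = X / suc k
    m d : ℕ
    m = pred (2 ^ h)
    d = n ∸ m
    1+m≡ : suc m ≡ 2 ^ h
    1+m≡ = suc-pred (2 ^ h)
    m<2^h : m < 2 ^ h
    m<2^h = ≤-reflexive 1+m≡
    n≡ : m + d ≡ n
    n≡ = m+[n∸m]≡n (≤-trans (<⇒≤ m<2^h) (≮⇒≥ n≮2^h))
    d≤ : d ≤ 2 ^ h
    d≤ = +-cancelˡ-≤ (suc m) d (2 ^ h) (begin
      suc m + d  ≡⟨ cong suc n≡ ⟩
      suc n  ≤⟨ n<2^ ⟩
      2 ^ h + (2 ^ h + 0) ≡⟨ cong₂ _+_ (sym 1+m≡) (+-identityʳ (2 ^ h)) ⟩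
      suc m + 2 ^ h  ∎)
    block : ∀ i → f (m + i) ≤ X / 2 ^ h
    block i = /-monoʳ-≤ X (subst (_≤ suc (m + i)) 1+m≡ (s≤s (m≤m+n m i)))

  ∑-multiples : ∀ N d .{{_ : NonZero d}} → ∑[ i ∈ upTo N ] ⟦ d ∣? suc i ⟧ ≤ N / d
  ∑-multiples zero    d = z≤n
  ∑-multiples (suc N) d = begin
    (∑[ i ∈ upTo (suc N) ] ⟦ d ∣? suc i ⟧)  ≡⟨ ∑-upTo-suc N (λ i → ⟦ d ∣? suc i ⟧) ⟩
    (∑[ i ∈ upTo N ] ⟦ d ∣? suc i ⟧) + ⟦ d ∣? suc N ⟧ ≤⟨ +-monoˡ-≤ _ (∑-multiples N d) ⟩
    N / d + ⟦ d ∣? suc N ⟧  ≤⟨ step (d ∣? suc N) ⟩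
    suc N / d  ∎
    where
    open ≤-Reasoning
    step : (dec : Dec (d ∣ suc N)) → N / d + ⟦ dec ⟧ ≤ suc N / d
    step (no _)  = ≤-trans (≤-reflexive (+-identityʳ (N / d))) (/-monoˡ-≤ d (n≤1+n N))
    step (yes (divides q eq)) = begin
      N / d + 1  ≡⟨ +-comm (N / d) 1 ⟩
      suc (N / d)  ≤⟨ m<n*o⇒m/o<n (≤-reflexive eq) ⟩
      q  ≡⟨ m*n/n≡m q d ⟨
      q * d / d  ≡⟨ cong (_/ d) eq ⟨
      suc N / d  ∎

  -- Mertens' argument also needs this direction, to pass from the quotients y / p back to multiples
  -- counted up to y.
  ∑-multiples-≥ : ∀ N d .{{_ : NonZero d}} → N / d ≤ ∑[ i ∈ upTo N ] ⟦ d ∣? suc i ⟧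
  ∑-multiples-≥ zero    d = ≤-reflexive (0/n≡0 d)
  ∑-multiples-≥ (suc N) d = begin
    suc N / d  ≤⟨ step (d ∣? suc N) ⟩
    N / d + ⟦ d ∣? suc N ⟧  ≤⟨ +-monoˡ-≤ _ (∑-multiples-≥ N d) ⟩
    (∑[ i ∈ upTo N ] ⟦ d ∣? suc i ⟧) + ⟦ d ∣? suc N ⟧ ≡⟨ ∑-upTo-suc N (λ i → ⟦ d ∣? suc i ⟧) ⟨
    (∑[ i ∈ upTo (suc N) ] ⟦ d ∣? suc i ⟧)  ∎
    where
    open ≤-Reasoning
    below : ∀ q → q * d ≤ N → q ≤ N / d
    below q qd≤N = ≤-trans (≤-reflexive (sym (m*n/n≡m q d))) (/-monoˡ-≤ d qd≤N)
    step : (dec : Dec (d ∣ suc N)) → suc N / d ≤ N / d + ⟦ dec ⟧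
    step (yes (divides zero ()))
    step (yes (divides (suc q) eq)) = begin
      suc N / d  ≡⟨ cong (_/ d) eq ⟩
      suc q * d / d  ≡⟨ m*n/n≡m (suc q) d ⟩
      suc q  ≤⟨ s≤s (below q (s≤s⁻¹ (≤-trans (+-monoˡ-≤ (q * d) (>-nonZero⁻¹ d)) (≤-reflexive (sym eq))))) ⟩
      suc (N / d)  ≡⟨ +-comm 1 (N / d) ⟩
      N / d + 1  ∎
    step (no ∤) = ≤-trans (below (suc N / d) (s≤s⁻¹ (≤∧≢⇒< (m/n*n≤m (suc N) d) (λ eq → ∤ (divides (suc N / d) (sym eq))))))
                          (≤-reflexive (sym (+-identityʳ (N / d))))

-- Congruences, and point-line incidences over ℤ/p.

module Incidence where

  open Sums
  open import Data.Integer.Base as ℤ using (ℤ; +_)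
  import Data.Integer.Divisibility.Signed as ℤ
  import Data.Integer.Properties as ℤ
  import Data.Integer.Tactic.RingSolver as ℤ
  open import Data.List.Base using (List; []; _∷_; length; upTo; cartesianProduct)
  open import Data.List.Membership.Propositional using (_∈_; find; lose)
  open import Data.List.Membership.Propositional.Properties using (∈-upTo⁺; ∈-upTo⁻; ∈-cartesianProduct⁻)
  open import Data.List.Properties using (length-upTo)
  open import Data.List.Relation.Unary.Any as Any using (any?)
  open import Data.List.Relation.Unary.Unique.Propositional.Properties using (upTo⁺)
  open import Data.Nat.Base
  open import Data.Nat.DivMod
  open import Data.Nat.Divisibility
  open import Data.Nat.Primality
  open import Data.Nat.Properties
  open import Data.Nat.Tactic.RingSolver using (solve-∀)
  open import Data.Product.Base using (_×_; _,_; proj₁; proj₂; ∃-syntax)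
  open import Data.Sum.Base using (_⊎_; inj₁; inj₂)
  open import Relation.Binary.PropositionalEquality
  open import Relation.Nullary using (Dec; yes; no; ¬_; contradiction)

  module Congruence (p : ℕ) where

    infix 4 _≈_ _≈?_

    -- Divisibility of an integer difference rather than equality of remainders: each congruence is
    -- then an equation in ℤ with an explicit quotient, and the rules for congruences become ring
    -- identities.
    _≈_ : ℕ → ℕ → Set
    x ≈ y = p ∣ ℤ.∣ + x ℤ.- + y ∣

    _≈?_ : ∀ x y → Dec (x ≈ y)
    x ≈? y = p ∣? ℤ.∣ + x ℤ.- + y ∣

    ≈⇒∃ : ∀ {x y} → x ≈ y → ∃[ q ] + x ≡ + y ℤ.+ q ℤ.* + p
    ≈⇒∃ {x} {y} x≈y with ℤ.∣ᵤ⇒∣ {+ p} {+ x ℤ.- + y} x≈y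
    ... | ℤ.divides q eq = q , trans (split (+ x) (+ y)) (cong (ℤ._+_ (+ y)) eq)
      where
      split : ∀ a b → a ≡ b ℤ.+ (a ℤ.- b)
      split = ℤ.solve-∀

    ∃⇒≈ : ∀ {x y} q → + x ≡ + y ℤ.+ q ℤ.* + p → x ≈ y
    ∃⇒≈ {x} {y} q eq = ℤ.∣⇒∣ᵤ {+ p} {+ x ℤ.- + y} (ℤ.divides q
      (trans (cong (ℤ._- + y) eq) (cancel (+ y) (q ℤ.* + p))))
      where
      cancel : ∀ a b → (a ℤ.+ b) ℤ.- a ≡ b
      cancel = ℤ.solve-∀

    ≈-refl : ∀ {x} → x ≈ x
    ≈-refl {x} = ∃⇒≈ {x} {x} (+ 0) (sym (ℤ.+-identityʳ (+ x)))

    ≈-sym : ∀ {x y} → x ≈ y → y ≈ x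
    ≈-sym {x} {y} x≈y with ≈⇒∃ {x} {y} x≈y
    ... | q , eq = ∃⇒≈ {y} {x} (ℤ.- q) (trans (move (+ y) q (+ p)) (cong (ℤ._+ ℤ.- q ℤ.* + p) (sym eq)))
      where
      move : ∀ y q p → y ≡ (y ℤ.+ q ℤ.* p) ℤ.+ ℤ.- q ℤ.* p
      move = ℤ.solve-∀

    ≈-trans : ∀ {x y z} → x ≈ y → y ≈ z → x ≈ z
    ≈-trans {x} {y} {z} x≈y y≈z with ≈⇒∃ {x} {y} x≈y | ≈⇒∃ {y} {z} y≈z
    ... | q , eq | r , eq′ = ∃⇒≈ {x} {z} (r ℤ.+ q) (trans eq (trans (cong (ℤ._+ q ℤ.* + p) eq′) (join (+ z) r q (+ p))))
      where
      join : ∀ z r q p → (z ℤ.+ r ℤ.* p) ℤ.+ q ℤ.* p ≡ z ℤ.+ (r ℤ.+ q) ℤ.* p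
      join = ℤ.solve-∀

    ≈-+ : ∀ {w x y z} → w ≈ x → y ≈ z → w + y ≈ x + z
    ≈-+ {w} {x} {y} {z} w≈x y≈z with ≈⇒∃ {w} {x} w≈x | ≈⇒∃ {y} {z} y≈z
    ... | q , eq | r , eq′ = ∃⇒≈ {w + y} {x + z} (q ℤ.+ r) (trans (cong₂ ℤ._+_ eq eq′) (join (+ x) (+ z) q r (+ p)))
      where
      join : ∀ x z q r p → (x ℤ.+ q ℤ.* p) ℤ.+ (z ℤ.+ r ℤ.* p) ≡ (x ℤ.+ z) ℤ.+ (q ℤ.+ r) ℤ.* p
      join = ℤ.solve-∀

    ≈-* : ∀ {w x y z} → w ≈ x → y ≈ z → w * y ≈ x * z
    ≈-* {w} {x} {y} {z} w≈x y≈z with ≈⇒∃ {w} {x} w≈x | ≈⇒∃ {y} {z} y≈z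
    ... | q , eq | r , eq′ = ∃⇒≈ {w * y} {x * z} (q ℤ.* + z ℤ.+ + x ℤ.* r ℤ.+ q ℤ.* r ℤ.* + p)
      (trans (ℤ.pos-* w y) (trans (cong₂ ℤ._*_ eq eq′) (trans (join (+ x) (+ z) q r (+ p))
        (cong (λ t → t ℤ.+ (q ℤ.* + z ℤ.+ + x ℤ.* r ℤ.+ q ℤ.* r ℤ.* + p) ℤ.* + p) (sym (ℤ.pos-* x z))))))
      where
      join : ∀ x z q r p → (x ℤ.+ q ℤ.* p) ℤ.* (z ℤ.+ r ℤ.* p) ≡
                           x ℤ.* z ℤ.+ (q ℤ.* z ℤ.+ x ℤ.* r ℤ.+ q ℤ.* r ℤ.* p) ℤ.* p
      join = ℤ.solve-∀

    ≈-cancel-+ʳ : ∀ {x y} z → x + z ≈ y + z → x ≈ y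
    ≈-cancel-+ʳ {x} {y} z h with ≈⇒∃ {x + z} {y + z} h
    ... | q , eq = ∃⇒≈ {x} {y} q (trans (undo (+ x) (+ z)) (trans (cong (ℤ._- + z) eq) (join (+ y) (+ z) (q ℤ.* + p))))
      where
      undo : ∀ x z → x ≡ (x ℤ.+ z) ℤ.- z
      undo = ℤ.solve-∀
      join : ∀ y z r → ((y ℤ.+ z) ℤ.+ r) ℤ.- z ≡ y ℤ.+ r
      join = ℤ.solve-∀

    ≈0⇒∣ : ∀ {x} → x ≈ 0 → p ∣ x
    ≈0⇒∣ {x} h = subst (p ∣_) (cong ℤ.∣_∣ (ℤ.+-identityʳ (+ x))) h

    ∣⇒≈0 : ∀ {x} → p ∣ x → x ≈ 0
    ∣⇒≈0 {x} h = subst (p ∣_) (sym (cong ℤ.∣_∣ (ℤ.+-identityʳ (+ x)))) h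

    %-≈ : ∀ x .{{_ : NonZero p}} → x ≈ x % p
    %-≈ x = ∃⇒≈ {x} {x % p} (+ (x / p)) (trans (cong +_ (m≡m%n+[m/n]*n x p)) (cong (ℤ._+_ (+ (x % p))) (ℤ.pos-* (x / p) p)))

    ≈⇒≡ : ∀ {x y} → x < p → y < p → x ≈ y → x ≡ y
    ≈⇒≡ {x} {y} x<p y<p h with ℤ.∣ + x ℤ.- + y ∣ in eq
    ... | zero  = ℤ.+-injective (ℤ.i-j≡0⇒i≡j (+ x) (+ y) (ℤ.∣i∣≡0⇒i≡0 eq))
    ... | suc d = contradiction (∣⇒≤ h) (<⇒≱ (≤-<-trans (≤-trans (≤-reflexive (sym eq))
        (≤-trans (≤-reflexive (cong ℤ.∣_∣ (ℤ.m-n≡m⊖n x y))) (ℤ.∣m⊝n∣≤m⊔n x y))) (⊔-lub x<p y<p)))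

    -- Subtracting the two congruences gives p ∣ (u - u′)(x - x′). Geometrically, lines with
    -- different slopes meet in one place at most.
    distinct-root : Prime p → ∀ u u′ v v′ x x′ → u * x + v ≈ u′ * x + v′ → u * x′ + v ≈ u′ * x′ + v′ →
                    u ≈ u′ ⊎ x ≈ x′
    distinct-root pr u u′ v v′ x x′ h h′ with ≈⇒∃ {u * x + v} {u′ * x + v′} h | ≈⇒∃ {u * x′ + v} {u′ * x′ + v′} h′
    ... | q , eq | r , eq′ = euclidsLemma _ _ pr (subst (p ∣_) (ℤ.abs-* (+ u ℤ.- + u′) (+ x ℤ.- + x′))
        (ℤ.∣⇒∣ᵤ {+ p} {(+ u ℤ.- + u′) ℤ.* (+ x ℤ.- + x′)} (ℤ.divides (q ℤ.- r) (trans
          (expand (+ u) (+ u′) (+ v) (+ v′) (+ x) (+ x′))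
          (trans (cong₂ (λ a b → (a ℤ.- (+ u′ ℤ.* + x ℤ.+ + v′)) ℤ.- (b ℤ.- (+ u′ ℤ.* + x′ ℤ.+ + v′)))
            (cast u x v u′ v′ q x eq) (cast u x′ v u′ v′ r x′ eq′))
            (collect (+ u′ ℤ.* + x ℤ.+ + v′) (+ u′ ℤ.* + x′ ℤ.+ + v′) q r (+ p)))))))
      where
      cast : ∀ u x v u′ v′ q x′ → + (u * x + v) ≡ + (u′ * x′ + v′) ℤ.+ q ℤ.* + p →
             + u ℤ.* + x ℤ.+ + v ≡ (+ u′ ℤ.* + x′ ℤ.+ + v′) ℤ.+ q ℤ.* + p
      cast u x v u′ v′ q x′ e = trans (cong (ℤ._+ + v) (sym (ℤ.pos-* u x)))
        (trans e (cong (λ t → t ℤ.+ + v′ ℤ.+ q ℤ.* + p) (ℤ.pos-* u′ x′)))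
      expand : ∀ u u′ v v′ x x′ → (u ℤ.- u′) ℤ.* (x ℤ.- x′) ≡
        ((u ℤ.* x ℤ.+ v) ℤ.- (u′ ℤ.* x ℤ.+ v′)) ℤ.- ((u ℤ.* x′ ℤ.+ v) ℤ.- (u′ ℤ.* x′ ℤ.+ v′))
      expand = ℤ.solve-∀
      collect : ∀ a b q r p → ((a ℤ.+ q ℤ.* p) ℤ.- a) ℤ.- ((b ℤ.+ r ℤ.* p) ℤ.- b) ≡ (q ℤ.- r) ℤ.* p
      collect = ℤ.solve-∀

    residue-unique : ∀ b → ∑[ x ∈ upTo p ] ⟦ b ≈? x ⟧ ≤ 1
    residue-unique b = ∑-unique (upTo⁺ p) (b ≈?_) (λ {x} {y} x∈ y∈ h h′ →
      ≈⇒≡ (∈-upTo⁻ x∈) (∈-upTo⁻ y∈) (≈-trans {x} {b} {y} (≈-sym {b} {x} h) h′))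

    residue-exists : .{{_ : NonZero p}} → ∀ b → 1 ≤ ∑[ x ∈ upTo p ] ⟦ b ≈? x ⟧
    residue-exists b = ≤-trans (≤-reflexive (sym (⟦⟧-true (b ≈? (b % p)) (%-≈ b))))
      (term≤∑ (λ x → ⟦ b ≈? x ⟧) (∈-upTo⁺ (m%n<n b p)))

    negative-unique : ∀ c → ∑[ y ∈ upTo p ] ⟦ c + y ≈? 0 ⟧ ≤ 1
    negative-unique c = ∑-unique (upTo⁺ p) (λ y → c + y ≈? 0) (λ {x} {y} x∈ y∈ h h′ →
      ≈⇒≡ (∈-upTo⁻ x∈) (∈-upTo⁻ y∈) (≈-cancel-+ʳ {x} {y} c
        (subst₂ _≈_ (+-comm c x) (+-comm c y) (≈-trans {c + x} {0} {c + y} h (≈-sym {c + y} {0} h′)))))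

    negative-exists : .{{_ : NonZero p}} → ∀ c → 1 ≤ ∑[ y ∈ upTo p ] ⟦ c + y ≈? 0 ⟧
    negative-exists c = ≤-trans (≤-reflexive (sym (⟦⟧-true (c + y ≈? 0) vanish)))
      (term≤∑ (λ y → ⟦ c + y ≈? 0 ⟧) (∈-upTo⁺ (m%n<n _ p)))
      where
      y : ℕ
      -- The residue of - c, written as (p - 1) c to stay in ℕ.
      y = (pred p * c) % p
      vanish : c + y ≈ 0
      vanish = ≈-trans {c + y} {c + pred p * c} {0} (≈-+ {c} {c} {y} {pred p * c} (≈-refl {c}) (≈-sym {pred p * c} {y} (%-≈ (pred p * c))))
        (∣⇒≈0 {c + pred p * c} (subst (λ q → p ∣ q * c) (sym (suc-pred p)) (m∣m*n c)))

  2ab≤a²+b² : ∀ a b → 2 * (a * b) ≤ a * a + b * b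
  2ab≤a²+b² a b with ≤-total a b
  ... | inj₁ a≤b = subst (λ b → 2 * (a * b) ≤ a * a + b * b) (m+[n∸m]≡n a≤b)
    (≤-trans (m≤m+n _ ((b ∸ a) * (b ∸ a))) (≤-reflexive (square a (b ∸ a))))
    where
    square : ∀ a d → 2 * (a * (a + d)) + d * d ≡ a * a + (a + d) * (a + d)
    square = solve-∀
  ... | inj₂ b≤a = subst (λ a → 2 * (a * b) ≤ a * a + b * b) (m+[n∸m]≡n b≤a)
    (≤-trans (m≤m+n _ ((a ∸ b) * (a ∸ b))) (≤-reflexive (square b (a ∸ b))))
    where
    square : ∀ b d → 2 * ((b + d) * b) + d * d ≡ (b + d) * (b + d) + b * b
    square = solve-∀

  -- A second moment argument on the incidences of the points (b , w) with the
  -- lines u x + v + y = 0 in the affine plane over ℤ/p.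
  module _ {p : ℕ} (pr : Prime p) (A B : List ℕ)
           (B-distinct : ∀ x → ∑[ b ∈ B ] ⟦ Congruence._≈?_ p b x ⟧ ≤ 1) where
    open Congruence p

    private
      instance
        p≢0 : NonZero p
        p≢0 = prime⇒nonZero pr

      n U E : ℕ
      n = length A
      U = length B
      E = ∑[ a ∈ A ] ∑[ a′ ∈ A ] ⟦ a ≈? a′ ⟧

      Solution : Set
      Solution = ∃[ u ] ∃[ v ] ∃[ w ] ∃[ b ] u ∈ A × v ∈ A × w ∈ A × b ∈ B × u * b + v + w ≈ 0

      -- The second moment only refutes the absence of solutions; a search through the finite lists
      -- turns this into a solution.
      solution? : Dec Solution
      solution? with any? (λ u → any? (λ v → any? (λ w → any? (λ b → u * b + v + w ≈? 0) B) A) A) A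
      ... | yes q with find q
      ... | u , u∈ , q₁ with find q₁
      ... | v , v∈ , q₂ with find q₂
      ... | w , w∈ , q₃ with find q₃
      ... | b , b∈ , eq = yes (u , v , w , b , u∈ , v∈ , w∈ , b∈ , eq)
      solution? | no ¬q = no λ (u , v , w , b , u∈ , v∈ , w∈ , b∈ , eq) →
        ¬q (lose u∈ (lose v∈ (lose w∈ (lose b∈ eq))))

      lines grid : List (ℕ × ℕ)
      lines = cartesianProduct A A
      grid  = cartesianProduct (upTo p) (upTo p)

      through : ℕ × ℕ → ℕ × ℕ → ℕ
      through (x , y) (u , v) = ⟦ u * x + v + y ≈? 0 ⟧

      -- i and m count the lines through a place of the plane and the points at it.
      i m : ℕ × ℕ → ℕ
      i g = ∑ lines (through g)
      mB mA : ℕ → ℕ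
      mB x = ∑[ b ∈ B ] ⟦ b ≈? x ⟧
      mA y = ∑[ w ∈ A ] ⟦ w ≈? y ⟧
      m (x , y) = mB x * mA y

      ∑-grid : ∀ (f : ℕ × ℕ → ℕ) → ∑ grid f ≡ ∑[ x ∈ upTo p ] ∑[ y ∈ upTo p ] f (x , y)
      ∑-grid f = ∑-cartesian _,_ (upTo p) (upTo p) f

      ∑-lines : ∀ (f : ℕ × ℕ → ℕ) → ∑ lines f ≡ ∑[ u ∈ A ] ∑[ v ∈ A ] f (u , v)
      ∑-lines f = ∑-cartesian _,_ A A f

      length-lines : ∀ c → ∑ lines (λ _ → c) ≡ n * (n * c)
      length-lines c = trans (∑-lines (λ _ → c)) (trans (∑-cong A (λ _ → ∑-const A c)) (∑-const A (n * c)))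

      length-grid : ∀ c → ∑ grid (λ _ → c) ≡ p * (p * c)
      length-grid c = trans (∑-grid (λ _ → c)) (trans (∑-cong (upTo p) (λ _ → const)) const)
        where
        const : ∀ {c} → ∑ (upTo p) (λ _ → c) ≡ p * c
        const {c} = trans (∑-const (upTo p) c) (cong (_* c) (length-upTo p))

      ∑i≥ : p * (n * n) ≤ ∑ grid i
      ∑i≥ = begin
        p * (n * n)  ≡⟨ trans (*-comm p (n * n)) (*-assoc n n p) ⟩
        n * (n * p)  ≡⟨ length-lines p ⟨
        ∑ lines (λ _ → p)  ≤⟨ ∑-mono lines (λ {l} _ → hits l) ⟩
        ∑ lines (λ l → ∑ grid (λ g → through g l))  ≡⟨ ∑-swap grid lines through ⟨
        ∑ grid i  ∎
        where
        open ≤-Reasoning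
        hits : ∀ l → p ≤ ∑ grid (λ g → through g l)
        hits l@(u , v) = begin
          p  ≡⟨ trans (∑-const (upTo p) 1) (trans (*-identityʳ _) (length-upTo p)) ⟨
          (∑[ x ∈ upTo p ] 1)  ≤⟨ ∑-mono (upTo p) (λ {x} _ → negative-exists (u * x + v)) ⟩
          (∑[ x ∈ upTo p ] ∑[ y ∈ upTo p ] through (x , y) l)  ≡⟨ ∑-grid (λ g → through g l) ⟨
          ∑ grid (λ g → through g l)  ∎

      -- Lines with different slopes share at most one place. Parallel ones share a place only if
      -- they also agree in the intercept, and then they share p of them.
      common-points : ∀ u v u′ v′ → ∑ grid (λ g → through g (u , v) * through g (u′ , v′)) ≤
                      1 + p * (⟦ u ≈? u′ ⟧ * ⟦ v ≈? v′ ⟧)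
      common-points u v u′ v′ = begin
        ∑ grid (λ g → through g (u , v) * through g (u′ , v′))
          ≡⟨ ∑-grid _ ⟩
        (∑[ x ∈ upTo p ] ∑[ y ∈ upTo p ] (⟦ u * x + v + y ≈? 0 ⟧ * ⟦ u′ * x + v′ + y ≈? 0 ⟧))
          ≤⟨ ∑-mono (upTo p) (λ {x} _ → column x) ⟩
        (∑[ x ∈ upTo p ] ⟦ u * x + v ≈? u′ * x + v′ ⟧)
          ≤⟨ rows (u ≈? u′) ⟩
        1 + p * (⟦ u ≈? u′ ⟧ * ⟦ v ≈? v′ ⟧) ∎
        where
        open ≤-Reasoning
        both : ∀ x y → ⟦ u * x + v + y ≈? 0 ⟧ * ⟦ u′ * x + v′ + y ≈? 0 ⟧ ≤
                       ⟦ u * x + v ≈? u′ * x + v′ ⟧ * ⟦ u * x + v + y ≈? 0 ⟧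
        both x y with u * x + v + y ≈? 0 | u′ * x + v′ + y ≈? 0
        ... | no _  | _     = z≤n
        ... | yes _ | no _  = z≤n
        ... | yes h | yes h′ = ≤-reflexive (sym (trans (*-identityʳ _) (⟦⟧-true (u * x + v ≈? u′ * x + v′)
              (≈-cancel-+ʳ {u * x + v} {u′ * x + v′} y
                (≈-trans {u * x + v + y} {0} {u′ * x + v′ + y} h (≈-sym {u′ * x + v′ + y} {0} h′))))))
        column : ∀ x → ∑[ y ∈ upTo p ] (⟦ u * x + v + y ≈? 0 ⟧ * ⟦ u′ * x + v′ + y ≈? 0 ⟧) ≤ ⟦ u * x + v ≈? u′ * x + v′ ⟧
        column x = begin
          (∑[ y ∈ upTo p ] (⟦ u * x + v + y ≈? 0 ⟧ * ⟦ u′ * x + v′ + y ≈? 0 ⟧)) ≤⟨ ∑-mono (upTo p) (λ {y} _ → both x y) ⟩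
          (∑[ y ∈ upTo p ] (q * ⟦ u * x + v + y ≈? 0 ⟧))  ≡⟨ ∑-*ˡ (upTo p) q _ ⟩
          q * (∑[ y ∈ upTo p ] ⟦ u * x + v + y ≈? 0 ⟧)  ≤⟨ *-monoʳ-≤ q (negative-unique (u * x + v)) ⟩
          q * 1  ≡⟨ *-identityʳ q ⟩
          q  ∎
          where
          q : ℕ
          q = ⟦ u * x + v ≈? u′ * x + v′ ⟧
        rows : (d : Dec (u ≈ u′)) → ∑[ x ∈ upTo p ] ⟦ u * x + v ≈? u′ * x + v′ ⟧ ≤ 1 + p * (⟦ d ⟧ * ⟦ v ≈? v′ ⟧)
        rows (yes u≈u′) = ≤-trans (∑-upTo-bound p (λ {x} _ → ≤-trans
            (⟦⟧-mono (u * x + v ≈? u′ * x + v′) (v ≈? v′) (λ h → ≈-cancel-+ʳ {v} {v′} (u * x)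
              (subst₂ _≈_ (+-comm (u * x) v) (+-comm (u * x) v′) (≈-trans {u * x + v} {u′ * x + v′} {u * x + v′} h
                (≈-+ {u′ * x} {u * x} {v′} {v′} (≈-* {u′} {u} {x} {x} (≈-sym {u} {u′} u≈u′) (≈-refl {x})) (≈-refl {v′}))))))
            (≤-reflexive (sym (*-identityˡ ⟦ v ≈? v′ ⟧)))))
          (m≤n+m _ 1)
        rows (no u≉u′) = ≤-trans (∑-unique (upTo⁺ p) (λ x → u * x + v ≈? u′ * x + v′) unique) (m≤m+n 1 _)
          where
          unique : ∀ {x x′} → x ∈ upTo p → x′ ∈ upTo p → u * x + v ≈ u′ * x + v′ → u * x′ + v ≈ u′ * x′ + v′ → x ≡ x′
          unique {x} {x′} x∈ x′∈ h h′ with distinct-root pr u u′ v v′ x x′ h h′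
          ... | inj₁ u≈u′ = contradiction u≈u′ u≉u′
          ... | inj₂ x≈x′ = ≈⇒≡ (∈-upTo⁻ x∈) (∈-upTo⁻ x′∈) x≈x′

      parallel : ∑[ l ∈ lines ] ∑[ l′ ∈ lines ] (⟦ proj₁ l ≈? proj₁ l′ ⟧ * ⟦ proj₂ l ≈? proj₂ l′ ⟧) ≡ E * E
      parallel = begin
        (∑[ l ∈ lines ] ∑[ l′ ∈ lines ] (⟦ proj₁ l ≈? proj₁ l′ ⟧ * ⟦ proj₂ l ≈? proj₂ l′ ⟧))
          ≡⟨ ∑-cong lines (λ {l} _ → trans (∑-lines _) (sym (∑*∑ A A (λ u′ → ⟦ proj₁ l ≈? u′ ⟧) (λ v′ → ⟦ proj₂ l ≈? v′ ⟧)))) ⟩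
        (∑[ l ∈ lines ] (∑[ u′ ∈ A ] ⟦ proj₁ l ≈? u′ ⟧) * (∑[ v′ ∈ A ] ⟦ proj₂ l ≈? v′ ⟧))
          ≡⟨ trans (∑-lines _) (sym (∑*∑ A A (λ u → ∑[ u′ ∈ A ] ⟦ u ≈? u′ ⟧) (λ v → ∑[ v′ ∈ A ] ⟦ v ≈? v′ ⟧))) ⟩
        E * E ∎
        where open ≡-Reasoning

      -- The n ^ 4 is the contribution of the mean n² / p over the p² places. Together with `∑i≥`
      -- this bounds the squared deviation of `i` from its mean by p E² in total.
      ∑i²≤ : ∑ grid (λ g → i g * i g) ≤ n * (n * (n * (n * 1))) + p * (E * E)
      ∑i²≤ = begin
        ∑ grid (λ g → i g * i g)
          ≡⟨ ∑-cong grid (λ {g} _ → ∑*∑ lines lines (through g) (through g)) ⟩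
        ∑ grid (λ g → ∑ lines (λ l → ∑ lines (λ l′ → through g l * through g l′)))
          ≡⟨ ∑-swap grid lines _ ⟩
        ∑ lines (λ l → ∑ grid (λ g → ∑ lines (λ l′ → through g l * through g l′)))
          ≡⟨ ∑-cong lines (λ _ → ∑-swap grid lines _) ⟩
        ∑ lines (λ l → ∑ lines (λ l′ → ∑ grid (λ g → through g l * through g l′)))
          ≤⟨ ∑-mono lines (λ {l} _ → ∑-mono lines (λ {l′} _ → common-points (proj₁ l) (proj₂ l) (proj₁ l′) (proj₂ l′))) ⟩
        ∑ lines (λ l → ∑ lines (λ l′ → 1 + p * same l l′))
          ≡⟨ ∑-cong lines (λ {l} _ → trans (∑-+ lines (λ _ → 1) (λ l′ → p * same l l′))
               (cong₂ _+_ (length-lines 1) (∑-*ˡ lines p (same l)))) ⟩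
        ∑ lines (λ l → n * (n * 1) + p * ∑ lines (same l))
          ≡⟨ trans (∑-+ lines (λ _ → n * (n * 1)) _) (cong₂ _+_ (length-lines (n * (n * 1)))
               (trans (∑-*ˡ lines p (λ l → ∑ lines (same l))) (cong (p *_) parallel))) ⟩
        n * (n * (n * (n * 1))) + p * (E * E) ∎
        where
        open ≤-Reasoning
        same : ℕ × ℕ → ℕ × ℕ → ℕ
        same l l′ = ⟦ proj₁ l ≈? proj₁ l′ ⟧ * ⟦ proj₂ l ≈? proj₂ l′ ⟧

      ∑-residues≥ : ∀ (xs : List ℕ) → length xs ≤ ∑[ x ∈ upTo p ] ∑[ a ∈ xs ] ⟦ a ≈? x ⟧
      ∑-residues≥ xs = begin
        length xs  ≡⟨ trans (∑-const xs 1) (*-identityʳ _) ⟨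
        (∑[ a ∈ xs ] 1)  ≤⟨ ∑-mono xs (λ {a} _ → residue-exists a) ⟩
        (∑[ a ∈ xs ] ∑[ x ∈ upTo p ] ⟦ a ≈? x ⟧)  ≡⟨ ∑-swap xs (upTo p) _ ⟩
        (∑[ x ∈ upTo p ] ∑[ a ∈ xs ] ⟦ a ≈? x ⟧)  ∎
        where open ≤-Reasoning

      ∑m≥ : U * n ≤ ∑ grid m
      ∑m≥ = begin
        U * n  ≤⟨ *-mono-≤ (∑-residues≥ B) (∑-residues≥ A) ⟩
        ∑ (upTo p) mB * ∑ (upTo p) mA  ≡⟨ ∑*∑ (upTo p) (upTo p) mB mA ⟩
        (∑[ x ∈ upTo p ] ∑[ y ∈ upTo p ] mB x * mA y)  ≡⟨ ∑-grid m ⟨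
        ∑ grid m  ∎
        where open ≤-Reasoning

      ∑mB²≤ : ∑[ x ∈ upTo p ] mB x * mB x ≤ U
      ∑mB²≤ = begin
        (∑[ x ∈ upTo p ] mB x * mB x)  ≤⟨ ∑-mono (upTo p) (λ {x} _ → ≤-trans (*-monoʳ-≤ (mB x) (B-distinct x)) (≤-reflexive (*-identityʳ _))) ⟩
        (∑[ x ∈ upTo p ] mB x)  ≡⟨ ∑-swap (upTo p) B (λ x b → ⟦ b ≈? x ⟧) ⟩
        (∑[ b ∈ B ] ∑[ x ∈ upTo p ] ⟦ b ≈? x ⟧)  ≤⟨ ∑-bound B (λ {b} _ → residue-unique b) ⟩
        U * 1  ≡⟨ *-identityʳ U ⟩
        U  ∎
        where open ≤-Reasoning

      ∑mA²≤ : ∑[ y ∈ upTo p ] mA y * mA y ≤ E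
      ∑mA²≤ = begin
        (∑[ y ∈ upTo p ] mA y * mA y)
          ≡⟨ ∑-cong (upTo p) (λ {y} _ → ∑*∑ A A (λ a → ⟦ a ≈? y ⟧) (λ a′ → ⟦ a′ ≈? y ⟧)) ⟩
        (∑[ y ∈ upTo p ] ∑[ a ∈ A ] ∑[ a′ ∈ A ] ⟦ a ≈? y ⟧ * ⟦ a′ ≈? y ⟧)
          ≡⟨ trans (∑-swap (upTo p) A _) (∑-cong A (λ _ → ∑-swap (upTo p) A _)) ⟩
        (∑[ a ∈ A ] ∑[ a′ ∈ A ] ∑[ y ∈ upTo p ] ⟦ a ≈? y ⟧ * ⟦ a′ ≈? y ⟧)
          ≤⟨ ∑-mono A (λ {a} _ → ∑-mono A (λ {a′} _ → collapse a a′)) ⟩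
        E ∎
        where
        open ≤-Reasoning
        meet : ∀ a a′ y → ⟦ a ≈? y ⟧ * ⟦ a′ ≈? y ⟧ ≤ ⟦ a ≈? a′ ⟧ * ⟦ a ≈? y ⟧
        meet a a′ y with a ≈? y | a′ ≈? y
        ... | no _  | _      = z≤n
        ... | yes _ | no _   = z≤n
        ... | yes h | yes h′ = ≤-reflexive (sym (trans (*-identityʳ _) (⟦⟧-true (a ≈? a′)
              (≈-trans {a} {y} {a′} h (≈-sym {a′} {y} h′)))))
        collapse : ∀ a a′ → ∑[ y ∈ upTo p ] ⟦ a ≈? y ⟧ * ⟦ a′ ≈? y ⟧ ≤ ⟦ a ≈? a′ ⟧
        collapse a a′ = begin
          (∑[ y ∈ upTo p ] ⟦ a ≈? y ⟧ * ⟦ a′ ≈? y ⟧)  ≤⟨ ∑-mono (upTo p) (λ {y} _ → meet a a′ y) ⟩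
          (∑[ y ∈ upTo p ] ⟦ a ≈? a′ ⟧ * ⟦ a ≈? y ⟧)  ≡⟨ ∑-*ˡ (upTo p) ⟦ a ≈? a′ ⟧ _ ⟩
          ⟦ a ≈? a′ ⟧ * (∑[ y ∈ upTo p ] ⟦ a ≈? y ⟧)  ≤⟨ *-monoʳ-≤ ⟦ a ≈? a′ ⟧ (residue-unique a) ⟩
          ⟦ a ≈? a′ ⟧ * 1  ≡⟨ *-identityʳ _ ⟩
          ⟦ a ≈? a′ ⟧  ∎

      ∑m²≤ : ∑ grid (λ g → m g * m g) ≤ U * E
      ∑m²≤ = begin
        ∑ grid (λ g → m g * m g)  ≡⟨ ∑-grid _ ⟩
        (∑[ x ∈ upTo p ] ∑[ y ∈ upTo p ] (mB x * mA y) * (mB x * mA y))  ≡⟨ ∑-cong (upTo p) (λ {x} _ → ∑-cong (upTo p) (λ {y} _ → swap (mB x) (mA y))) ⟩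
        (∑[ x ∈ upTo p ] ∑[ y ∈ upTo p ] (mB x * mB x) * (mA y * mA y))  ≡⟨ ∑*∑ (upTo p) (upTo p) (λ x → mB x * mB x) (λ y → mA y * mA y) ⟨
        (∑[ x ∈ upTo p ] mB x * mB x) * (∑[ y ∈ upTo p ] mA y * mA y)  ≤⟨ *-mono-≤ ∑mB²≤ ∑mA²≤ ⟩
        U * E  ∎
        where
        open ≤-Reasoning
        swap : ∀ a b → (a * b) * (a * b) ≡ (a * a) * (b * b)
        swap = solve-∀

      ∑≢0⇒∃ : ∀ {A : Set} (xs : List A) {R : A → Set} (R? : ∀ x → Dec (R x)) →
              ∑ xs (λ x → ⟦ R? x ⟧) ≢ 0 → ∃[ x ] x ∈ xs × R x
      ∑≢0⇒∃ []       R? ≢0 = contradiction refl ≢0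
      ∑≢0⇒∃ (x ∷ xs) R? ≢0 with R? x
      ... | yes r = x , Any.here refl , r
      ... | no _ with ∑≢0⇒∃ xs R? ≢0
      ...   | y , y∈ , r = y , Any.there y∈ , r

      no-incidence : ¬ Solution → ∀ g → i g ≡ 0 ⊎ m g ≡ 0
      no-incidence ¬sol (x , y) with i (x , y) ≟ 0 | mB x ≟ 0 | mA y ≟ 0
      ... | yes i≡0 | _ | _ = inj₁ i≡0
      ... | no _ | yes mB≡0 | _ = inj₂ (cong (_* mA y) mB≡0)
      ... | no _ | no _ | yes mA≡0 = inj₂ (trans (cong (mB x *_) mA≡0) (*-zeroʳ (mB x)))
      ... | no i≢0 | no mB≢0 | no mA≢0
          with ∑≢0⇒∃ lines (λ (u , v) → u * x + v + y ≈? 0) i≢0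
             | ∑≢0⇒∃ B (λ b → b ≈? x) mB≢0 | ∑≢0⇒∃ A (λ w → w ≈? y) mA≢0
      ... | (u , v) , l∈ , h | b , b∈ , b≈x | w , w∈ , w≈y with ∈-cartesianProduct⁻ A A l∈
      ... | u∈ , v∈ = contradiction (u , v , w , b , u∈ , v∈ , w∈ , b∈ ,
            ≈-trans {u * b + v + w} {u * x + v + y} {0}
              (≈-+ {u * b + v} {u * x + v} {w} {y}
                (≈-+ {u * b} {u * x} {v} {v} (≈-* {u} {u} {b} {x} (≈-refl {u}) b≈x) (≈-refl {v})) w≈y) h) ¬sol

      -- This is (n³ m + E p i - E n²)² ≥ 0, whose mixed term vanishes since i or m is 0. The
      -- weights are such that summation gives the same bound as Cauchy-Schwarz, applied to m and
      -- the deviation of i from n² / p, without any square roots.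
      pointwise : ∀ i m → i ≡ 0 ⊎ m ≡ 0 →
                  (2 * (n * n * n * (E * (n * n)))) * m + (2 * (E * E * p * (n * n))) * i ≤
                  ((n * n * n) * (n * n * n)) * (m * m) + ((E * E * (p * p)) * (i * i) + E * E * (n * n * (n * n)))
      pointwise i m (inj₁ refl) = ≤-trans (≤-reflexive (lhs n E p m)) (≤-trans (2ab≤a²+b² (n * n * n * m) (E * (n * n))) (≤-reflexive (rhs n E p m)))
        where
        lhs : ∀ n E p m → (2 * (n * n * n * (E * (n * n)))) * m + (2 * (E * E * p * (n * n))) * 0 ≡ 2 * ((n * n * n * m) * (E * (n * n)))
        lhs = solve-∀
        rhs : ∀ n E p m → (n * n * n * m) * (n * n * n * m) + (E * (n * n)) * (E * (n * n)) ≡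
              ((n * n * n) * (n * n * n)) * (m * m) + ((E * E * (p * p)) * 0 + E * E * (n * n * (n * n)))
        rhs = solve-∀
      pointwise i m (inj₂ refl) = ≤-trans (≤-reflexive (lhs n E p i)) (≤-trans (2ab≤a²+b² (E * p * i) (E * (n * n))) (≤-reflexive (rhs n E p i)))
        where
        lhs : ∀ n E p i → (2 * (n * n * n * (E * (n * n)))) * 0 + (2 * (E * E * p * (n * n))) * i ≡ 2 * ((E * p * i) * (E * (n * n)))
        lhs = solve-∀
        rhs : ∀ n E p i → (E * p * i) * (E * p * i) + (E * (n * n)) * (E * (n * n)) ≡
              ((n * n * n) * (n * n * n)) * 0 + ((E * E * (p * p)) * (i * i) + E * E * (n * n * (n * n)))
        rhs = solve-∀

      E≢0 : ∀ (A : List ℕ) → length A ≢ 0 → ∑[ a ∈ A ] ∑[ a′ ∈ A ] ⟦ a ≈? a′ ⟧ ≢ 0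
      E≢0 []      n≢0 _  = n≢0 refl
      E≢0 (a ∷ A) n≢0 eq = ⟦⟧≡0⇒¬ (a ≈? a) (∑≡0⇒ {xs = a ∷ A} (λ a′ → ⟦ a ≈? a′ ⟧) {a}
        (∑≡0⇒ {xs = a ∷ A} (λ b → ∑[ a′ ∈ a ∷ A ] ⟦ b ≈? a′ ⟧) {a} eq (Any.here refl)) (Any.here refl)) (≈-refl {a})

      bound : ¬ Solution → E * (U * ((n * n * n) * (n * n * n))) ≤ E * (p * p * p * (E * E * E))
      -- `α + 2 * β` is what remains on both sides once the inequality `pointwise` is summed over
      -- the grid; adding it avoids subtraction.
      bound ¬sol = +-cancelʳ-≤ (α + 2 * β) _ _ (begin
        E * (U * (n³ * n³)) + (α + 2 * β)  ≡⟨ left n E p U ⟩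
        c₁ * (U * n) + c₂ * (p * (n * n))  ≤⟨ +-mono-≤ (*-monoʳ-≤ c₁ ∑m≥) (*-monoʳ-≤ c₂ ∑i≥) ⟩
        c₁ * ∑ grid m + c₂ * ∑ grid i  ≡⟨ trans (∑-+ grid (λ g → c₁ * m g) (λ g → c₂ * i g)) (cong₂ _+_ (∑-*ˡ grid c₁ m) (∑-*ˡ grid c₂ i)) ⟨
        ∑ grid (λ g → c₁ * m g + c₂ * i g)  ≤⟨ ∑-mono grid (λ {g} _ → pointwise (i g) (m g) (no-incidence ¬sol g)) ⟩
        ∑ grid (λ g → c₃ * (m g * m g) + (c₄ * (i g * i g) + c₅))
          ≡⟨ trans (∑-+ grid (λ g → c₃ * (m g * m g)) (λ g → c₄ * (i g * i g) + c₅)) (cong₂ _+_ (∑-*ˡ grid c₃ (λ g → m g * m g))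
               (trans (∑-+ grid (λ g → c₄ * (i g * i g)) (λ _ → c₅)) (cong₂ _+_ (∑-*ˡ grid c₄ (λ g → i g * i g)) (length-grid c₅)))) ⟩
        c₃ * ∑ grid (λ g → m g * m g) + (c₄ * ∑ grid (λ g → i g * i g) + p * (p * c₅))
          ≤⟨ +-mono-≤ (*-monoʳ-≤ c₃ ∑m²≤) (+-monoˡ-≤ (p * (p * c₅)) (*-monoʳ-≤ c₄ ∑i²≤)) ⟩
        c₃ * (U * E) + (c₄ * (n * (n * (n * (n * 1))) + p * (E * E)) + p * (p * c₅))
          ≡⟨ right n E p U ⟩
        E * (p * p * p * (E * E * E)) + (α + 2 * β) ∎)
        where
        open ≤-Reasoning
        n³ c₁ c₂ c₃ c₄ c₅ α β : ℕ
        n³ = n * n * n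
        c₁ = 2 * (n³ * (E * (n * n)))
        c₂ = 2 * (E * E * p * (n * n))
        c₃ = n³ * n³
        c₄ = E * E * (p * p)
        c₅ = E * E * (n * n * (n * n))
        α  = E * (U * (n³ * n³))
        β  = E * E * (p * p) * (n * n * (n * n))
        left : ∀ n E p U → E * (U * ((n * n * n) * (n * n * n))) + (E * (U * ((n * n * n) * (n * n * n))) + 2 * (E * E * (p * p) * (n * n * (n * n)))) ≡
               2 * (n * n * n * (E * (n * n))) * (U * n) + 2 * (E * E * p * (n * n)) * (p * (n * n))
        left = solve-∀
        right : ∀ n E p U → ((n * n * n) * (n * n * n)) * (U * E) + (E * E * (p * p) * (n * (n * (n * (n * 1))) + p * (E * E)) + p * (p * (E * E * (n * n * (n * n))))) ≡
                E * (p * p * p * (E * E * E)) + (E * (U * ((n * n * n) * (n * n * n))) + 2 * (E * E * (p * p) * (n * n * (n * n))))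
        right = solve-∀

    incidence : p * p * p * (E * E * E) < U * ((n * n * n) * (n * n * n)) → Solution
    incidence big with solution?
    ... | yes sol = sol
    ... | no ¬sol = contradiction (*-cancelˡ-≤ E {{≢-nonZero (E≢0 A n≢0)}} (bound ¬sol)) (<⇒≱ big)
      where
      n≢0 : n ≢ 0
      n≢0 n≡0 = n≮0 (subst (p * p * p * (E * E * E) <_) (*-zeroʳ U)
        (subst (λ k → p * p * p * (E * E * E) < U * ((k * k * k) * (k * k * k))) n≡0 big))

-- Prime divisors, binomial coefficients, Fermat's theorem for base 2, and gcds of products.

module Primes where

  open Sums
  open Incidence using (module Congruence)
  open import Data.List.Base using (List; []; _∷_; length; upTo; filter)
  open import Data.List.Membership.Propositional using (_∈_)
  open import Data.List.Membership.Propositional.Properties using (∈-upTo⁻; ∈-filter⁻)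
  open import Data.List.Relation.Unary.All as All using (All; []; _∷_)
  open import Data.List.Relation.Unary.AllPairs.Core using ([]; _∷_)
  open import Data.List.Relation.Unary.Any using (here; there)
  open import Data.List.Relation.Unary.Unique.Propositional using (Unique)
  import Data.List.Relation.Unary.Unique.Propositional.Properties as Unique
  open import Data.Nat.Base
  open import Data.Nat.Divisibility
  open import Data.Nat.GCD
  open import Data.Nat.ListAction using (product)
  open import Data.Nat.Primality
  open import Data.Nat.Primality.Factorisation using (factorisationHasAllPrimeFactors)
  open import Data.Nat.Properties
  open import Data.Nat.Tactic.RingSolver using (solve-∀)
  open import Data.Product.Base using (proj₁; proj₂)
  open import Data.Sum.Base using (_⊎_; inj₁; inj₂)
  open import Relation.Binary.PropositionalEquality
  open import Relation.Nullary using (Dec; yes; no; contradiction)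

  2^-cancel-≤ : ∀ {m n} → 2 ^ m ≤ 2 ^ n → m ≤ n
  2^-cancel-≤ {m} {n} h with m ≤? n
  ... | yes m≤n = m≤n
  ... | no  m≰n = contradiction h (<⇒≱ (^-monoʳ-< 2 (s≤s (s≤s z≤n)) (≰⇒> m≰n)))

  prime⇒≥2 : ∀ {p} → Prime p → 2 ≤ p
  prime⇒≥2 pr = nonTrivial⇒n>1 _ {{prime⇒nonTrivial pr}}

  ∑-filter : ∀ {A : Set} (xs : List A) {R : A → Set} (R? : ∀ x → Dec (R x)) w →
             ∑[ x ∈ xs ] w x * ⟦ R? x ⟧ ≡ ∑ (filter R? xs) w
  ∑-filter []       R? w = refl
  ∑-filter (x ∷ xs) R? w with R? x
  ... | yes _ = cong₂ _+_ (*-identityʳ (w x)) (∑-filter xs R? w)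
  ... | no _  = cong₂ _+_ (*-zeroʳ (w x)) (∑-filter xs R? w)

  product-distinct-∣ : ∀ {ps n} → Unique ps → All Prime ps → (∀ {p} → p ∈ ps → p ∣ n) → product ps ∣ n
  product-distinct-∣ []        []         h = 1∣ _
  product-distinct-∣ {p ∷ ps} (p∉ ∷ un) (pr ∷ prs) h with product-distinct-∣ un prs (λ q∈ → h (there q∈))
  ... | divides q refl with euclidsLemma q (product ps) pr (h (here refl))
  ...   | inj₁ p∣q  = *-monoˡ-∣ (product ps) p∣q
  ...   | inj₂ p∣Πps = contradiction refl (All.lookup p∉ (factorisationHasAllPrimeFactors pr p∣Πps prs))

  -- The distinct primes dividing n have a product of at most n, which is at least 2 to the sum of
  -- their weights. Weight 1 bounds the number of prime divisors; the weight `log` is the one for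
  -- Mertens' argument.
  ∑-prime-divisors : ∀ {ps} → Unique ps → All Prime ps → ∀ (w : ℕ → ℕ) → (∀ {p} → p ∈ ps → 2 ^ w p ≤ p) →
                     ∀ n .{{_ : NonZero n}} X → n ≤ 2 ^ X → ∑[ p ∈ ps ] w p * ⟦ p ∣? n ⟧ ≤ X
  ∑-prime-divisors {ps} un prs w h n X n≤ = 2^-cancel-≤ (begin
    2 ^ (∑[ p ∈ ps ] w p * ⟦ p ∣? n ⟧)  ≡⟨ cong (2 ^_) (∑-filter ps (_∣? n) w) ⟩
    2 ^ ∑ ds w  ≤⟨ powers ds (λ p∈ → h (proj₁ (∈-filter⁻ (_∣? n) {xs = ps} p∈))) ⟩
    product ds  ≤⟨ ∣⇒≤ (product-distinct-∣ (Unique.filter⁺ (_∣? n) un)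
                                              (All.tabulate (λ p∈ → All.lookup prs (proj₁ (∈-filter⁻ (_∣? n) {xs = ps} p∈))))
                                              (λ p∈ → proj₂ (∈-filter⁻ (_∣? n) {xs = ps} p∈))) ⟩
    n  ≤⟨ n≤ ⟩
    2 ^ X  ∎)
    where
    open ≤-Reasoning
    ds : List ℕ
    ds = filter (_∣? n) ps
    powers : ∀ xs → (∀ {p} → p ∈ xs → 2 ^ w p ≤ p) → 2 ^ ∑ xs w ≤ product xs
    powers []       h = ≤-refl
    powers (x ∷ xs) h = ≤-trans (≤-reflexive (^-distribˡ-+-* 2 (w x) (∑ xs w)))
      (*-mono-≤ (h (here refl)) (powers xs (λ p∈ → h (there p∈))))

  binomial : ℕ → ℕ → ℕ
  binomial n       zero    = 1
  binomial zero    (suc k) = 0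
  binomial (suc n) (suc k) = binomial n k + binomial n (suc k)

  binomial-vanishes : ∀ n k → n < k → binomial n k ≡ 0
  binomial-vanishes zero    (suc k) _         = refl
  binomial-vanishes (suc n) (suc k) (s≤s n<k) = cong₂ _+_ (binomial-vanishes n k n<k) (binomial-vanishes n (suc k) (m<n⇒m<1+n n<k))

  binomial-diagonal : ∀ n → binomial n n ≡ 1
  binomial-diagonal zero    = refl
  binomial-diagonal (suc n) = cong₂ _+_ (binomial-diagonal n) (binomial-vanishes n (suc n) ≤-refl)

  binomial≤2^ : ∀ n k → binomial n k ≤ 2 ^ n
  binomial≤2^ n       zero    = m^n>0 2 n
  binomial≤2^ zero    (suc k) = z≤n
  binomial≤2^ (suc n) (suc k) = +-mono-≤ (binomial≤2^ n k) (≤-trans (binomial≤2^ n (suc k)) (≤-reflexive (sym (+-identityʳ (2 ^ n)))))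

  -- Serves twice: a prime divides its inner binomial coefficients, and later powers are compared
  -- with factorials.
  absorption : ∀ n k → suc k * binomial (suc n) (suc k) ≡ suc n * binomial n k
  absorption zero    zero    = refl
  absorption zero    (suc k) = *-zeroʳ (2 + k)
  absorption (suc n) zero    = trans (*-identityˡ _) (trans (cong suc (trans (sym (*-identityˡ _)) (absorption n zero))) refl)
  absorption (suc n) (suc k) = begin
    suc (suc k) * (b + c)  ≡⟨ split (suc k) b c ⟩
    b + suc k * b + suc (suc k) * c  ≡⟨ cong₂ (λ u v → b + u + v) (absorption n k) (absorption n (suc k)) ⟩
    b + suc n * binomial n k + suc n * binomial n (suc k) ≡⟨ join b (suc n) (binomial n k) (binomial n (suc k)) ⟩
    b + suc n * b  ∎
    where
    open ≡-Reasoning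
    b c : ℕ
    b = binomial (suc n) (suc k)
    c = binomial (suc n) (suc (suc k))
    split : ∀ k b c → suc k * (b + c) ≡ b + k * b + suc k * c
    split = solve-∀
    join : ∀ b n x y → b + n * x + n * y ≡ b + n * (x + y)
    join = solve-∀

  ∑-upTo-head : ∀ n (f : ℕ → ℕ) → ∑ (upTo (suc n)) f ≡ f 0 + ∑ (upTo n) (λ i → f (suc i))
  ∑-upTo-head n f = trans (∑-upTo-+ 1 n f) (cong (_+ ∑ (upTo n) (λ i → f (suc i))) (+-identityʳ (f 0)))

  ∑-binomial : ∀ n → ∑ (upTo (suc n)) (binomial n) ≡ 2 ^ n
  ∑-binomial zero    = refl
  ∑-binomial (suc n) = begin
    ∑ (upTo (2 + n)) (binomial (suc n))  ≡⟨ ∑-upTo-head (suc n) (binomial (suc n)) ⟩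
    1 + ∑ (upTo (suc n)) (λ k → binomial n k + binomial n (suc k))  ≡⟨ cong suc (∑-+ (upTo (suc n)) (binomial n) (λ k → binomial n (suc k))) ⟩
    1 + (∑ (upTo (suc n)) (binomial n) + ∑ (upTo (suc n)) (λ k → binomial n (suc k))) ≡⟨ +-suc (∑ (upTo (suc n)) (binomial n)) _ ⟨
    ∑ (upTo (suc n)) (binomial n) + (1 + ∑ (upTo (suc n)) (λ k → binomial n (suc k))) ≡⟨ cong₂ _+_ (∑-binomial n) shifted ⟩
    2 ^ n + (2 ^ n + 0)  ∎
    where
    open ≡-Reasoning
    shifted : 1 + ∑ (upTo (suc n)) (λ k → binomial n (suc k)) ≡ 2 ^ n + 0
    shifted = trans (sym (∑-upTo-head (suc n) (binomial n))) (trans (∑-upTo-suc (suc n) (binomial n))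
      (cong₂ _+_ (∑-binomial n) (binomial-vanishes n (suc n) ≤-refl)))

  ∣-∑ : ∀ {A : Set} (xs : List A) {f : A → ℕ} {d} → (∀ {x} → x ∈ xs → d ∣ f x) → d ∣ ∑ xs f
  ∣-∑ []       h = _ ∣0
  ∣-∑ (x ∷ xs) h = ∣m∣n⇒∣m+n (h (here refl)) (∣-∑ xs (λ x∈ → h (there x∈)))

  prime∣binomial : ∀ {q} → Prime (suc q) → ∀ k → k < q → suc q ∣ binomial (suc q) (suc k)
  prime∣binomial {q} pr k k<q with euclidsLemma (suc k) (binomial (suc q) (suc k)) pr
                                     (subst (suc q ∣_) (sym (absorption q k)) (m∣m*n (binomial q k)))
  ... | inj₁ q∣k = contradiction (∣⇒≤ q∣k) (<⇒≱ (s≤s k<q))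
  ... | inj₂ q∣b = q∣b

  -- The binomial coefficients of row p add up to 2 ^ p and the inner ones are multiples of p, so p
  -- ∣ 2 (2 ^ (p - 1) - 1); the factor 2 cancels because p is odd.
  fermat : ∀ {p} → Prime p → 2 < p → Congruence._≈_ p (2 ^ pred p) 1
  fermat {suc q} pr 2<p = ∃⇒≈′ (euclidsLemma 2 (2 ^ q ∸ 1) pr dvd)
    where
    open Congruence (suc q)
    p : ℕ
    p = suc q
    inner : ℕ
    inner = ∑ (upTo q) (λ k → binomial p (suc k))
    expand : 2 ^ p ≡ 2 + inner
    expand = begin
      2 ^ p  ≡⟨ ∑-binomial p ⟨
      ∑ (upTo (suc p)) (binomial p)  ≡⟨ ∑-upTo-suc p (binomial p) ⟩
      ∑ (upTo p) (binomial p) + binomial p p  ≡⟨ cong₂ _+_ (∑-upTo-head q (binomial p)) (binomial-diagonal p) ⟩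
      1 + inner + 1  ≡⟨ +-comm (1 + inner) 1 ⟩
      2 + inner  ∎
      where open ≡-Reasoning
    1≤2^q : 1 ≤ 2 ^ q
    1≤2^q = m^n>0 2 q
    dvd : p ∣ 2 * (2 ^ q ∸ 1)
    dvd = subst (p ∣_) (sym (trans (*-distribˡ-∸ 2 (2 ^ q) 1) (trans (cong (_∸ 2) expand) (m+n∸m≡n 2 inner))))
      (∣-∑ (upTo q) (λ k∈ → prime∣binomial pr _ (∈-upTo⁻ k∈)))
    ∃⇒≈′ : p ∣ 2 ⊎ p ∣ 2 ^ q ∸ 1 → 2 ^ q ≈ 1
    ∃⇒≈′ (inj₁ p∣2) = contradiction (∣⇒≤ p∣2) (<⇒≱ 2<p)
    ∃⇒≈′ (inj₂ h)   = subst (_≈ 1) (m∸n+n≡m 1≤2^q) (≈-+ {2 ^ q ∸ 1} {0} {1} {1} (∣⇒≈0 {2 ^ q ∸ 1} h) (≈-refl {1}))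

  -- The right side is the gcd of b gcd(a, c) and c gcd(a, c), and b gcd(a, c) is itself gcd(b a, b
  -- c); so gcd(a b, c) divides both.
  gcd-*-∣ : ∀ a b c → gcd (a * b) c ∣ gcd a c * gcd b c
  gcd-*-∣ a b c = subst (gcd (a * b) c ∣_) (sym (c*gcd[m,n]≡gcd[cm,cn] (gcd a c) b c))
    (gcd-greatest
      (subst (gcd (a * b) c ∣_) (trans (sym (c*gcd[m,n]≡gcd[cm,cn] b a c)) (*-comm b (gcd a c)))
        (gcd-greatest (subst (gcd (a * b) c ∣_) (*-comm a b) (gcd[m,n]∣m (a * b) c))
                      (∣n⇒∣m*n b (gcd[m,n]∣n (a * b) c))))
      (∣n⇒∣m*n (gcd a c) (gcd[m,n]∣n (a * b) c)))

  -- Reduces the gcd of p - 1 with a product of numbers q - 1 to the pairwise gcds, which are what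
  -- can be averaged over n.
  gcd-product≤ : ∀ (ts : List ℕ) c D .{{_ : NonZero c}} → (∀ {t} → t ∈ ts → gcd t c ≤ D) → gcd (product ts) c ≤ D ^ length ts
  gcd-product≤ []       c D h = ≤-reflexive (gcd-zeroˡ c)
  gcd-product≤ (t ∷ ts) c D h = ≤-trans (∣⇒≤ {{m*n≢0 _ _ {{nz t}} {{nz (product ts)}}}} (gcd-*-∣ t (product ts) c))
    (*-mono-≤ (h (here refl)) (gcd-product≤ ts c D (λ t∈ → h (there t∈))))
    where
    nz : ∀ a → NonZero (gcd a c)
    nz a = ≢-nonZero (gcd[m,n]≢0 a c (inj₂ (≢-nonZero⁻¹ c)))

-- Sums of powers of 2 ^ V, and the rarity of primes with many coincidences among them.

module Blocks where

  open Sums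
  open Incidence
  open Primes
  import Data.Integer.Base as ℤ
  import Data.Integer.Properties as ℤ
  open import Data.List.Base using (List; []; _∷_; _++_; length; upTo; map; cartesianProductWith)
  open import Data.List.Membership.Propositional using (_∈_)
  open import Data.List.Membership.Propositional.Properties using (∈-upTo⁺; ∈-upTo⁻; ∈-cartesianProductWith⁻; ∈-map⁻)
  open import Data.List.Properties using (length-++; length-map; length-upTo)
  open import Data.List.Relation.Unary.All as All using (All; []; _∷_)
  open import Data.List.Relation.Unary.Any using (here)
  open import Data.List.Relation.Unary.Unique.Propositional using (Unique)
  import Data.List.Relation.Unary.Unique.Propositional.Properties as Unique
  open import Data.Nat.Base
  open import Data.Nat.DivMod
  open import Data.Nat.Divisibility
  open import Data.Nat.Primality
  open import Data.Nat.Properties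
  open import Data.Nat.Tactic.RingSolver using (solve-∀)
  open import Data.Product.Base using (_×_; _,_; ∃-syntax)
  open import Data.Sum.Base using (_⊎_; inj₁; inj₂)
  open import Relation.Binary.Definitions using (tri<; tri≈; tri>)
  open import Relation.Binary.PropositionalEquality
  open import Relation.Nullary using (yes; no; ¬_; contradiction)
  open import Relation.Nullary.Decidable using (¬?)

  -- Exponents may repeat: equal powers merge by carrying, which only lowers the number of binary
  -- ones, so k still bounds the Hamming weight.
  SumOf : ℕ → ℕ → ℕ → Set
  SumOf V k m = ∃[ cs ] length cs ≡ k × ∑[ c ∈ cs ] 2 ^ (V * c) ≡ m

  SumOf-+ : ∀ {V j k a b} → SumOf V j a → SumOf V k b → SumOf V (j + k) (a + b)
  SumOf-+ {V} (cs , refl , refl) (ds , refl , refl) = cs ++ ds , length-++ cs , ∑-++ cs ds (λ c → 2 ^ (V * c))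

  SumOf-shift : ∀ {V k a} b → SumOf V k a → SumOf V k (2 ^ (V * b) * a)
  SumOf-shift {V} b (cs , refl , refl) = map (b +_) cs , length-map (b +_) cs ,
    trans (∑-map (b +_) cs _) (trans (∑-cong cs (λ {c} _ → trans (cong (2 ^_) (*-distribˡ-+ V b c)) (^-distribˡ-+-* 2 (V * b) (V * c))))
      (∑-*ˡ cs (2 ^ (V * b)) _))

  difference : ∀ {m n} → m < n → ∃[ o ] n ≡ m + suc o
  difference {m} {n} m<n = n ∸ suc m , sym (trans (+-suc m _) (m+[n∸m]≡n m<n))

  prime∣2^ : ∀ {p} → Prime p → ∀ n → p ∣ 2 ^ n → p ≤ 2
  prime∣2^ pr zero    h = contradiction (∣⇒≤ h) (<⇒≱ (prime⇒≥2 pr))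
  prime∣2^ pr (suc n) h with euclidsLemma 2 (2 ^ n) pr h
  ... | inj₁ p∣2  = ∣⇒≤ p∣2
  ... | inj₂ p∣2^ = prime∣2^ pr n p∣2^

  module Values (V T : ℕ) .{{_ : NonZero V}} where

    Q : ℕ
    Q = 2 ^ (V * T)

    instance
      Q≢0 : NonZero Q
      Q≢0 = m^n≢0 2 (V * T)

    -- The powers are digits in base `Q`, so each has its own range of exponents. With a common
    -- range, permutations of the exponents would give the same number and spoil the count of T ^ H
    -- different values.
    values : ℕ → List ℕ
    values zero    = 0 ∷ []
    values (suc H) = cartesianProductWith (λ a m → 2 ^ (V * a) + Q * m) (upTo T) (values H)

    2^Va<Q : ∀ {a} → a < T → 2 ^ (V * a) < Q
    2^Va<Q a<T = ^-monoʳ-< 2 (s≤s (s≤s z≤n)) (*-monoʳ-< V a<T)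

    length-values : ∀ H → length (values H) ≡ T ^ H
    length-values zero    = refl
    length-values (suc H) = begin
      length (values (suc H))  ≡⟨ trans (∑-const (values (suc H)) 1) (*-identityʳ _) ⟨
      ∑ (values (suc H)) (λ _ → 1)  ≡⟨ ∑-cartesian _ (upTo T) (values H) (λ _ → 1) ⟩
      ∑ (upTo T) (λ _ → ∑ (values H) (λ _ → 1)) ≡⟨ ∑-const (upTo T) _ ⟩
      length (upTo T) * ∑ (values H) (λ _ → 1)  ≡⟨ cong₂ _*_ (length-upTo T) (trans (∑-const (values H) 1) (trans (*-identityʳ _) (length-values H))) ⟩
      T * T ^ H  ∎
      where open ≡-Reasoning

    values-bound : ∀ H {m} → m ∈ values H → m < 2 ^ (V * T * H)
    values-bound zero    (here refl) = m^n>0 2 (V * T * 0)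
    values-bound (suc H) m∈ with ∈-cartesianProductWith⁻ (λ a m → 2 ^ (V * a) + Q * m) (upTo T) (values H) m∈
    ... | a , m , a∈ , m∈ , refl = begin-strict
      2 ^ (V * a) + Q * m  <⟨ +-monoˡ-< (Q * m) (2^Va<Q (∈-upTo⁻ a∈)) ⟩
      Q + Q * m  ≡⟨ *-suc Q m ⟨
      Q * suc m  ≤⟨ *-monoʳ-≤ Q (values-bound H m∈) ⟩
      Q * 2 ^ (V * T * H)  ≡⟨ ^-distribˡ-+-* 2 (V * T) (V * T * H) ⟨
      2 ^ (V * T + V * T * H)  ≡⟨ cong (2 ^_) (*-suc (V * T) H) ⟨
      2 ^ (V * T * suc H)  ∎
      where open ≤-Reasoning

    values-SumOf : ∀ H {m} → m ∈ values H → SumOf V H m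
    values-SumOf zero    (here refl) = [] , refl , refl
    values-SumOf (suc H) m∈ with ∈-cartesianProductWith⁻ (λ a m → 2 ^ (V * a) + Q * m) (upTo T) (values H) m∈
    ... | a , m , a∈ , m∈ , refl = SumOf-+ {V} {1} (a ∷ [] , refl , +-identityʳ _) (SumOf-shift {V} T (values-SumOf H m∈))

    -- Q divides everything but the first power, which is less than Q.
    values-distinct : ∀ H c → ∑[ m ∈ values H ] ⟦ m ≟ c ⟧ ≤ 1
    values-distinct zero    c = ≤-trans (≤-reflexive (+-identityʳ ⟦ 0 ≟ c ⟧)) (⟦⟧≤1 (0 ≟ c))
    values-distinct (suc H) c = begin
      (∑[ m ∈ values (suc H) ] ⟦ m ≟ c ⟧)
        ≡⟨ ∑-cartesian _ (upTo T) (values H) _ ⟩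
      (∑[ a ∈ upTo T ] ∑[ m ∈ values H ] ⟦ 2 ^ (V * a) + Q * m ≟ c ⟧)
        ≤⟨ ∑-mono (upTo T) (λ {a} a∈ → ∑-mono (values H) (λ {m} _ → split a m (∈-upTo⁻ a∈))) ⟩
      (∑[ a ∈ upTo T ] ∑[ m ∈ values H ] ⟦ 2 ^ (V * a) ≟ c % Q ⟧ * ⟦ m ≟ c / Q ⟧)
        ≡⟨ ∑*∑ (upTo T) (values H) (λ a → ⟦ 2 ^ (V * a) ≟ c % Q ⟧) (λ m → ⟦ m ≟ c / Q ⟧) ⟨
      (∑[ a ∈ upTo T ] ⟦ 2 ^ (V * a) ≟ c % Q ⟧) * (∑[ m ∈ values H ] ⟦ m ≟ c / Q ⟧)
        ≤⟨ *-mono-≤ (∑-unique (Unique.upTo⁺ T) (λ a → 2 ^ (V * a) ≟ c % Q) (λ _ _ h h′ → injective (trans h (sym h′))))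
                    (values-distinct H (c / Q)) ⟩
      1 * 1
        ≡⟨⟩
      1 ∎
      where
      open ≤-Reasoning
      injective : ∀ {a b} → 2 ^ (V * a) ≡ 2 ^ (V * b) → a ≡ b
      injective eq = ≤-antisym (*-cancelˡ-≤ V (2^-cancel-≤ (≤-reflexive eq))) (*-cancelˡ-≤ V (2^-cancel-≤ (≤-reflexive (sym eq))))
      split : ∀ a m → a < T → ⟦ 2 ^ (V * a) + Q * m ≟ c ⟧ ≤ ⟦ 2 ^ (V * a) ≟ c % Q ⟧ * ⟦ m ≟ c / Q ⟧
      split a m a<T = ⟦⟧-bound (2 ^ (V * a) + Q * m ≟ c) λ { refl → ≤-reflexive (sym (cong₂ _*_
        (⟦⟧-true (2 ^ (V * a) ≟ _) (sym (low a m a<T))) (⟦⟧-true (m ≟ _) (sym (high a m a<T))))) }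
        where
        low : ∀ a m → a < T → (2 ^ (V * a) + Q * m) % Q ≡ 2 ^ (V * a)
        low a m a<T = trans (cong (λ k → (2 ^ (V * a) + k) % Q) (*-comm Q m))
          (trans ([m+kn]%n≡m%n (2 ^ (V * a)) m Q) (m<n⇒m%n≡m (2^Va<Q a<T)))
        high : ∀ a m → a < T → (2 ^ (V * a) + Q * m) / Q ≡ m
        high a m a<T = trans (cong (λ k → (2 ^ (V * a) + k) / Q) (*-comm Q m))
          (trans (+-distrib-/-∣ʳ (2 ^ (V * a)) {m * Q} {Q} (n∣m*n m))
            (cong₂ _+_ (m<n⇒m/n≡0 (2^Va<Q a<T)) (m*n/n≡m m Q)))

    distance : ℕ → ℕ → ℕ
    distance a b = ℤ.∣ ℤ.+ a ℤ.- ℤ.+ b ∣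

    collisions : ℕ → ℕ → ℕ
    collisions H p = ∑[ a ∈ values H ] ∑[ b ∈ values H ] ⟦ p ∣? distance a b ⟧ * ⟦ ¬? (a ≟ b) ⟧

    energy≤ : ∀ H p → ∑[ a ∈ values H ] ∑[ b ∈ values H ] ⟦ Congruence._≈?_ p a b ⟧ ≤ T ^ H + collisions H p
    energy≤ H p = begin
      (∑[ a ∈ values H ] ∑[ b ∈ values H ] ⟦ p ∣? distance a b ⟧)
        ≤⟨ ∑-mono (values H) (λ {a} _ → ∑-mono (values H) (λ {b} _ → split a b)) ⟩
      (∑[ a ∈ values H ] ∑[ b ∈ values H ] (⟦ b ≟ a ⟧ + ⟦ p ∣? distance a b ⟧ * ⟦ ¬? (a ≟ b) ⟧))
        ≡⟨ trans (∑-cong (values H) (λ {a} _ → ∑-+ (values H) (λ b → ⟦ b ≟ a ⟧) (λ b → ⟦ p ∣? distance a b ⟧ * ⟦ ¬? (a ≟ b) ⟧)))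
             (∑-+ (values H) (λ a → ∑[ b ∈ values H ] ⟦ b ≟ a ⟧) _) ⟩
      (∑[ a ∈ values H ] ∑[ b ∈ values H ] ⟦ b ≟ a ⟧) + collisions H p
        ≤⟨ +-monoˡ-≤ (collisions H p) (∑-bound (values H) (λ {a} _ → values-distinct H a)) ⟩
      length (values H) * 1 + collisions H p
        ≡⟨ cong (_+ collisions H p) (trans (*-identityʳ _) (length-values H)) ⟩
      T ^ H + collisions H p ∎
      where
      open ≤-Reasoning
      split : ∀ a b → ⟦ p ∣? distance a b ⟧ ≤ ⟦ b ≟ a ⟧ + ⟦ p ∣? distance a b ⟧ * ⟦ ¬? (a ≟ b) ⟧
      split a b with a ≟ b
      ... | yes refl = ≤-trans (⟦⟧≤1 (p ∣? distance a a)) (≤-trans (≤-reflexive (sym (⟦⟧-true (a ≟ a) refl))) (m≤m+n _ _))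
      ... | no  _    = ≤-trans (≤-reflexive (sym (*-identityʳ _))) (m≤n+m _ _)

    -- Two different values differ by a positive integer of at most 2 ^ (V T H), so at most V T H
    -- primes make them collide.
    ∑-collisions : ∀ H {ps} → Unique ps → All Prime ps →
                   ∑ ps (collisions H) ≤ T ^ H * (T ^ H * (V * T * H))
    ∑-collisions H {ps} un prs = begin
      ∑ ps (collisions H)
        ≡⟨ trans (∑-swap ps (values H) _) (∑-cong (values H) (λ _ → ∑-swap ps (values H) _)) ⟩
      (∑[ a ∈ values H ] ∑[ b ∈ values H ] ∑[ p ∈ ps ] ⟦ p ∣? distance a b ⟧ * ⟦ ¬? (a ≟ b) ⟧)
        ≤⟨ ∑-bound (values H) (λ a∈ → ∑-bound (values H) (λ b∈ → pair a∈ b∈)) ⟩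
      length (values H) * (length (values H) * (V * T * H))
        ≡⟨ cong₂ (λ u v → u * (v * (V * T * H))) (length-values H) (length-values H) ⟩
      T ^ H * (T ^ H * (V * T * H)) ∎
      where
      open ≤-Reasoning
      pair : ∀ {a b} → a ∈ values H → b ∈ values H →
             ∑[ p ∈ ps ] ⟦ p ∣? distance a b ⟧ * ⟦ ¬? (a ≟ b) ⟧ ≤ V * T * H
      pair {a} {b} a∈ b∈ with a ≟ b
      ... | yes _  = ≤-trans (≤-reflexive (trans (∑-*ʳ ps (λ p → ⟦ p ∣? distance a b ⟧) 0) (*-zeroʳ (∑ ps (λ p → ⟦ p ∣? distance a b ⟧))))) z≤n
      ... | no a≢b = ≤-trans (≤-reflexive (∑-cong ps (λ {p} _ → *-comm ⟦ p ∣? distance a b ⟧ 1)))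
        (∑-prime-divisors un prs (λ _ → 1) (λ p∈ → prime⇒≥2 (All.lookup prs p∈)) (distance a b) {{nz}} (V * T * H)
          (≤-trans (≤-trans (≤-reflexive (cong ℤ.∣_∣ (ℤ.m-n≡m⊖n a b))) (ℤ.∣m⊝n∣≤m⊔n a b))
            (⊔-lub (<⇒≤ (values-bound H a∈)) (<⇒≤ (values-bound H b∈)))))
        where
        nz : NonZero (distance a b)
        nz = ≢-nonZero (λ eq → a≢b (ℤ.+-injective (ℤ.i-j≡0⇒i≡j (ℤ.+ a) (ℤ.+ b) (ℤ.∣i∣≡0⇒i≡0 eq))))

    -- For odd p it vanishes exactly if the order of 2 ^ V modulo p exceeds U. Each 2 ^ (V j) - 1
    -- has at most V j prime divisors, hence this fails for few primes.
    periods : ℕ → ℕ → ℕ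
    periods U p = ∑[ j ∈ upTo U ] ⟦ p ∣? (2 ^ (V * suc j) ∸ 1) ⟧

    ∑-periods : ∀ U {ps} → Unique ps → All Prime ps → ∑ ps (periods U) ≤ U * (V * U)
    ∑-periods U {ps} un prs = ≤-trans (≤-reflexive (∑-swap ps (upTo U) _)) (∑-upTo-bound U (λ {j} j<U → begin
        (∑[ p ∈ ps ] ⟦ p ∣? (2 ^ (V * suc j) ∸ 1) ⟧)  ≡⟨ ∑-cong ps (λ _ → sym (*-identityˡ _)) ⟩
        (∑[ p ∈ ps ] 1 * ⟦ p ∣? (2 ^ (V * suc j) ∸ 1) ⟧) ≤⟨ ∑-prime-divisors un prs (λ _ → 1) (λ p∈ → prime⇒≥2 (All.lookup prs p∈))
                                                              _ {{nz j}} (V * suc j) (m∸n≤m _ 1) ⟩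
        V * suc j  ≤⟨ *-monoʳ-≤ V j<U ⟩
        V * U  ∎))
      where
      open ≤-Reasoning
      nz : ∀ j → NonZero (2 ^ (V * suc j) ∸ 1)
      nz j = >-nonZero (m<n⇒0<n∸m (^-monoʳ-< 2 (s≤s (s≤s z≤n)) {0} (>-nonZero⁻¹ _ {{m*n≢0 V (suc j)}})))

    powers-distinct : ∀ U {p} → Prime p → 2 < p → periods U p ≡ 0 → ∀ x →
                      ∑[ b ∈ map (λ b → 2 ^ (V * b)) (upTo U) ] ⟦ Congruence._≈?_ p b x ⟧ ≤ 1
    powers-distinct U {p} pr 2<p none x = ≤-trans (≤-reflexive (∑-map (λ b → 2 ^ (V * b)) (upTo U) _))
      (∑-unique (Unique.upTo⁺ U) (λ b → 2 ^ (V * b) ≈? x) (λ {b} {c} b∈ c∈ h h′ →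
        unique b c (∈-upTo⁻ b∈) (∈-upTo⁻ c∈) (≈-trans {2 ^ (V * b)} {x} {2 ^ (V * c)} h (≈-sym {2 ^ (V * c)} {x} h′))))
      where
      open Congruence p
      -- An odd prime does not divide 2 ^ (V b), so cancelling this power leaves a period d + 1 ≤ U,
      -- which `none` excludes.
      gap : ∀ b d → b + suc d < U → ¬ 2 ^ (V * b) ≈ 2 ^ (V * (b + suc d))
      gap b d lt h = impossible (euclidsLemma (2 ^ (V * b)) (2 ^ (V * suc d) ∸ 1) pr
          (≈0⇒∣ {2 ^ (V * b) * (2 ^ (V * suc d) ∸ 1)} (≈-cancel-+ʳ {2 ^ (V * b) * (2 ^ (V * suc d) ∸ 1)} {0} (2 ^ (V * b))
            (≈-sym {2 ^ (V * b)} (subst (2 ^ (V * b) ≈_) shape h)))))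
        where
        shape : 2 ^ (V * (b + suc d)) ≡ 2 ^ (V * b) * (2 ^ (V * suc d) ∸ 1) + 2 ^ (V * b)
        shape = trans (cong (2 ^_) (*-distribˡ-+ V b (suc d))) (trans (^-distribˡ-+-* 2 (V * b) (V * suc d))
          (trans (cong (2 ^ (V * b) *_) (sym (m∸n+n≡m (m^n>0 2 (V * suc d)))))
            (trans (*-distribˡ-+ (2 ^ (V * b)) _ 1) (cong (2 ^ (V * b) * (2 ^ (V * suc d) ∸ 1) +_) (*-identityʳ (2 ^ (V * b)))))))
        impossible : ¬ (p ∣ 2 ^ (V * b) ⊎ p ∣ 2 ^ (V * suc d) ∸ 1)
        impossible (inj₁ h) = <⇒≱ 2<p (prime∣2^ pr (V * b) h)
        impossible (inj₂ h) = ⟦⟧≡0⇒¬ (p ∣? (2 ^ (V * suc d) ∸ 1))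
          (∑≡0⇒ {xs = upTo U} (λ j → ⟦ p ∣? (2 ^ (V * suc j) ∸ 1) ⟧) none (∈-upTo⁺ (<-trans ≤-refl (≤-<-trans (m≤n+m (suc d) b) lt)))) h
      unique : ∀ b c → b < U → c < U → 2 ^ (V * b) ≈ 2 ^ (V * c) → b ≡ c
      unique b c b<U c<U h with <-cmp b c
      ... | tri≈ _ b≡c _ = b≡c
      ... | tri< b<c _ _ with difference b<c
      ...   | d , refl = contradiction h (gap b d c<U)
      unique b c b<U c<U h | tri> _ _ c<b with difference c<b
      ...   | d , refl = contradiction (≈-sym {2 ^ (V * b)} {2 ^ (V * c)} h) (gap c d b<U)

  -- For primes of size about Z ^ e, where Z = 2 ^ s, the incidence theorem is
  -- applied to sums of H powers of 2 ^ V with Z choices for each exponent, and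
  -- to Z ^ u multipliers. V ranges over 1, …, Z.
  module Block (s e H u : ℕ) where

    private
      Z : ℕ
      Z = 2 ^ s

      module _ (i : ℕ) where
        open Values (suc i) Z public

    instance
      2^sH≢0 : NonZero (2 ^ (s * H))
      2^sH≢0 = m^n≢0 2 (s * H)

    -- The quotient vanishes exactly if there are fewer collisions than values, so that the energy
    -- is at most twice the number of values. Being a natural number, `badness` is at least 1 at
    -- every failing prime, so its sum also bounds how many primes fail. All V up to Z are included
    -- because the V that will occur depends on the other prime factors of n.
    badness : ℕ → ℕ
    badness p = ∑[ i ∈ upTo Z ] (collisions i H p / 2 ^ (s * H) + periods i (2 ^ (s * u)) p)

    -- The first hypothesis is the incidence condition in exponents of 2, with p below 2 ^ ((s + 1)
    -- e) and the energy at most 2 · 2 ^ (s H). In the constant 4, three come from the cube of that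
    -- factor 2 and one from the strict inequality.
    badness≡0⇒sum : 4 + suc s * e * 3 ≤ s * u + s * H * 3 →
                    ∀ {p} → Prime p → 2 < p → p < 2 ^ (suc s * e) → badness p ≡ 0 →
                    ∀ {V} → 1 ≤ V → V ≤ Z → ∃[ m ] SumOf V (H + H + H) m × p ∣ m
    badness≡0⇒sum cond {p} pr 2<p p< good {suc i} _ i<Z = conclude (incidence pr A B distinct big)
      where
      open ≤-Reasoning
      good-i : collisions i H p / 2 ^ (s * H) + periods i (2 ^ (s * u)) p ≡ 0
      good-i = ∑≡0⇒ (λ i → collisions i H p / 2 ^ (s * H) + periods i (2 ^ (s * u)) p) good (∈-upTo⁺ i<Z)
      A B : List ℕ
      A = values i H
      B = map (λ b → 2 ^ (suc i * b)) (upTo (2 ^ (s * u)))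
      distinct : ∀ x → ∑[ b ∈ B ] ⟦ Congruence._≈?_ p b x ⟧ ≤ 1
      distinct = powers-distinct i (2 ^ (s * u)) pr 2<p (m+n≡0⇒n≡0 (collisions i H p / 2 ^ (s * H)) good-i)
      Z^H : Z ^ H ≡ 2 ^ (s * H)
      Z^H = ^-*-assoc 2 s H
      |A| : length A ≡ 2 ^ (s * H)
      |A| = trans (length-values i H) Z^H
      |B| : length B ≡ 2 ^ (s * u)
      |B| = trans (length-map (λ b → 2 ^ (suc i * b)) (upTo (2 ^ (s * u)))) (length-upTo (2 ^ (s * u)))
      E n : ℕ
      n = length A
      E = ∑[ a ∈ A ] ∑[ a′ ∈ A ] ⟦ Congruence._≈?_ p a a′ ⟧
      E≤ : E ≤ 2 ^ suc (s * H)
      E≤ = begin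
        E  ≤⟨ energy≤ i H p ⟩
        Z ^ H + collisions i H p  ≤⟨ +-mono-≤ (≤-reflexive Z^H) (<⇒≤ (m/n≡0⇒m<n (m+n≡0⇒m≡0 (collisions i H p / 2 ^ (s * H)) good-i))) ⟩
        2 ^ (s * H) + 2 ^ (s * H)  ≡⟨ cong (2 ^ (s * H) +_) (sym (+-identityʳ (2 ^ (s * H)))) ⟩
        2 ^ suc (s * H)  ∎
      cube : ∀ {x} a → x ≤ 2 ^ a → x * x * x ≤ 2 ^ (a + a + a)
      cube a h = ≤-trans (*-mono-≤ (*-mono-≤ h h) h) (≤-reflexive (trans (cong (_* 2 ^ a) (sym (^-distribˡ-+-* 2 a a))) (sym (^-distribˡ-+-* 2 (a + a) a))))
      cube-≡ : ∀ {x} a → x ≡ 2 ^ a → x * x * x ≡ 2 ^ (a + a + a)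
      cube-≡ a refl = trans (cong (_* 2 ^ a) (sym (^-distribˡ-+-* 2 a a))) (sym (^-distribˡ-+-* 2 (a + a) a))
      big : p * p * p * (E * E * E) < length B * ((n * n * n) * (n * n * n))
      big = begin-strict
        p * p * p * (E * E * E)  ≤⟨ *-mono-≤ (cube P (<⇒≤ p<)) (cube (suc N) E≤) ⟩
        2 ^ (P + P + P) * 2 ^ (suc N + suc N + suc N)  ≡⟨ ^-distribˡ-+-* 2 (P + P + P) _ ⟨
        2 ^ ((P + P + P) + (suc N + suc N + suc N))  <⟨ ^-monoʳ-< 2 (s≤s (s≤s z≤n)) exponents ⟩
        2 ^ (s * u + ((N + N + N) + (N + N + N)))  ≡⟨ trans (^-distribˡ-+-* 2 (s * u) _) (cong (2 ^ (s * u) *_) (^-distribˡ-+-* 2 (N + N + N) (N + N + N))) ⟩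
        2 ^ (s * u) * (2 ^ (N + N + N) * 2 ^ (N + N + N))  ≡⟨ cong₂ (λ b c → b * (c * c)) |B| (cube-≡ N |A|) ⟨
        length B * ((n * n * n) * (n * n * n))  ∎
        where
        P N : ℕ
        P = suc s * e
        N = s * H
        exponents : (P + P + P) + (suc N + suc N + suc N) < s * u + ((N + N + N) + (N + N + N))
        exponents = subst₂ _≤_ (left P N) (right (s * u) N) (+-monoˡ-≤ (N * 3) cond)
          where
          left : ∀ P N → 4 + P * 3 + N * 3 ≡ suc ((P + P + P) + (suc N + suc N + suc N))
          left = solve-∀
          right : ∀ U N → U + N * 3 + N * 3 ≡ U + ((N + N + N) + (N + N + N))
          right = solve-∀
      conclude : ∃[ a ] ∃[ b ] ∃[ c ] ∃[ d ] a ∈ A × b ∈ A × c ∈ A × d ∈ B × Congruence._≈_ p (a * d + b + c) 0 →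
                 ∃[ m ] SumOf (suc i) (H + H + H) m × p ∣ m
      conclude (a , b , c , d , a∈ , b∈ , c∈ , d∈ , h) with ∈-map⁻ (λ b → 2 ^ (suc i * b)) d∈
      -- Multiplication by `d`, a power of 2 ^ V, only shifts the exponents of `a`; so three sums of
      -- H powers are all that is needed.
      ... | x , _ , refl = 2 ^ (suc i * x) * a + b + c ,
            SumOf-+ {suc i} (SumOf-+ {suc i} (SumOf-shift {suc i} x (values-SumOf i H a∈)) (values-SumOf i H b∈)) (values-SumOf i H c∈) ,
            subst (λ k → p ∣ k + b + c) (*-comm a (2 ^ (suc i * x))) (Congruence.≈0⇒∣ p {a * 2 ^ (suc i * x) + b + c} h)

    ∑-badness : ∀ {ps} → Unique ps → All Prime ps →
                ∑ ps badness ≤ Z * (2 ^ (s * H) * (Z * Z * H) + 2 ^ (s * u) * (Z * 2 ^ (s * u)))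
    ∑-badness {ps} un prs = begin
      ∑ ps badness
        ≡⟨ ∑-swap ps (upTo Z) _ ⟩
      (∑[ i ∈ upTo Z ] ∑[ p ∈ ps ] (collisions i H p / 2 ^ (s * H) + periods i (2 ^ (s * u)) p))
        ≤⟨ ∑-upTo-bound Z (λ {i} i<Z → subst (_≤ _) (sym (∑-+ ps (λ p → collisions i H p / 2 ^ (s * H)) (periods i (2 ^ (s * u)))))
             (+-mono-≤ (first i i<Z) (≤-trans (∑-periods i (2 ^ (s * u)) un prs) (*-monoʳ-≤ (2 ^ (s * u)) (*-monoˡ-≤ (2 ^ (s * u)) i<Z))))) ⟩
      Z * (2 ^ (s * H) * (Z * Z * H) + 2 ^ (s * u) * (Z * 2 ^ (s * u))) ∎
      where
      open ≤-Reasoning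
      first : ∀ i → i < Z → ∑[ p ∈ ps ] (collisions i H p / 2 ^ (s * H)) ≤ 2 ^ (s * H) * (Z * Z * H)
      first i i<Z = *-cancelʳ-≤ _ _ (2 ^ (s * H)) (begin
        (∑[ p ∈ ps ] (collisions i H p / 2 ^ (s * H))) * 2 ^ (s * H)  ≡⟨ ∑-*ʳ ps _ (2 ^ (s * H)) ⟨
        (∑[ p ∈ ps ] collisions i H p / 2 ^ (s * H) * 2 ^ (s * H))  ≤⟨ ∑-mono ps (λ {p} _ → m/n*n≤m (collisions i H p) (2 ^ (s * H))) ⟩
        ∑ ps (collisions i H)  ≤⟨ ∑-collisions i H un prs ⟩
        Z ^ H * (Z ^ H * (suc i * Z * H))  ≡⟨ cong₂ (λ x y → x * (y * (suc i * Z * H))) (^-*-assoc 2 s H) (^-*-assoc 2 s H) ⟩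
        2 ^ (s * H) * (2 ^ (s * H) * (suc i * Z * H))  ≤⟨ *-monoʳ-≤ (2 ^ (s * H)) (*-monoʳ-≤ (2 ^ (s * H)) (*-monoˡ-≤ H (*-monoˡ-≤ Z i<Z))) ⟩
        2 ^ (s * H) * (2 ^ (s * H) * (Z * Z * H))  ≡⟨ *-comm (2 ^ (s * H)) _ ⟩
        2 ^ (s * H) * (Z * Z * H) * 2 ^ (s * H)  ∎)

-- Chinese remaindering of exponents.

module Exponents where

  open Sums
  open Incidence using (module Congruence)
  open Primes
  open Blocks using (SumOf)
  open import Data.List.Base using (List; []; _∷_; length; upTo; map; filter)
  open import Data.List.Membership.Propositional using (_∈_)
  open import Data.List.Membership.Propositional.Properties using (∈-map⁺; ∈-filter⁺)
  open import Data.List.Relation.Unary.All as All using (All; []; _∷_)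
  open import Data.List.Relation.Unary.AllPairs.Core using ([]; _∷_)
  open import Data.List.Relation.Unary.Any using (here; there)
  open import Data.List.Relation.Unary.Unique.Propositional using (Unique)
  open import Data.Nat.Base
  open import Data.Nat.Divisibility
  open import Data.Nat.GCD
  open import Data.Nat.ListAction using (product)
  open import Data.Nat.ListAction.Properties using (∈⇒∣product)
  open import Data.Nat.Primality
  open import Data.Nat.Properties
  open import Data.Nat.Tactic.RingSolver using (solve-∀)
  open import Data.Product.Base using (_×_; _,_; ∃-syntax)
  open import Relation.Binary.PropositionalEquality
  open import Relation.Nullary using (¬_)
  open import Relation.Nullary.Decidable using (¬?)

  -- A multiple of T congruent to the gcd modulo t, stated without subtraction. If Bézout's
  -- coefficient of T is - x, it is replaced by x (t - 1), which is congruent to it modulo t.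
  bézout-multiple : ∀ T t .{{_ : NonZero t}} → ∃[ E ] ∃[ a ] ∃[ b ] T ∣ E × E + a * t ≡ gcd T t + b * t
  bézout-multiple T t@(suc t′) with Bézout.identity (gcd-GCD T t)
  ... | Bézout.+- x y eq = x * T , 0 , y , n∣m*n x , trans (+-identityʳ (x * T)) (sym eq)
  ... | Bézout.-+ x y eq = x * T * t′ , y , x * T , ∣m⇒∣m*n t′ (n∣m*n x) ,
    trans (cong (x * T * t′ +_) (sym eq)) (shuffle (x * T) t′ (gcd T t))
    where
    shuffle : ∀ c t d → c * t + (d + c) ≡ d + c * suc t
    shuffle = solve-∀

  -- The default 0 never enters a sum, since only indices below the length are summed; it lets
  -- exponents be functions on all of ℕ.
  nth : List ℕ → ℕ → ℕ
  nth []       _       = 0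
  nth (x ∷ xs) zero    = x
  nth (x ∷ xs) (suc i) = nth xs i

  ∑-nth : ∀ xs (f : ℕ → ℕ) → ∑[ i ∈ upTo (length xs) ] f (nth xs i) ≡ ∑ xs f
  ∑-nth []       f = refl
  ∑-nth (x ∷ xs) f = trans (∑-upTo-head (length xs) (λ i → f (nth (x ∷ xs) i))) (cong (f x +_) (∑-nth xs f))

  module Powers {p t : ℕ} (2^t≈1 : Congruence._≈_ p (2 ^ t) 1) where
    open Congruence p

    ≈-^ : ∀ {x y} n → x ≈ y → x ^ n ≈ y ^ n
    ≈-^ zero    h = ≈-refl {1}
    ≈-^ {x} {y} (suc n) h = ≈-* {x} {y} {x ^ n} {y ^ n} h (≈-^ {x} {y} n h)

    1^n≡1 : ∀ n → 1 ^ n ≡ 1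
    1^n≡1 zero    = refl
    1^n≡1 (suc n) = trans (+-identityʳ (1 ^ n)) (1^n≡1 n)

    2^-multiple : ∀ a → 2 ^ (a * t) ≈ 1
    2^-multiple a = subst₂ _≈_ (trans (^-*-assoc 2 t a) (cong (2 ^_) (*-comm t a))) (1^n≡1 a) (≈-^ {2 ^ t} {1} a 2^t≈1)

    2^-+multiple : ∀ x a → 2 ^ (x + a * t) ≈ 2 ^ x
    2^-+multiple x a = subst₂ _≈_ (sym (^-distribˡ-+-* 2 x (a * t))) (*-identityʳ (2 ^ x))
      (≈-* {2 ^ x} {2 ^ x} {2 ^ (a * t)} {1} (≈-refl {2 ^ x}) (2^-multiple a))

    2^-cong : ∀ {x y} a b → x + a * t ≡ y + b * t → 2 ^ x ≈ 2 ^ y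
    2^-cong {x} {y} a b eq = ≈-trans {2 ^ x} {2 ^ (x + a * t)} {2 ^ y} (≈-sym {2 ^ (x + a * t)} {2 ^ x} (2^-+multiple x a))
      (subst (λ z → 2 ^ z ≈ 2 ^ y) (sym eq) (2^-+multiple y b))

    ≈-∑ : ∀ {A : Set} (xs : List A) {f g : A → ℕ} → (∀ x → f x ≈ g x) → ∑ xs f ≈ ∑ xs g
    ≈-∑ []       h = ≈-refl {0}
    ≈-∑ (x ∷ xs) {f} {g} h = ≈-+ {f x} {g x} {∑ xs f} {∑ xs g} (h x) (≈-∑ xs {f} {g} h)

  -- Modulo p the exponents matter modulo p − 1, so solutions for the single
  -- primes combine once their exponents are multiples of the common factors.
  module _ (ps : List ℕ) (un : Unique ps) (prs : All Prime ps) (odd : ∀ {p} → p ∈ ps → 2 < p) (k : ℕ) where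

    cofactor : ℕ → ℕ
    cofactor p = product (map pred (filter (λ q → ¬? (q ≟ p)) ps))

    private
      t∣cofactor : ∀ {p q} → p ∈ ps → p ≢ q → pred p ∣ cofactor q
      t∣cofactor {p} {q} p∈ p≢q = ∈⇒∣product (∈-map⁺ pred (∈-filter⁺ (λ q′ → ¬? (q′ ≟ q)) p∈ p≢q))

    -- The primes are treated one at a time. The invariant for those still untreated is that all
    -- exponents are 0 modulo p - 1. Treating q adds `E` c to the exponent in the same position,
    -- where `E` is V modulo q - 1 and 0 modulo every other p - 1: the exponents become V c for q
    -- and keep their classes for the rest. Each position is adjusted separately, so the number of
    -- summands stays k.
    combine : (∀ {p} → p ∈ ps → ∃[ m ] SumOf (gcd (cofactor p) (pred p)) k m × p ∣ m) →
              ∀ qs → Unique qs → (∀ {q} → q ∈ qs → q ∈ ps) →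
              ∃[ e ] (∀ {p} → p ∈ ps → ¬ p ∈ qs → ∀ i → pred p ∣ e i) ×
                     (∀ {p} → p ∈ qs → p ∣ ∑[ i ∈ upTo k ] 2 ^ e i)
    combine sol []       _           _   = (λ _ → 0) , (λ _ _ _ → _ ∣0) , (λ ())
    combine sol (q ∷ qs) (q∉ ∷ unqs) sub with sol (sub (here refl)) | combine sol qs unqs (λ q∈ → sub (there q∈))
    ... | m , (cs , refl , refl) , q∣m | e , outside , inside
        with bézout-multiple (cofactor q) (pred q) {{>-nonZero (≤-trans (s≤s z≤n) (pred-mono-≤ (odd (sub (here refl)))))}}
    ...   | E , a , b , T∣E , E≡ = e′ , outside′ , inside′
      where
      q∈ps : q ∈ ps
      q∈ps = sub (here refl)
      e′ : ℕ → ℕ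
      e′ i = E * nth cs i + e i
      t∣E : ∀ {p} → p ∈ ps → p ≢ q → pred p ∣ E
      t∣E p∈ p≢q = ∣-trans (t∣cofactor p∈ p≢q) T∣E
      outside′ : ∀ {p} → p ∈ ps → ¬ p ∈ q ∷ qs → ∀ i → pred p ∣ e′ i
      outside′ p∈ p∉ i = ∣m∣n⇒∣m+n (∣m⇒∣m*n (nth cs i) (t∣E p∈ (λ p≡q → p∉ (here p≡q)))) (outside p∈ (λ p∈qs → p∉ (there p∈qs)) i)
      sum-divisible : ∀ {p} → p ∈ ps → ∀ (f g : ℕ → ℕ) → (∀ i → ∃[ x ] ∃[ y ] f i + x * pred p ≡ g i + y * pred p) →
                      p ∣ ∑[ i ∈ upTo k ] 2 ^ g i → p ∣ ∑[ i ∈ upTo k ] 2 ^ f i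
      sum-divisible {p} p∈ f g h d = ≈0⇒∣ {∑[ i ∈ upTo k ] 2 ^ f i} (≈-trans {∑[ i ∈ upTo k ] 2 ^ f i} {∑[ i ∈ upTo k ] 2 ^ g i} {0}
          (≈-∑ (upTo k) {λ i → 2 ^ f i} {λ i → 2 ^ g i} (λ i → let x , y , eq = h i in 2^-cong {f i} {g i} x y eq))
          (∣⇒≈0 {∑[ i ∈ upTo k ] 2 ^ g i} d))
        where
        open Congruence p
        open Powers {p} {pred p} (fermat (All.lookup prs p∈) (odd p∈))
      inside′ : ∀ {p} → p ∈ q ∷ qs → p ∣ ∑[ i ∈ upTo k ] 2 ^ e′ i
      inside′ {p} (there p∈) = sum-divisible (sub (there p∈)) e′ e shift (inside p∈)
        where
        shift : ∀ i → ∃[ x ] ∃[ y ] e′ i + x * pred p ≡ e i + y * pred p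
        shift i with ∣m⇒∣m*n (nth cs i) (t∣E (sub (there p∈)) (λ p≡q → All.lookup q∉ p∈ (sym p≡q)))
        ... | divides y eq = 0 , y , trans (+-identityʳ _) (trans (+-comm (E * nth cs i) (e i)) (cong (e i +_) eq))
      inside′ (here refl) = sum-divisible q∈ps e′ (λ i → V * nth cs i) shift (subst (q ∣_) (sym (∑-nth cs (λ c → 2 ^ (V * c)))) q∣m)
        where
        V : ℕ
        V = gcd (cofactor q) (pred q)
        q∉qs : ¬ q ∈ qs
        q∉qs q∈ = All.lookup q∉ q∈ refl
        shift : ∀ i → ∃[ x ] ∃[ y ] e′ i + x * pred q ≡ V * nth cs i + y * pred q
        shift i with outside q∈ps q∉qs i
        ... | divides z eq = nth cs i * a , nth cs i * b + z , (begin
          E * c + e i + c * a * t  ≡⟨ cong (λ w → E * c + w + c * a * t) eq ⟩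
          E * c + z * t + c * a * t  ≡⟨ left E c z t a ⟩
          c * (E + a * t) + z * t  ≡⟨ cong (λ w → c * w + z * t) E≡ ⟩
          c * (V + b * t) + z * t  ≡⟨ right V c z t b ⟩
          V * c + (c * b + z) * t  ∎)
          where
          open ≡-Reasoning
          c t : ℕ
          c = nth cs i
          t = pred q
          left : ∀ E c z t a → E * c + z * t + c * a * t ≡ c * (E + a * t) + z * t
          left = solve-∀
          right : ∀ V c z t b → c * (V + b * t) + z * t ≡ V * c + (c * b + z) * t
          right = solve-∀

    common-multiple : (∀ {p} → p ∈ ps → ∃[ m ] SumOf (gcd (cofactor p) (pred p)) k m × p ∣ m) →
                      ∃[ e ] product ps ∣ ∑[ i ∈ upTo k ] 2 ^ e i
    common-multiple sol with combine sol ps un (λ q∈ → q∈)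
    ... | e , _ , inside = e , product-distinct-∣ un prs inside

-- Hamming weight, and upper bounds for `M` from representations as sums of powers of 2.

module Weight where

  open Sums
  open import Data.Digit using (fromDigits; toDigits)
  open import Data.Fin.Base as Fin using (Fin; zero; suc; toℕ)
  import Data.Fin.Properties as Fin
  open import Data.List.Base using (List; []; _∷_; length; upTo; map; cartesianProductWith)
  open import Data.List.Properties using (length-map; length-upTo)
  open import Data.Nat.Base
  open import Data.Nat.DivMod
  open import Data.Nat.Divisibility
  open import Data.Nat.Induction using (<-rec)
  open import Data.Nat.Properties
  open import Data.Nat.Tactic.RingSolver using (solve-∀)
  open import Data.Product.Base using (_×_; _,_; proj₁; proj₂; ∃-syntax)
  open import Relation.Binary.PropositionalEquality

  digit-unique : ∀ (d e : Fin 2) u v → toℕ d + u * 2 ≡ toℕ e + v * 2 → d ≡ e × u ≡ v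
  digit-unique d e u v eq = Fin.toℕ-injective d≡e , *-cancelʳ-≡ u v 2 (+-cancelˡ-≡ (toℕ d) _ _ (trans eq (cong (_+ v * 2) (sym d≡e))))
    where
    low : ∀ (d : Fin 2) u → (toℕ d + u * 2) % 2 ≡ toℕ d
    low d u = trans ([m+kn]%n≡m%n (toℕ d) u 2) (m<n⇒m%n≡m (Fin.toℕ<n d))
    d≡e : toℕ d ≡ toℕ e
    d≡e = trans (sym (low d u)) (trans (cong (_% 2) eq) (low e v))

  ones-cong : ∀ ds es → fromDigits ds ≡ fromDigits es → ones ds ≡ ones es
  ones-cong []       []       eq = refl
  ones-cong []       (e ∷ es) eq with digit-unique zero e 0 (fromDigits es) eq
  ... | refl , eq′ = ones-cong [] es eq′
  ones-cong (d ∷ ds) []       eq with digit-unique d zero (fromDigits ds) 0 eq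
  ... | refl , eq′ = ones-cong ds [] eq′
  ones-cong (d ∷ ds) (e ∷ es) eq with digit-unique d e (fromDigits ds) (fromDigits es) eq
  ones-cong (zero     ∷ ds) (_ ∷ es) eq | refl , eq′ = ones-cong ds es eq′
  ones-cong (suc zero ∷ ds) (_ ∷ es) eq | refl , eq′ = cong suc (ones-cong ds es eq′)

  s₂≡ones : ∀ ds m → m ≡ fromDigits ds → s₂ m ≡ ones ds
  s₂≡ones ds m eq = ones-cong (proj₁ (toDigits 2 m)) ds (trans (proj₂ (toDigits 2 m)) eq)

  s₂-even : ∀ m → s₂ (m * 2) ≡ s₂ m
  s₂-even m = s₂≡ones (zero ∷ proj₁ (toDigits 2 m)) (m * 2) (cong (_* 2) (sym (proj₂ (toDigits 2 m))))

  s₂-odd : ∀ m → s₂ (1 + m * 2) ≡ suc (s₂ m)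
  s₂-odd m = s₂≡ones (suc zero ∷ proj₁ (toDigits 2 m)) (1 + m * 2) (cong (λ k → 1 + k * 2) (sym (proj₂ (toDigits 2 m))))

  data Halving : ℕ → Set where
    even : ∀ m → Halving (m * 2)
    odd  : ∀ m → Halving (1 + m * 2)

  halving : ∀ n → Halving n
  halving zero = even 0
  halving (suc n) with halving n
  ... | even m = odd m
  ... | odd  m = even (suc m)

  s₂-suc : ∀ m → s₂ (suc m) ≤ suc (s₂ m)
  s₂-suc = <-rec _ step
    where
    step : ∀ m → (∀ {k} → k < m → s₂ (suc k) ≤ suc (s₂ k)) → s₂ (suc m) ≤ suc (s₂ m)
    step m rec with halving m
    ... | even k = ≤-reflexive (trans (s₂-odd k) (cong suc (sym (s₂-even k))))
    ... | odd  k = begin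
      s₂ (suc k * 2)  ≡⟨ s₂-even (suc k) ⟩
      s₂ (suc k)  ≤⟨ rec (s≤s (m≤m*n k 2)) ⟩
      suc (s₂ k)  ≡⟨ s₂-odd k ⟨
      s₂ (1 + k * 2)  ≤⟨ n≤1+n _ ⟩
      suc (s₂ (1 + k * 2))  ∎
      where open ≤-Reasoning

  -- The lowest a bits are untouched; above them the addition is a successor, and a carry never
  -- leaves more than one additional 1.
  s₂-2^+ : ∀ a m → s₂ (2 ^ a + m) ≤ suc (s₂ m)
  s₂-2^+ zero    m = s₂-suc m
  s₂-2^+ (suc a) m with halving m
  ... | even k = begin
    s₂ (2 * 2 ^ a + k * 2)  ≡⟨ cong s₂ (shuffle (2 ^ a) k) ⟩
    s₂ ((2 ^ a + k) * 2)  ≡⟨ s₂-even (2 ^ a + k) ⟩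
    s₂ (2 ^ a + k)  ≤⟨ s₂-2^+ a k ⟩
    suc (s₂ k)  ≡⟨ cong suc (s₂-even k) ⟨
    suc (s₂ (k * 2))  ∎
    where
    open ≤-Reasoning
    shuffle : ∀ x k → 2 * x + k * 2 ≡ (x + k) * 2
    shuffle = solve-∀
  ... | odd k = begin
    s₂ (2 * 2 ^ a + (1 + k * 2)) ≡⟨ cong s₂ (shuffle (2 ^ a) k) ⟩
    s₂ (1 + (2 ^ a + k) * 2)  ≡⟨ s₂-odd (2 ^ a + k) ⟩
    suc (s₂ (2 ^ a + k))  ≤⟨ s≤s (s₂-2^+ a k) ⟩
    suc (suc (s₂ k))  ≡⟨ cong suc (s₂-odd k) ⟨
    suc (s₂ (1 + k * 2))  ∎
    where
    open ≤-Reasoning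
    shuffle : ∀ x k → 2 * x + (1 + k * 2) ≡ 1 + (x + k) * 2
    shuffle = solve-∀

  s₂-∑ : ∀ as → s₂ (∑[ a ∈ as ] 2 ^ a) ≤ length as
  s₂-∑ []       = ≤-refl
  s₂-∑ (a ∷ as) = ≤-trans (s₂-2^+ a (∑[ a ∈ as ] 2 ^ a)) (s≤s (s₂-∑ as))

  bits : ∀ w n → n < 2 ^ w → ∃[ as ] ∑[ a ∈ as ] 2 ^ a ≡ n × length as ≤ w
  bits zero    zero    _ = [] , refl , z≤n
  bits zero    (suc n) (s≤s ())
  bits (suc w) n n<2^ with halving n
  ... | even m with bits w m (*-cancelʳ-< 2 m (2 ^ w) (subst (m * 2 <_) (*-comm 2 (2 ^ w)) n<2^))
  ...   | as , refl , len = map suc as , shifted as , ≤-trans (≤-reflexive (length-map suc as)) (m≤n⇒m≤1+n len)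
    where
    shifted : ∀ as → ∑[ a ∈ map suc as ] 2 ^ a ≡ (∑[ a ∈ as ] 2 ^ a) * 2
    shifted as = trans (∑-map suc as (2 ^_)) (trans (∑-*ˡ as 2 (2 ^_)) (*-comm 2 (∑ as (2 ^_))))
  bits (suc w) n n<2^ | odd m with bits w m (*-cancelʳ-< 2 m (2 ^ w) (subst (m * 2 <_) (*-comm 2 (2 ^ w)) (<-trans ≤-refl n<2^)))
  ...   | as , refl , len = 0 ∷ map suc as , cong suc (shifted as) , s≤s (≤-trans (≤-reflexive (length-map suc as)) len)
    where
    shifted : ∀ as → ∑[ a ∈ map suc as ] 2 ^ a ≡ (∑[ a ∈ as ] 2 ^ a) * 2
    shifted as = trans (∑-map suc as (2 ^_)) (trans (∑-*ˡ as 2 (2 ^_)) (*-comm 2 (∑ as (2 ^_))))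

  M-minimal : ∀ n .{{_ : NonZero n}} as q → 1 ≤ q → ∑[ a ∈ as ] 2 ^ a ≡ q * n → M n ≤ length as
  M-minimal n as q 1≤q eq = ≤-trans (proj₂ (proj₂ (minWeight n)) q 1≤q) (subst (λ m → s₂ m ≤ length as) eq (s₂-∑ as))

  M≤bits : ∀ n .{{_ : NonZero n}} w → n < 2 ^ w → M n ≤ w
  M≤bits n w n<2^ with bits w n n<2^
  ... | as , eq , len = ≤-trans (M-minimal n as 1 ≤-refl (trans eq (sym (*-identityˡ n)))) len

  -- Submultiplicativity with witnesses: the powers in the expansion of b times the k powers in a
  -- multiple of r give at most w k powers, whose sum is a multiple of b r. Since 1 ≤ k the sum is
  -- positive, so the multiple is not the excluded multiple 0.
  M≤product : ∀ n .{{_ : NonZero n}} b r w k (e : ℕ → ℕ) → 1 ≤ k → n ≡ b * r → b < 2 ^ w →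
              r ∣ ∑[ i ∈ upTo k ] 2 ^ e i → M n ≤ w * k
  M≤product n b r w k e 1≤k n≡ b<2^ (divides q eq) with bits w b b<2^
  ... | as , refl , len = ≤-trans (M-minimal n cs q 1≤q value) (≤-trans (≤-reflexive length-cs) (*-monoˡ-≤ k len))
    where
    cs : List ℕ
    cs = cartesianProductWith (λ a i → a + e i) as (upTo k)
    value : ∑[ c ∈ cs ] 2 ^ c ≡ q * n
    value = begin
      (∑[ c ∈ cs ] 2 ^ c)  ≡⟨ ∑-cartesian (λ a i → a + e i) as (upTo k) (2 ^_) ⟩
      (∑[ a ∈ as ] ∑[ i ∈ upTo k ] 2 ^ (a + e i))  ≡⟨ ∑-cong as (λ {a} _ → ∑-cong (upTo k) (λ {i} _ → ^-distribˡ-+-* 2 a (e i))) ⟩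
      (∑[ a ∈ as ] ∑[ i ∈ upTo k ] 2 ^ a * 2 ^ e i)  ≡⟨ ∑*∑ as (upTo k) (2 ^_) (λ i → 2 ^ e i) ⟨
      b * (∑[ i ∈ upTo k ] 2 ^ e i)  ≡⟨ cong (b *_) eq ⟩
      b * (q * r)  ≡⟨ shuffle b q r ⟩
      q * (b * r)  ≡⟨ cong (q *_) n≡ ⟨
      q * n  ∎
      where
      open ≡-Reasoning
      shuffle : ∀ b q r → b * (q * r) ≡ q * (b * r)
      shuffle = solve-∀
    length-cs : length cs ≡ length as * k
    length-cs = begin
      length cs  ≡⟨ trans (∑-const cs 1) (*-identityʳ _) ⟨
      ∑ cs (λ _ → 1)  ≡⟨ ∑-cartesian (λ a i → a + e i) as (upTo k) (λ _ → 1) ⟩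
      ∑ as (λ _ → ∑ (upTo k) (λ _ → 1))  ≡⟨ ∑-const as _ ⟩
      length as * ∑ (upTo k) (λ _ → 1)  ≡⟨ cong (length as *_) (trans (∑-const (upTo k) 1) (trans (*-identityʳ _) (length-upTo k))) ⟩
      length as * k  ∎
      where open ≡-Reasoning
    positive : ∀ {k} → 1 ≤ k → 1 ≤ ∑[ i ∈ upTo k ] 2 ^ e i
    positive {suc k} _ = ≤-trans (m^n>0 2 (e 0)) (m≤m+n _ _)
    1≤q : 1 ≤ q
    1≤q = go q (subst (1 ≤_) eq (positive 1≤k))
      where
      go : ∀ q → 1 ≤ q * r → 1 ≤ q
      go (suc q) _ = s≤s z≤n

-- The bound for a single n: its smooth part, its large primes and the exceptional cases.

module Pointwise where

  open Sums
  open Primes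
  open Blocks using (SumOf; module Block)
  open Exponents
  open Weight using (M≤bits; M≤product)
  open import Data.List.Base using (List; []; _∷_; _++_; length; upTo; map; filter)
  open import Data.List.Membership.Propositional using (_∈_)
  open import Data.List.Membership.Propositional.Properties using (∈-map⁻; ∈-filter⁺; ∈-filter⁻; ∈-upTo⁺; ∈-upTo⁻; ∈-++⁻)
  open import Data.List.Properties using (length-++; length-map; length-filter; length-upTo)
  open import Data.List.Relation.Unary.All as All using (All; []; _∷_)
  open import Data.List.Relation.Unary.AllPairs.Core using ([]; _∷_)
  open import Data.List.Relation.Unary.Any using (here; there)
  open import Data.List.Relation.Unary.Unique.Propositional using (Unique)
  import Data.List.Relation.Unary.Unique.Propositional.Properties as Unique
  open import Data.Nat.Base
  open import Data.Nat.DivMod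
  open import Data.Nat.Divisibility
  open import Data.Nat.GCD
  open import Data.Nat.ListAction using (product)
  open import Data.Nat.ListAction.Properties using (∈⇒∣product)
  open import Data.Nat.Primality
  open import Data.Nat.Primality.Factorisation using (factorise; factorisationHasAllPrimeFactors; module PrimeFactorisation)
  open import Data.Nat.Properties
  open import Data.Nat.Tactic.RingSolver using (solve-∀)
  open import Data.Product.Base using (_×_; _,_; proj₁; proj₂; ∃-syntax)
  open import Data.Sum.Base using (inj₁; inj₂)
  open import Relation.Binary.PropositionalEquality
  open import Relation.Nullary using (Dec; yes; no; ¬_; contradiction)
  open import Relation.Nullary.Decidable using (¬?)

  n<2^n : ∀ n → n < 2 ^ n
  n<2^n zero    = ≤-refl
  n<2^n (suc n) = +-mono-≤ (m^n>0 2 n) (≤-trans (n<2^n n) (≤-reflexive (sym (+-identityʳ (2 ^ n)))))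

  ⌊log⌋ : ∀ n → ∃[ l ] 2 ^ l ≤ suc n × suc n < 2 ^ suc l
  ⌊log⌋ zero = 0 , ≤-refl , ≤-refl
  ⌊log⌋ (suc n) with ⌊log⌋ n
  ... | l , lower , upper with 2 ^ suc l ≤? 2 + n
  ...   | yes h = suc l , h , ≤-<-trans upper (^-monoʳ-< 2 (s≤s (s≤s z≤n)) {suc l} ≤-refl)
  ...   | no ¬h = l , ≤-trans lower (n≤1+n (suc n)) , ≰⇒> ¬h

  -- The binary logarithm rounded down, with value 0 at 0.
  log : ℕ → ℕ
  log n = proj₁ (⌊log⌋ (pred n))

  log-bounds : ∀ n .{{_ : NonZero n}} → 2 ^ log n ≤ n × n < 2 ^ suc (log n)
  log-bounds (suc n) = proj₂ (⌊log⌋ n)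

  1≤log : ∀ {n} → 2 ≤ n → 1 ≤ log n
  1≤log {n} 2≤n with log n | log-bounds n {{>-nonZero (≤-trans (s≤s z≤n) 2≤n)}}
  ... | zero  | _ , n<2 = contradiction n<2 (≤⇒≯ 2≤n)
  ... | suc _ | _       = s≤s z≤n

  product-filter : ∀ {R : ℕ → Set} (R? : ∀ x → Dec (R x)) xs →
                   product xs ≡ product (filter R? xs) * product (filter (λ x → ¬? (R? x)) xs)
  product-filter R? []       = refl
  product-filter R? (x ∷ xs) with R? x
  ... | yes _ = trans (cong (x *_) (product-filter R? xs)) (sym (*-assoc x _ _))
  ... | no _  = trans (cong (x *_) (product-filter R? xs)) (shuffle x (product (filter R? xs)) _)
    where
    shuffle : ∀ x a b → x * (a * b) ≡ a * (x * b)
    shuffle = solve-∀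

  squarefree⇒unique : ∀ xs → (∀ {p} → p ∈ xs → ¬ p * p ∣ product xs) → Unique xs
  squarefree⇒unique []       h = []
  squarefree⇒unique (x ∷ xs) h =
    All.tabulate (λ { x∈ refl → h (here refl) (*-monoʳ-∣ x (∈⇒∣product x∈)) })
    ∷ squarefree⇒unique xs (λ p∈ d → h (there p∈) (∣n⇒∣m*n x d))

  count : ℕ → List ℕ → ℕ
  count p xs = ∑[ x ∈ xs ] ⟦ x ≟ p ⟧

  ^count∣product : ∀ p xs → p ^ count p xs ∣ product xs
  ^count∣product p []       = ∣-refl
  ^count∣product p (x ∷ xs) with x ≟ p
  ... | yes refl = *-monoʳ-∣ p (^count∣product p xs)
  ... | no _     = ∣n⇒∣m*n x (^count∣product p xs)

  ^-mono-∣ : ∀ p {m n} → m ≤ n → p ^ m ∣ p ^ n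
  ^-mono-∣ p {m} {n} m≤n = subst (p ^ m ∣_) (trans (sym (^-distribˡ-+-* p m (n ∸ m))) (cong (p ^_) (m+[n∸m]≡n m≤n))) (m∣m*n (p ^ (n ∸ m)))

  -- Writes a multiplicity as a count of prime powers dividing n, the form that can be summed over
  -- n.
  multiplicity≤ : ∀ p c h n → c ≤ h → p ^ c ∣ n → c ≤ ∑[ j ∈ upTo h ] ⟦ p ^ suc j ∣? n ⟧
  multiplicity≤ p c h n c≤h d = begin
    c  ≡⟨ trans (∑-const (upTo c) 1) (trans (*-identityʳ _) (length-upTo c)) ⟨
    ∑ (upTo c) (λ _ → 1)  ≤⟨ ∑-mono (upTo c) (λ {j} j∈ → ≤-reflexive (sym (⟦⟧-true (p ^ suc j ∣? n) (∣-trans (^-mono-∣ p (∈-upTo⁻ j∈)) d)))) ⟩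
    ∑ (upTo c) (λ j → ⟦ p ^ suc j ∣? n ⟧)  ≤⟨ m≤m+n _ _ ⟩
    ∑ (upTo c) (λ j → ⟦ p ^ suc j ∣? n ⟧) + _  ≡⟨ ∑-upTo-+ c (h ∸ c) (λ j → ⟦ p ^ suc j ∣? n ⟧) ⟨
    ∑ (upTo (c + (h ∸ c))) (λ j → ⟦ p ^ suc j ∣? n ⟧)  ≡⟨ cong (λ k → ∑ (upTo k) (λ j → ⟦ p ^ suc j ∣? n ⟧)) (m+[n∸m]≡n c≤h) ⟩
    ∑ (upTo h) (λ j → ⟦ p ^ suc j ∣? n ⟧)  ∎
    where open ≤-Reasoning

  divisors : List ℕ → List ℕ
  divisors []       = 1 ∷ []
  divisors (p ∷ ps) = divisors ps ++ map (p *_) (divisors ps)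

  length-divisors : ∀ ps → length (divisors ps) ≡ 2 ^ length ps
  length-divisors []       = refl
  length-divisors (p ∷ ps) = trans (length-++ (divisors ps)) (cong₂ _+_ (length-divisors ps)
    (trans (length-map (p *_) (divisors ps)) (trans (length-divisors ps) (sym (+-identityʳ (2 ^ length ps))))))

  divisors-∣ : ∀ ps {d} → d ∈ divisors ps → d ∣ product ps
  divisors-∣ []       (here refl) = ∣-refl
  divisors-∣ (p ∷ ps) d∈ with ∈-++⁻ (divisors ps) d∈
  ... | inj₁ d∈ps = ∣n⇒∣m*n p (divisors-∣ ps d∈ps)
  ... | inj₂ d∈p* with ∈-map⁻ (p *_) d∈p*
  ...   | d , d∈ps , refl = *-monoʳ-∣ p (divisors-∣ ps d∈ps)

  divisors-unique : ∀ {ps} → Unique ps → All Prime ps → Unique (divisors ps)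
  divisors-unique []        []         = [] ∷ []
  divisors-unique {p ∷ ps} (p∉ ∷ un) (pr ∷ prs) = Unique.++⁺ (divisors-unique un prs)
    (Unique.map⁺ (*-cancelˡ-≡ _ _ p {{prime⇒nonZero pr}}) (divisors-unique un prs))
    λ { (d∈ , d∈p*) → disjoint d∈ d∈p* }
    where
    disjoint : ∀ {d} → d ∈ divisors ps → ¬ d ∈ map (p *_) (divisors ps)
    disjoint d∈ d∈p* with ∈-map⁻ (p *_) d∈p*
    ... | c , _ , refl = All.lookup p∉ (factorisationHasAllPrimeFactors pr (∣-trans (m∣m*n c) (divisors-∣ ps d∈)) prs) refl

  -- Bounds the number of prime factors through the number of divisors, whose average is a harmonic
  -- sum: distinct primes have pairwise different subset products, all dividing n. The index d
  -- stands for the divisor d + 1.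
  2^-divisors≤ : ∀ {ps} → Unique ps → All Prime ps → ∀ n N .{{_ : NonZero n}} → n ≤ N → product ps ∣ n →
                 2 ^ length ps ≤ ∑[ d ∈ upTo N ] ⟦ suc d ∣? n ⟧
  2^-divisors≤ {ps} un prs n N n≤N d = begin
    2 ^ length ps  ≡⟨ length-divisors ps ⟨
    length (divisors ps)  ≡⟨ length-map pred (divisors ps) ⟨
    length (map pred (divisors ps))  ≤⟨ length≤∑ pred-unique (λ d → suc d ∣? n) member ⟩
    (∑[ d ∈ upTo N ] ⟦ suc d ∣? n ⟧)  ∎
    where
    open ≤-Reasoning
    divisor-∣ : ∀ {c} → c ∈ divisors ps → c ∣ n
    divisor-∣ c∈ = ∣-trans (divisors-∣ ps c∈) d
    nonzero : ∀ {c} → c ∣ n → NonZero c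
    nonzero c∣n = ≢-nonZero (λ { refl → ≢-nonZero⁻¹ n (0∣⇒≡0 c∣n) })
    unique-pred : ∀ {xs} → (∀ {x} → x ∈ xs → NonZero x) → Unique xs → Unique (map pred xs)
    unique-pred nz [] = []
    unique-pred {x ∷ xs} nz (x∉ ∷ un) = All.tabulate (λ y∈ eq → distinct y∈ eq) ∷ unique-pred (λ x∈ → nz (there x∈)) un
      where
      distinct : ∀ {y} → y ∈ map pred xs → pred x ≢ y
      distinct y∈ eq with ∈-map⁻ pred y∈
      ... | z , z∈ , refl = All.lookup x∉ z∈ (trans (sym (suc-pred x {{nz (here refl)}})) (trans (cong suc eq) (suc-pred z {{nz (there z∈)}})))
    pred-unique : Unique (map pred (divisors ps))
    pred-unique = unique-pred (λ c∈ → nonzero (divisor-∣ c∈)) (divisors-unique un prs)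
    member : ∀ {x} → x ∈ map pred (divisors ps) → x ∈ upTo N × suc x ∣ n
    member x∈ with ∈-map⁻ pred x∈
    ... | c , c∈ , refl with suc-pred c {{nonzero (divisor-∣ c∈)}}
    ...   | eq = ∈-upTo⁺ (subst (_≤ N) (sym eq) (≤-trans (∣⇒≤ (divisor-∣ c∈)) n≤N)) , subst (_∣ n) (sym eq) (divisor-∣ c∈)

  -- A prime x satisfies x < 2 ^ (1 + log x) and 1 ≤ log x, so doubling the exponent absorbs the
  -- rounding in every factor.
  product≤4^∑log : ∀ {xs} → All Prime xs → product xs ≤ 2 ^ (2 * ∑ xs log)
  product≤4^∑log []         = ≤-refl
  product≤4^∑log {x ∷ xs} (pr ∷ prs) = begin
    x * product xs  ≤⟨ *-mono-≤ x≤ (product≤4^∑log prs) ⟩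
    2 ^ (2 * log x) * 2 ^ (2 * ∑ xs log)  ≡⟨ ^-distribˡ-+-* 2 (2 * log x) _ ⟨
    2 ^ (2 * log x + 2 * ∑ xs log)  ≡⟨ cong (2 ^_) (*-distribˡ-+ 2 (log x) (∑ xs log)) ⟨
    2 ^ (2 * ∑ (x ∷ xs) log)  ∎
    where
    open ≤-Reasoning
    x≤ : x ≤ 2 ^ (2 * log x)
    x≤ = ≤-trans (<⇒≤ (proj₂ (log-bounds x {{prime⇒nonZero pr}}))) (^-monoʳ-≤ 2
      (≤-trans (+-monoˡ-≤ (log x) (1≤log (prime⇒≥2 pr))) (≤-reflexive (cong (log x +_) (sym (+-identityʳ (log x)))))))

  module Parameters (e H u : ℕ) (2≤e : 2 ≤ e) (1≤H : 1 ≤ H) (exponents : ∀ s → 49 ≤ s → 4 + suc s * e * 3 ≤ s * u + s * H * 3)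
                    (N h a : ℕ) (N< : N < 2 ^ h) (3≤a : 3 ≤ a) where

    k : ℕ
    k = H + H + H

    instance
      e≢0 : NonZero e
      e≢0 = >-nonZero (≤-trans (s≤s z≤n) 2≤e)

    -- In the averaging h ≤ 2 ^ a, which makes `D` at least h ^ 4 and `K` at least h ^ 2. Fewer than
    -- `K` divisors allow at most a * 2 distinct large primes, so `V` is at most `D` ^ (a * 2) = 2 ^
    -- `s₀`. This is what makes the logarithm of `y` quadratic in a.
    s₀ y D K : ℕ
    s₀ = a * 4 * (a * 2)
    y  = 2 ^ (s₀ * e)
    D  = 2 ^ (a * 4)
    K  = 2 ^ (a * 2)

    instance
      y≢0 : NonZero y
      y≢0 = m^n≢0 2 (s₀ * e)
      D≢0 : NonZero D
      D≢0 = m^n≢0 2 (a * 4)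
      K≢0 : NonZero K
      K≢0 = m^n≢0 2 (a * 2)

    open Block using () renaming (badness to badness′)

    badness : ℕ → ℕ → ℕ
    badness s = badness′ s e H u

    small : List ℕ
    small = filter prime? (upTo y)

    block : ℕ → List ℕ
    block s = filter prime? (filter (2 ^ (s * e) ≤?_) (upTo (2 ^ (suc s * e))))

    -- smooth n bounds the logarithm of the y-smooth part of n. If bad n vanishes,
    -- then the prime factors p ≥ y of n are distinct; gcd (p ∸ 1) (q ∸ 1) ≤ D for
    -- any two of them, as p = i d + 1 and q = j d + 1 for the gcd d; there are at
    -- most 2 a of them; and each divides a sum of k powers of 2 ^ V for V ≤ 2 ^ s₀.
    smooth squares common divisorCount blocks bad : ℕ → ℕ
    smooth n = ∑[ p ∈ small ] ∑[ j ∈ upTo h ] log p * ⟦ p ^ suc j ∣? n ⟧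
    squares n = ∑[ m ∈ upTo N ] ⟦ (y + m) * (y + m) ∣? n ⟧
    common n = ∑[ d ∈ upTo N ] ∑[ i ∈ upTo N ] ∑[ j ∈ upTo N ] ⟦ suc (suc i * (D + d)) * suc (suc j * (D + d)) ∣? n ⟧
    divisorCount n = ∑[ d ∈ upTo N ] ⟦ suc d ∣? n ⟧
    blocks n = ∑[ i ∈ upTo N ] ∑[ p ∈ block (s₀ + i) ] ⟦ p ∣? n ⟧ * badness (s₀ + i) p
    bad n = squares n + common n + divisorCount n / K + blocks n

    module _ (n : ℕ) .{{_ : NonZero n}} (n≤N : n ≤ N) where

      open PrimeFactorisation (factorise n)

      private
        n<2^h : n < 2 ^ h
        n<2^h = ≤-<-trans n≤N N<

        ls ss : List ℕ
        ss = filter (_<? y) factors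
        ls = filter (λ p → ¬? (p <? y)) factors

        n≡ : n ≡ product ss * product ls
        n≡ = trans isFactorisation (product-filter (_<? y) factors)

        ss-prime : All Prime ss
        ss-prime = All.tabulate (λ p∈ → All.lookup factorsPrime (proj₁ (∈-filter⁻ (_<? y) {xs = factors} p∈)))

        ls-prime : All Prime ls
        ls-prime = All.tabulate (λ p∈ → All.lookup factorsPrime (proj₁ (∈-filter⁻ (λ p → ¬? (p <? y)) {xs = factors} p∈)))

        ls-≥ : ∀ {p} → p ∈ ls → y ≤ p
        ls-≥ p∈ = ≮⇒≥ (proj₂ (∈-filter⁻ (λ p → ¬? (p <? y)) {xs = factors} p∈))

        ls-∣ : product ls ∣ n
        ls-∣ = divides (product ss) n≡

        ∈ls⇒∣n : ∀ {p} → p ∈ ls → p ∣ n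
        ∈ls⇒∣n p∈ = ∣-trans (∈⇒∣product p∈) ls-∣

        ∈ls⇒≤N : ∀ {p} → p ∈ ls → p ≤ N
        ∈ls⇒≤N p∈ = ≤-trans (∣⇒≤ (∈ls⇒∣n p∈)) n≤N

        multiplicity : ∀ {p} → p ∈ small → count p ss ≤ ∑[ j ∈ upTo h ] ⟦ p ^ suc j ∣? n ⟧
        multiplicity {p} p∈ = multiplicity≤ p (count p ss) h n count≤h p^∣n
          where
          p^∣n : p ^ count p ss ∣ n
          p^∣n = ∣-trans (^count∣product p ss) (divides (product ls) (trans n≡ (*-comm (product ss) (product ls))))
          count≤h : count p ss ≤ h
          count≤h = 2^-cancel-≤ (≤-trans (^-monoˡ-≤ (count p ss) (prime⇒≥2 (proj₂ (∈-filter⁻ prime? {xs = upTo y} p∈))))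
            (≤-trans (∣⇒≤ p^∣n) (<⇒≤ n<2^h)))

        ∑log≤smooth : ∑ ss log ≤ smooth n
        ∑log≤smooth = begin
          ∑ ss log  ≤⟨ ∑-mono ss hit ⟩
          (∑[ q ∈ ss ] ∑[ p ∈ small ] log p * ⟦ q ≟ p ⟧)  ≡⟨ ∑-swap ss small _ ⟩
          (∑[ p ∈ small ] ∑[ q ∈ ss ] log p * ⟦ q ≟ p ⟧)  ≡⟨ ∑-cong small (λ {p} _ → ∑-*ˡ ss (log p) (λ q → ⟦ q ≟ p ⟧)) ⟩
          (∑[ p ∈ small ] log p * count p ss)  ≤⟨ ∑-mono small (λ {p} p∈ → *-monoʳ-≤ (log p) (multiplicity p∈)) ⟩
          (∑[ p ∈ small ] log p * (∑[ j ∈ upTo h ] ⟦ p ^ suc j ∣? n ⟧)) ≡⟨ ∑-cong small (λ {p} _ → sym (∑-*ˡ (upTo h) (log p) _)) ⟩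
          smooth n  ∎
          where
          open ≤-Reasoning
          hit : ∀ {q} → q ∈ ss → log q ≤ ∑[ p ∈ small ] log p * ⟦ q ≟ p ⟧
          hit {q} q∈ = ≤-trans (≤-reflexive (sym (trans (cong (log q *_) (⟦⟧-true (q ≟ q) refl)) (*-identityʳ (log q)))))
            (term≤∑ (λ p → log p * ⟦ q ≟ p ⟧) (∈-filter⁺ prime? (∈-upTo⁺ (proj₂ (∈-filter⁻ (_<? y) {xs = factors} q∈))) (All.lookup ss-prime q∈)))

        ss<2^ : product ss < 2 ^ suc (2 * smooth n)
        ss<2^ = ≤-<-trans (≤-trans (product≤4^∑log ss-prime) (^-monoʳ-≤ 2 (*-monoʳ-≤ 2 ∑log≤smooth)))
          (^-monoʳ-< 2 (s≤s (s≤s z≤n)) {2 * smooth n} ≤-refl)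

        1≤s₀ : 1 ≤ s₀
        1≤s₀ = *-mono-≤ {1} {a * 4} {1} {a * 2} (*-mono-≤ {1} {a} {1} {4} 1≤a (s≤s z≤n)) (*-mono-≤ {1} {a} {1} {2} 1≤a (s≤s z≤n))
          where
          1≤a : 1 ≤ a
          1≤a = ≤-trans (s≤s z≤n) 3≤a

        2<y : 2 < y
        2<y = ^-monoʳ-< 2 (s≤s (s≤s z≤n)) {1} (*-mono-≤ {1} {s₀} {2} {e} 1≤s₀ 2≤e)

        odd : ∀ {p} → p ∈ ls → 2 < p
        odd p∈ = <-≤-trans 2<y (ls-≥ p∈)

        module Good (good : bad n ≡ 0) where

          no-blocks : blocks n ≡ 0
          no-blocks = m+n≡0⇒n≡0 (squares n + common n + divisorCount n / K) good
          no-rest : squares n + common n + divisorCount n / K ≡ 0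
          no-rest = m+n≡0⇒m≡0 _ good
          few-divisors : divisorCount n < K
          few-divisors = m/n≡0⇒m<n (m+n≡0⇒n≡0 (squares n + common n) no-rest)
          no-common : common n ≡ 0
          no-common = m+n≡0⇒n≡0 (squares n) (m+n≡0⇒m≡0 _ no-rest)
          no-squares : squares n ≡ 0
          no-squares = m+n≡0⇒m≡0 (squares n) (m+n≡0⇒m≡0 _ no-rest)

          ls-unique : Unique ls
          ls-unique = squarefree⇒unique ls λ {p} p∈ d → ⟦⟧≡0⇒¬ ((y + (p ∸ y)) * (y + (p ∸ y)) ∣? n)
            (∑≡0⇒ {xs = upTo N} (λ m → ⟦ (y + m) * (y + m) ∣? n ⟧) no-squares (∈-upTo⁺ (below p∈)))
            (subst (λ q → q * q ∣ n) (sym (m+[n∸m]≡n (ls-≥ p∈))) (∣-trans d ls-∣))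
            where
            below : ∀ {p} → p ∈ ls → p ∸ y < N
            below {p} p∈ = <-≤-trans (∸-monoʳ-< {p} {y} {0} (>-nonZero⁻¹ y) (ls-≥ p∈)) (∈ls⇒≤N p∈)

          length-ls : length ls ≤ a * 2
          length-ls = <⇒≤ (2^-cancel-<′ (≤-<-trans (2^-divisors≤ ls-unique ls-prime n N n≤N ls-∣) few-divisors))
            where
            2^-cancel-<′ : ∀ {m n} → 2 ^ m < 2 ^ n → m < n
            2^-cancel-<′ h = ≰⇒> (λ n≤m → <⇒≱ h (^-monoʳ-≤ 2 n≤m))

          gcd≤D : ∀ {p q} → p ∈ ls → q ∈ ls → q ≢ p → gcd (pred q) (pred p) ≤ D
          gcd≤D {p} {q} p∈ q∈ q≢p with gcd (pred q) (pred p) ≤? D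
          ... | yes h = h
          ... | no  h = contradiction pq∣n (⟦⟧≡0⇒¬ (suc (suc i * (D + d)) * suc (suc j * (D + d)) ∣? n)
                (∑≡0⇒ {xs = upTo N} (λ j → ⟦ suc (suc i * (D + d)) * suc (suc j * (D + d)) ∣? n ⟧)
                  (∑≡0⇒ {xs = upTo N} (λ i → ∑[ j ∈ upTo N ] ⟦ suc (suc i * (D + d)) * suc (suc j * (D + d)) ∣? n ⟧)
                    (∑≡0⇒ {xs = upTo N} (λ d → ∑[ i ∈ upTo N ] ∑[ j ∈ upTo N ] ⟦ suc (suc i * (D + d)) * suc (suc j * (D + d)) ∣? n ⟧) no-common d∈)
                    i∈) j∈))
            where
            g d i j : ℕ
            g = gcd (pred q) (pred p)
            d = g ∸ D
            D+d≡g : D + d ≡ g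
            D+d≡g = m+[n∸m]≡n (<⇒≤ (≰⇒> h))
            positive : ∀ {r} → r ∈ ls → NonZero (pred r)
            positive r∈ = >-nonZero (≤-trans (s≤s z≤n) (pred-mono-≤ (odd r∈)))
            cofactor′ : ∀ {r} → r ∈ ls → g ∣ pred r → ∃[ i ] r ≡ suc (suc i * (D + d)) × i < N
            cofactor′ {r} r∈ (divides zero eq) = contradiction (subst NonZero eq (positive r∈)) (λ ())
            cofactor′ {r} r∈ (divides (suc i) eq) = i , r≡ , <-≤-trans (≤-<-trans (≤-trans (n≤1+n i) i<) (≤-reflexive (sym r≡))) (∈ls⇒≤N r∈)
              where
              r≡ : r ≡ suc (suc i * (D + d))
              r≡ = trans (sym (suc-pred r {{prime⇒nonZero (All.lookup ls-prime r∈)}})) (cong suc (trans eq (cong (suc i *_) (sym D+d≡g))))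
              i< : suc i ≤ suc i * (D + d)
              i< = ≤-trans (≤-reflexive (sym (*-identityʳ (suc i)))) (*-monoʳ-≤ (suc i) (≤-trans (>-nonZero⁻¹ D) (m≤m+n D d)))
            q-form : ∃[ i ] q ≡ suc (suc i * (D + d)) × i < N
            q-form = cofactor′ q∈ (gcd[m,n]∣m (pred q) (pred p))
            p-form : ∃[ i ] p ≡ suc (suc i * (D + d)) × i < N
            p-form = cofactor′ p∈ (gcd[m,n]∣n (pred q) (pred p))
            i = proj₁ q-form
            j = proj₁ p-form
            i∈ : i ∈ upTo N
            i∈ = ∈-upTo⁺ (proj₂ (proj₂ q-form))
            j∈ : j ∈ upTo N
            j∈ = ∈-upTo⁺ (proj₂ (proj₂ p-form))
            d∈ : d ∈ upTo N
            d∈ = ∈-upTo⁺ (≤-<-trans (m∸n≤m g D) (≤-<-trans (∣⇒≤ {{positive p∈}} (gcd[m,n]∣n (pred q) (pred p)))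
                   (<-≤-trans (≤-reflexive (suc-pred p {{prime⇒nonZero (All.lookup ls-prime p∈)}})) (∈ls⇒≤N p∈))))
            pq∣n : suc (suc i * (D + d)) * suc (suc j * (D + d)) ∣ n
            pq∣n = subst₂ (λ u v → u * v ∣ n) (proj₁ (proj₂ q-form)) (proj₁ (proj₂ p-form))
              (subst (λ r → q * r ∣ n) (*-identityʳ p) (product-distinct-∣ {q ∷ p ∷ []} ((q≢p ∷ []) ∷ [] ∷ [])
                (All.lookup ls-prime q∈ ∷ All.lookup ls-prime p∈ ∷ [])
                (λ { (here refl) → ∈ls⇒∣n q∈ ; (there (here refl)) → ∈ls⇒∣n p∈ })))

          V : ℕ → ℕ
          V p = gcd (cofactor ls ls-unique ls-prime odd k p) (pred p)

          V≤ : ∀ {p} → p ∈ ls → V p ≤ 2 ^ s₀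
          V≤ {p} p∈ = begin
            V p  ≤⟨ gcd-product≤ others (pred p) D {{>-nonZero (≤-trans (s≤s z≤n) (pred-mono-≤ (odd p∈)))}} pairwise ⟩
            D ^ length others  ≤⟨ ^-monoʳ-≤ D (≤-trans (≤-reflexive (length-map pred (filter (λ q → ¬? (q ≟ p)) ls)))
                                        (≤-trans (length-filter (λ q → ¬? (q ≟ p)) ls) length-ls)) ⟩
            D ^ (a * 2)  ≡⟨ ^-*-assoc 2 (a * 4) (a * 2) ⟩
            2 ^ s₀  ∎
            where
            open ≤-Reasoning
            others : List ℕ
            others = map pred (filter (λ q → ¬? (q ≟ p)) ls)
            pairwise : ∀ {t} → t ∈ others → gcd t (pred p) ≤ D
            pairwise t∈ with ∈-map⁻ pred t∈
            ... | q , q∈ , refl with ∈-filter⁻ (λ q → ¬? (q ≟ p)) {xs = ls} q∈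
            ...   | q∈ls , q≢p = gcd≤D p∈ q∈ls q≢p

          1≤V : ∀ {p} → p ∈ ls → 1 ≤ V p
          1≤V {p} p∈ = n≢0⇒n>0 (gcd[m,n]≢0 (cofactor ls ls-unique ls-prime odd k p) (pred p) (inj₂ (≢-nonZero⁻¹ (pred p) {{>-nonZero (≤-trans (s≤s z≤n) (pred-mono-≤ (odd p∈)))}})))

          find-block : ∀ p fuel i → 2 ^ ((s₀ + i) * e) ≤ p → p < 2 ^ ((s₀ + i + fuel) * e) →
                       ∃[ j ] 2 ^ ((s₀ + j) * e) ≤ p × p < 2 ^ (suc (s₀ + j) * e)
          find-block p zero       i lo hi = contradiction (≤-trans (≤-reflexive (cong (λ k → 2 ^ (k * e)) (+-identityʳ (s₀ + i)))) lo) (<⇒≱ hi)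
          find-block p (suc fuel) i lo hi with p <? 2 ^ (suc (s₀ + i) * e)
          ... | yes p< = i , lo , p<
          ... | no  p≮ = find-block p fuel (suc i) (subst (λ k → 2 ^ (k * e) ≤ p) (sym (+-suc s₀ i)) (≮⇒≥ p≮))
                           (subst (λ k → p < 2 ^ (k * e)) (trans (+-suc (s₀ + i) fuel) (cong (_+ fuel) (sym (+-suc s₀ i)))) hi)

          49≤ : ∀ i → 49 ≤ s₀ + i
          -- `s₀` is 8 a², which is at least 72 = 49 + 23 when 3 ≤ a.
          49≤ i = ≤-trans (m≤m+n 49 23) (≤-trans (*-mono-≤ (*-monoˡ-≤ 4 3≤a) (*-monoˡ-≤ 2 3≤a)) (m≤m+n s₀ i))

          solution : ∀ {p} → p ∈ ls → ∃[ m ] SumOf (V p) k m × p ∣ m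
          solution {p} p∈ with find-block p p 0 (subst (λ k → 2 ^ (k * e) ≤ p) (sym (+-identityʳ s₀)) (ls-≥ p∈))
               -- Fuel p suffices because p < 2 ^ p.
               (<-≤-trans (n<2^n p) (^-monoʳ-≤ 2 (≤-trans (m≤n+m p (s₀ + 0)) (m≤m*n (s₀ + 0 + p) e))))
          ... | i , lo , hi = Block.badness≡0⇒sum (s₀ + i) e H u (exponents (s₀ + i) (49≤ i)) (All.lookup ls-prime p∈) (odd p∈) hi
                  no-badness (1≤V p∈) (≤-trans (V≤ p∈) (^-monoʳ-≤ 2 (m≤m+n s₀ i)))
            where
            i<N : i < N
            -- The N blocks in `blocks` cover all primes up to N, since those of block i are at
            -- least 2 ^ i and hence exceed i.
            i<N = <-≤-trans (n<2^n i) (≤-trans (^-monoʳ-≤ 2 (≤-trans (m≤n+m i s₀) (m≤m*n (s₀ + i) e))) (≤-trans lo (∈ls⇒≤N p∈)))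
            p∈block : p ∈ block (s₀ + i)
            p∈block = ∈-filter⁺ prime? (∈-filter⁺ (2 ^ ((s₀ + i) * e) ≤?_) (∈-upTo⁺ hi) lo) (All.lookup ls-prime p∈)
            no-badness : badness (s₀ + i) p ≡ 0
            no-badness = trans (sym (trans (cong (_* badness (s₀ + i) p) (⟦⟧-true (p ∣? n) (∈ls⇒∣n p∈))) (*-identityˡ _)))
              (∑≡0⇒ {xs = block (s₀ + i)} (λ p → ⟦ p ∣? n ⟧ * badness (s₀ + i) p)
                (∑≡0⇒ {xs = upTo N} (λ i → ∑[ p ∈ block (s₀ + i) ] ⟦ p ∣? n ⟧ * badness (s₀ + i) p) no-blocks (∈-upTo⁺ i<N)) p∈block)

          M≤smooth : M n ≤ suc (2 * smooth n) * k
          M≤smooth = let e , d = common-multiple ls ls-unique ls-prime odd k solution in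
            M≤product n (product ss) (product ls) (suc (2 * smooth n)) k e
              (≤-trans 1≤H (m≤n+m H (H + H))) n≡ ss<2^ d

      -- Markov's inequality in disguise: a nonzero `bad n` is at least 1, so h * `bad n` covers the
      -- trivial bound h for `M n`, and only the average of `bad` remains to be estimated.
      M≤smooth+bad : M n ≤ suc (2 * smooth n) * k + h * bad n
      M≤smooth+bad = split (bad n ≟ 0)
        where
        split : Dec (bad n ≡ 0) → M n ≤ suc (2 * smooth n) * k + h * bad n
        split (yes good) = ≤-trans (Good.M≤smooth good) (m≤m+n _ _)
        split (no ¬good) = ≤-trans (M≤bits n h n<2^h)
          (≤-trans (≤-trans (≤-reflexive (sym (*-identityʳ h))) (*-monoʳ-≤ h (n≢0⇒n>0 ¬good))) (m≤n+m _ _))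

-- Averages of the smooth part and of the exceptional counts.

module Average where

  open Sums
  open Primes
  open Blocks using (module Block)
  open Pointwise
  open import Data.List.Base using (List; upTo; filter)
  open import Data.List.Membership.Propositional using (_∈_)
  open import Data.List.Membership.Propositional.Properties using (∈-filter⁻; ∈-upTo⁻)
  open import Data.List.Properties using (length-upTo)
  open import Data.List.Relation.Unary.All as All using (All)
  open import Data.List.Relation.Unary.Unique.Propositional using (Unique)
  import Data.List.Relation.Unary.Unique.Propositional.Properties as Unique
  open import Data.Nat.Base
  open import Data.Nat.DivMod
  open import Data.Nat.Divisibility
  open import Data.Nat.Primality
  open import Data.Nat.Properties
  open import Data.Nat.Tactic.RingSolver using (solve-∀)
  open import Data.Product.Base using (_×_; _,_; proj₁; proj₂; ∃-syntax)
  open import Relation.Binary.PropositionalEquality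

  multiples : ℕ → ℕ → ℕ
  multiples N d = ∑[ i ∈ upTo N ] ⟦ d ∣? suc i ⟧

  multiples≤ : ∀ N {b d} .{{_ : NonZero b}} → b ≤ d → multiples N d ≤ N / b
  multiples≤ N {b} {d} b≤d = ≤-trans (∑-multiples N d {{d≢0}}) (/-monoʳ-≤ N {{d≢0}} b≤d)
    where
    d≢0 : NonZero d
    d≢0 = >-nonZero (≤-trans (>-nonZero⁻¹ b) b≤d)

  infixl 7 _/2^_
  _/2^_ : ℕ → ℕ → ℕ
  n /2^ i = (n / 2 ^ i) {{m^n≢0 2 i}}

  ∑-geometric : ∀ n A → ∑[ i ∈ upTo n ] (A /2^ i) ≤ 2 * A
  ∑-geometric zero    A = z≤n
  ∑-geometric (suc n) A = begin
    (∑[ i ∈ upTo (suc n) ] A /2^ i)  ≡⟨ ∑-upTo-head n (A /2^_) ⟩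
    A / 1 + (∑[ i ∈ upTo n ] A /2^ suc i)  ≡⟨ cong₂ _+_ (n/1≡n A) (∑-cong (upTo n) (λ {i} _ →
                                                      sym (m/n/o≡m/[n*o] A 2 (2 ^ i) {{_}} {{m^n≢0 2 i}} {{m^n≢0 2 (suc i)}}))) ⟩
    A + (∑[ i ∈ upTo n ] (A / 2) /2^ i)  ≤⟨ +-monoʳ-≤ A (∑-geometric n (A / 2)) ⟩
    A + 2 * (A / 2)  ≤⟨ +-monoʳ-≤ A (≤-trans (≤-reflexive (*-comm 2 (A / 2))) (m/n*n≤m A 2)) ⟩
    A + A  ≡⟨ cong (A +_) (sym (+-identityʳ A)) ⟩
    2 * A  ∎
    where open ≤-Reasoning

  -- As p ^ (j + 1) is at least p 2 ^ j, all higher powers together only double the contribution of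
  -- p.
  prime-power-multiples : ∀ N h {p} → Prime p → .{{_ : NonZero p}} → ∑[ j ∈ upTo h ] multiples N (p ^ suc j) ≤ 2 * (N / p)
  prime-power-multiples N h {p} pr {{p≢0}} = ≤-trans (∑-mono (upTo h) (λ {j} _ → step j)) (∑-geometric h (N / p))
    where
    step : ∀ j → multiples N (p ^ suc j) ≤ (N / p) /2^ j
    step j = ≤-trans (multiples≤ N {p * 2 ^ j} {{m*n≢0 p (2 ^ j) {{p≢0}} {{m^n≢0 2 j}}}} (*-monoʳ-≤ p (^-monoˡ-≤ j (prime⇒≥2 pr))))
      (≤-reflexive (sym (m/n/o≡m/[n*o] N p (2 ^ j) {{_}} {{m^n≢0 2 j}} {{m*n≢0 p (2 ^ j) {{p≢0}} {{m^n≢0 2 j}}}})))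

  -- With p ≤ y the quotient y / p is at least 1, so rounding it down loses less than half. This
  -- transfers the frequency of multiples of p from N to y.
  quotient-ratio : ∀ N y p .{{_ : NonZero p}} → p ≤ y → y * (N / p) ≤ 2 * N * (y / p)
  quotient-ratio N y p p≤y = begin
    y * (N / p)  ≤⟨ *-monoˡ-≤ (N / p) y≤ ⟩
    2 * (y / p * p) * (N / p)  ≡⟨ shuffle (y / p) p (N / p) ⟩
    2 * (N / p * p) * (y / p)  ≤⟨ *-monoˡ-≤ (y / p) (*-monoʳ-≤ 2 (m/n*n≤m N p)) ⟩
    2 * N * (y / p)  ∎
    where
    open ≤-Reasoning
    shuffle : ∀ a p b → 2 * (a * p) * b ≡ 2 * (b * p) * a
    shuffle = solve-∀
    y≤ : y ≤ 2 * (y / p * p)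
    y≤ = begin
      y  ≡⟨ m≡m%n+[m/n]*n y p ⟩
      y % p + y / p * p  ≤⟨ +-monoˡ-≤ (y / p * p) (≤-trans (m%n≤n y p) (≤-trans (≤-reflexive (sym (*-identityˡ p))) (*-monoˡ-≤ p (m≥n⇒m/n>0 p≤y)))) ⟩
      y / p * p + y / p * p  ≡⟨ cong (y / p * p +_) (sym (+-identityʳ _)) ⟩
      2 * (y / p * p)  ∎

  -- The average obtained is quadratic in a, which is of order log log x; all its terms are absorbed
  -- in the cube that the theorem asks for.
  quadratic≤cubic : ∀ k e c a → 1 ≤ a → k + 8 * k * (a * 4 * (a * 2) * e) + c ≤ (k + 8 * k * (8 * e) + c) * (a * a * a)
  quadratic≤cubic k e c a 1≤a = begin
    k + 8 * k * (a * 4 * (a * 2) * e) + c  ≡⟨ shuffle k e c a ⟩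
    k * 1 + 8 * k * (8 * e) * (a * a * 1) + c * 1  ≤⟨ +-mono-≤ (+-mono-≤ (*-monoʳ-≤ k 1≤a³) (*-monoʳ-≤ (8 * k * (8 * e)) (*-monoʳ-≤ (a * a) 1≤a))) (*-monoʳ-≤ c 1≤a³) ⟩
    k * (a * a * a) + 8 * k * (8 * e) * (a * a * a) + c * (a * a * a)  ≡⟨ collect k e c (a * a * a) ⟩
    (k + 8 * k * (8 * e) + c) * (a * a * a)  ∎
    where
    open ≤-Reasoning
    1≤a³ : 1 ≤ a * a * a
    1≤a³ = *-mono-≤ (*-mono-≤ 1≤a 1≤a) 1≤a
    shuffle : ∀ k e c a → k + 8 * k * (a * 4 * (a * 2) * e) + c ≡ k * 1 + 8 * k * (8 * e) * (a * a * 1) + c * 1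
    shuffle = solve-∀
    collect : ∀ k e c x → k * x + 8 * k * (8 * e) * x + c * x ≡ (k + 8 * k * (8 * e) + c) * x
    collect = solve-∀

  weightConstant : ℕ → ℕ → ℕ
  weightConstant f H = (H + H + H) + 8 * (H + H + H) * (8 * suc f) + (3 + suc H * 2)

  -- With Z = 2 ^ s, the equations for f make both sources of `badness` in a block of order Z ^ f: Z
  -- ^ (3 + H) from collisions and Z ^ (2 + 2 u) from periods. Primes of size Z ^ (f + 1) then leave
  -- a factor Z to spare.
  module _ (f H u : ℕ) (1≤H : 1 ≤ H) (f≡H : f ≡ 3 + H) (f≡u : f ≡ 2 + (u + u))
           (exponents : ∀ s → 49 ≤ s → 4 + suc s * suc f * 3 ≤ s * u + s * H * 3)
           (N h a : ℕ) (N< : N < 2 ^ h) (1≤h : 1 ≤ h) (h≤ : h ≤ 2 ^ a) (3≤a : 3 ≤ a) where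

    private
      e : ℕ
      e = suc f

      2≤e : 2 ≤ e
      2≤e = s≤s (subst (1 ≤_) (sym f≡H) (s≤s z≤n))

    open Parameters e H u 2≤e 1≤H exponents N h a N< 3≤a

    private
      1≤a : 1 ≤ a
      1≤a = ≤-trans (s≤s z≤n) 3≤a

      a*2≤s₀ : a * 2 ≤ s₀
      a*2≤s₀ = ≤-trans (≤-reflexive (sym (*-identityˡ (a * 2)))) (*-monoˡ-≤ (a * 2) (*-mono-≤ {1} {a} {1} {4} 1≤a (s≤s z≤n)))

      h²≤ : h * h ≤ 2 ^ (a * 2)
      h²≤ = ≤-trans (*-mono-≤ h≤ h≤) (≤-reflexive (trans (sym (^-distribˡ-+-* 2 a a)) (cong (2 ^_) (double a))))
        where
        double : ∀ a → a + a ≡ a * 2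
        double = solve-∀

      h²≤y : h * h ≤ y
      h²≤y = ≤-trans h²≤ (^-monoʳ-≤ 2 (≤-trans a*2≤s₀ (m≤m*n s₀ e)))

      h⁴≤D : (h * h) * (h * h) ≤ D
      h⁴≤D = ≤-trans (*-mono-≤ h²≤ h²≤) (≤-reflexive (trans (sym (^-distribˡ-+-* 2 (a * 2) (a * 2))) (cong (2 ^_) (double a))))
        where
        double : ∀ a → a * 2 + a * 2 ≡ a * 4
        double = solve-∀

      small-unique : Unique small
      small-unique = Unique.filter⁺ prime? (Unique.upTo⁺ y)

      small-prime : All Prime small
      small-prime = All.tabulate (λ p∈ → proj₂ (∈-filter⁻ prime? {xs = upTo y} p∈))

      block-unique : ∀ s → Unique (block s)
      block-unique s = Unique.filter⁺ prime? (Unique.filter⁺ (2 ^ (s * e) ≤?_) (Unique.upTo⁺ (2 ^ (suc s * e))))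

      block-prime : ∀ s → All Prime (block s)
      block-prime s = All.tabulate (λ p∈ → proj₂ (∈-filter⁻ prime? {xs = filter (2 ^ (s * e) ≤?_) (upTo (2 ^ (suc s * e)))} p∈))

      block-≥ : ∀ s {p} → p ∈ block s → 2 ^ (s * e) ≤ p
      block-≥ s p∈ = proj₂ (∈-filter⁻ (2 ^ (s * e) ≤?_) {xs = upTo (2 ^ (suc s * e))}
        (proj₁ (∈-filter⁻ prime? {xs = filter (2 ^ (s * e) ≤?_) (upTo (2 ^ (suc s * e)))} p∈)))

    -- Mertens' bound: the primes p < y divide proportionally as many numbers up
    -- to N as up to y, and a number i ≤ y has ∑ log p ≤ log y over its primes.
    ∑-smooth : ∑[ i ∈ upTo N ] smooth (suc i) ≤ 4 * N * (s₀ * e)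
    ∑-smooth = *-cancelˡ-≤ y (begin
      y * (∑[ i ∈ upTo N ] smooth (suc i))
        ≡⟨ cong (y *_) (trans (∑-swap (upTo N) small _) (∑-cong small (λ {p} _ → reorder p))) ⟩
      y * (∑[ p ∈ small ] log p * (∑[ j ∈ upTo h ] multiples N (p ^ suc j)))
        ≡⟨ ∑-*ˡ small y _ ⟨
      (∑[ p ∈ small ] y * (log p * (∑[ j ∈ upTo h ] multiples N (p ^ suc j))))
        ≤⟨ ∑-mono small (λ {p} p∈ → versus p (∈-filter⁻ prime? {xs = upTo y} p∈)) ⟩
      (∑[ p ∈ small ] 4 * N * (log p * multiples y p))
        ≡⟨ ∑-*ˡ small (4 * N) _ ⟩
      4 * N * (∑[ p ∈ small ] log p * multiples y p)
        ≡⟨ cong (4 * N *_) (trans (∑-cong small (λ {p} _ → sym (∑-*ˡ (upTo y) (log p) _))) (∑-swap small (upTo y) _)) ⟩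
      4 * N * (∑[ i ∈ upTo y ] ∑[ p ∈ small ] log p * ⟦ p ∣? suc i ⟧)
        ≤⟨ *-monoʳ-≤ (4 * N) (∑-upTo-bound y (λ {i} i<y → ∑-prime-divisors small-unique small-prime log small-log (suc i) (s₀ * e) i<y)) ⟩
      4 * N * (y * (s₀ * e))
        ≡⟨ shuffle (4 * N) y (s₀ * e) ⟩
      y * (4 * N * (s₀ * e)) ∎)
      where
      open ≤-Reasoning
      shuffle : ∀ a b c → a * (b * c) ≡ b * (a * c)
      shuffle = solve-∀
      reorder : ∀ p → ∑[ i ∈ upTo N ] ∑[ j ∈ upTo h ] log p * ⟦ p ^ suc j ∣? suc i ⟧ ≡ log p * (∑[ j ∈ upTo h ] multiples N (p ^ suc j))
      reorder p = trans (∑-cong (upTo N) (λ _ → ∑-*ˡ (upTo h) (log p) _)) (trans (∑-*ˡ (upTo N) (log p) _)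
        (cong (log p *_) (∑-swap (upTo N) (upTo h) _)))
      small-log : ∀ {p} → p ∈ small → 2 ^ log p ≤ p
      small-log {p} p∈ = proj₁ (log-bounds p {{prime⇒nonZero (proj₂ (∈-filter⁻ prime? {xs = upTo y} p∈))}})
      -- In 4 * N one factor 2 pays for the higher powers of p and the other for rounding y / p.
      versus : ∀ p → p ∈ upTo y × Prime p → y * (log p * (∑[ j ∈ upTo h ] multiples N (p ^ suc j))) ≤ 4 * N * (log p * multiples y p)
      versus p (p∈ , pr) = begin
        y * (log p * (∑[ j ∈ upTo h ] multiples N (p ^ suc j))) ≤⟨ *-monoʳ-≤ y (*-monoʳ-≤ (log p) (prime-power-multiples N h pr)) ⟩
        y * (log p * (2 * (N / p)))  ≡⟨ move y (log p) (N / p) ⟩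
        2 * log p * (y * (N / p))  ≤⟨ *-monoʳ-≤ (2 * log p) (quotient-ratio N y p (<⇒≤ (∈-upTo⁻ p∈))) ⟩
        2 * log p * (2 * N * (y / p))  ≤⟨ *-monoʳ-≤ (2 * log p) (*-monoʳ-≤ (2 * N) (∑-multiples-≥ y p)) ⟩
        2 * log p * (2 * N * multiples y p)  ≡⟨ collect (log p) N (multiples y p) ⟩
        4 * N * (log p * multiples y p)  ∎
        where
        instance
          p≢0 : NonZero p
          p≢0 = prime⇒nonZero pr
        move : ∀ y l q → y * (l * (2 * q)) ≡ 2 * l * (y * q)
        move = solve-∀
        collect : ∀ l n m → 2 * l * (2 * n * m) ≡ 4 * n * (l * m)
        collect = solve-∀

    -- The estimate (y + m)² ≥ y (m + 1) leaves a harmonic sum over m, of size at most h N / y.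
    -- Multiplied by h this is at most N, since h² ≤ y.
    ∑-squares : h * (∑[ i ∈ upTo N ] squares (suc i)) ≤ N
    ∑-squares = begin
      h * (∑[ i ∈ upTo N ] squares (suc i))
        ≡⟨ cong (h *_) (∑-swap (upTo N) (upTo N) _) ⟩
      h * (∑[ m ∈ upTo N ] multiples N ((y + m) * (y + m)))
        ≤⟨ *-monoʳ-≤ h (∑-mono (upTo N) (λ {m} _ → ≤-trans
             (multiples≤ N {y * suc m} {{m*n≢0 y (suc m)}} (*-mono-≤ (m≤m+n y m) (+-monoˡ-≤ m (>-nonZero⁻¹ y))))
             (≤-reflexive (sym (m/n/o≡m/[n*o] N y (suc m) {{_}} {{_}} {{m*n≢0 y (suc m)}}))))) ⟩
      h * (∑[ m ∈ upTo N ] N / y / suc m)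
        ≤⟨ *-monoʳ-≤ h (∑-harmonic (N / y) h N N<) ⟩
      h * (N / y * h)
        ≡⟨ shuffle h (N / y) ⟩
      N / y * (h * h)
        ≤⟨ *-monoʳ-≤ (N / y) h²≤y ⟩
      N / y * y
        ≤⟨ m/n*n≤m N y ⟩
      N ∎
      where
      open ≤-Reasoning
      shuffle : ∀ a b → a * (b * a) ≡ b * (a * a)
      shuffle = solve-∀

    -- Of the two factors D + d, one is bounded below by D and the other by d + 1. This leaves
    -- harmonic sums over d, i and j, in total h ^ 3 N / D; the fourth h is the trivial bound for
    -- `M`, whence D ≥ h ^ 4.
    ∑-common : h * (∑[ i ∈ upTo N ] common (suc i)) ≤ N
    ∑-common = begin
      h * (∑[ n ∈ upTo N ] common (suc n))
        ≡⟨ cong (h *_) (trans (∑-swap (upTo N) (upTo N) _) (∑-cong (upTo N) (λ _ → trans (∑-swap (upTo N) (upTo N) _)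
             (∑-cong (upTo N) (λ _ → ∑-swap (upTo N) (upTo N) _))))) ⟩
      h * (∑[ d ∈ upTo N ] ∑[ i ∈ upTo N ] ∑[ j ∈ upTo N ] multiples N (suc (suc i * (D + d)) * suc (suc j * (D + d))))
        ≤⟨ *-monoʳ-≤ h (∑-mono (upTo N) (λ {d} _ → ≤-trans (∑-mono (upTo N) (λ {i} _ → ≤-trans (∑-mono (upTo N) (λ {j} _ → single d i j))
             (∑-harmonic (N / D / suc d / suc i) h N N<))) (≤-trans (≤-reflexive (∑-*ʳ (upTo N) _ h)) (*-monoˡ-≤ h (∑-harmonic (N / D / suc d) h N N<))))) ⟩
      h * (∑[ d ∈ upTo N ] N / D / suc d * h * h)
        ≡⟨ cong (h *_) (trans (∑-*ʳ (upTo N) _ h) (cong (_* h) (∑-*ʳ (upTo N) _ h))) ⟩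
      h * ((∑[ d ∈ upTo N ] N / D / suc d) * h * h)
        ≤⟨ *-monoʳ-≤ h (*-monoˡ-≤ h (*-monoˡ-≤ h (∑-harmonic (N / D) h N N<))) ⟩
      h * (N / D * h * h * h)
        ≡⟨ shuffle h (N / D) ⟩
      N / D * ((h * h) * (h * h))
        ≤⟨ *-monoʳ-≤ (N / D) h⁴≤D ⟩
      N / D * D
        ≤⟨ m/n*n≤m N D ⟩
      N ∎
      where
      open ≤-Reasoning
      shuffle : ∀ a b → a * (b * a * a * a) ≡ b * ((a * a) * (a * a))
      shuffle = solve-∀
      single : ∀ d i j → multiples N (suc (suc i * (D + d)) * suc (suc j * (D + d))) ≤ N / D / suc d / suc i / suc j
      single d i j = ≤-trans (multiples≤ N {D * suc d * suc i * suc j} {{nz₃}} bound)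
        (≤-reflexive (sym (trans (cong (λ q → q / suc i / suc j) (m/n/o≡m/[n*o] N D (suc d) {{_}} {{_}} {{nz₁}}))
          (trans (cong (_/ suc j) (m/n/o≡m/[n*o] N (D * suc d) (suc i) {{nz₁}} {{_}} {{nz₂}}))
            (m/n/o≡m/[n*o] N (D * suc d * suc i) (suc j) {{nz₂}} {{_}} {{nz₃}})))))
        where
        nz₁ : NonZero (D * suc d)
        nz₁ = m*n≢0 D (suc d)
        nz₂ : NonZero (D * suc d * suc i)
        nz₂ = m*n≢0 (D * suc d) (suc i) {{nz₁}}
        nz₃ : NonZero (D * suc d * suc i * suc j)
        nz₃ = m*n≢0 (D * suc d * suc i) (suc j) {{nz₂}}
        arrange : ∀ D d i j → D * d * i * j ≡ (i * D) * (j * d)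
        arrange = solve-∀
        bound : D * suc d * suc i * suc j ≤ suc (suc i * (D + d)) * suc (suc j * (D + d))
        bound = ≤-trans (≤-reflexive (arrange D (suc d) (suc i) (suc j)))
          (*-mono-≤ (≤-trans (*-monoʳ-≤ (suc i) (m≤m+n D d)) (n≤1+n _))
                    (≤-trans (*-monoʳ-≤ (suc j) (+-monoˡ-≤ d (>-nonZero⁻¹ D))) (n≤1+n _)))

    -- The number of divisors has average at most h. Dividing by `K` ≥ h ^ 2 leaves 1 / h, which
    -- pays for the trivial bound h.
    ∑-divisorCount : h * (∑[ i ∈ upTo N ] divisorCount (suc i) / K) ≤ N
    ∑-divisorCount = *-cancelˡ-≤ h {{>-nonZero 1≤h}} (begin
      h * (h * S)  ≡⟨ trans (sym (*-assoc h h S)) (*-comm (h * h) S) ⟩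
      S * (h * h)  ≤⟨ *-monoʳ-≤ S h²≤ ⟩
      S * K  ≡⟨ ∑-*ʳ (upTo N) _ K ⟨
      (∑[ i ∈ upTo N ] divisorCount (suc i) / K * K)  ≤⟨ ∑-mono (upTo N) (λ {i} _ → m/n*n≤m (divisorCount (suc i)) K) ⟩
      (∑[ i ∈ upTo N ] divisorCount (suc i))  ≡⟨ ∑-swap (upTo N) (upTo N) _ ⟩
      (∑[ d ∈ upTo N ] multiples N (suc d))  ≤⟨ ∑-mono (upTo N) (λ {d} _ → ∑-multiples N (suc d)) ⟩
      (∑[ d ∈ upTo N ] N / suc d)  ≤⟨ ∑-harmonic N h N N< ⟩
      N * h  ≡⟨ *-comm N h ⟩
      h * N  ∎)
      where
      open ≤-Reasoning
      S : ℕ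
      S = ∑[ i ∈ upTo N ] divisorCount (suc i) / K

    ∑-block : ∀ s → ∑[ p ∈ block s ] badness s p ≤ suc H * 2 ^ (s * f)
    ∑-block s = begin
      ∑ (block s) (badness s)
        ≤⟨ Block.∑-badness s e H u (block-unique s) (block-prime s) ⟩
      Z * (2 ^ (s * H) * (Z * Z * H) + 2 ^ (s * u) * (Z * 2 ^ (s * u)))
        ≡⟨ shuffle Z (2 ^ (s * H)) (2 ^ (s * u)) H ⟩
      H * (Z * (2 ^ (s * H) * (Z * Z))) + Z * (2 ^ (s * u) * (Z * 2 ^ (s * u)))
        ≡⟨ cong₂ (λ a b → H * a + b) first second ⟩
      H * 2 ^ (s * f) + 2 ^ (s * f)
        ≡⟨ +-comm (H * 2 ^ (s * f)) (2 ^ (s * f)) ⟩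
      suc H * 2 ^ (s * f) ∎
      where
      open ≤-Reasoning
      Z : ℕ
      Z = 2 ^ s
      shuffle : ∀ z a b h → z * (a * (z * z * h) + b * (z * b)) ≡ h * (z * (a * (z * z))) + z * (b * (z * b))
      shuffle = solve-∀
      collect : ∀ w x y z → 2 ^ w * (2 ^ x * (2 ^ y * 2 ^ z)) ≡ 2 ^ (w + (x + (y + z)))
      collect w x y z = sym (trans (^-distribˡ-+-* 2 w (x + (y + z))) (cong (2 ^ w *_)
        (trans (^-distribˡ-+-* 2 x (y + z)) (cong (2 ^ x *_) (^-distribˡ-+-* 2 y z)))))
      first : Z * (2 ^ (s * H) * (Z * Z)) ≡ 2 ^ (s * f)
      first = trans (collect s (s * H) s s) (cong (2 ^_) (trans (arrange s H) (cong (s *_) (sym f≡H))))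
        where
        arrange : ∀ s H → s + (s * H + (s + s)) ≡ s * (3 + H)
        arrange = solve-∀
      second : Z * (2 ^ (s * u) * (Z * 2 ^ (s * u))) ≡ 2 ^ (s * f)
      second = trans (collect s (s * u) s (s * u)) (cong (2 ^_) (trans (arrange s u) (cong (s *_) (sym f≡u))))
        where
        arrange : ∀ s u → s + (s * u + (s + s * u)) ≡ s * (2 + (u + u))
        arrange = solve-∀

    -- In block s each prime is at least 2 ^ (s f) · 2 ^ s while `badness` totals at most (H + 1) 2
    -- ^ (s f), so the block costs (H + 1) N / 2 ^ s. This is a geometric series in s starting at
    -- `s₀`, and 2 ^ `s₀` is at least h.
    ∑-blocks : h * (∑[ i ∈ upTo N ] blocks (suc i)) ≤ suc H * 2 * N
    ∑-blocks = begin
      h * (∑[ n ∈ upTo N ] blocks (suc n))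
        ≡⟨ cong (h *_) (trans (∑-swap (upTo N) (upTo N) _) (∑-cong (upTo N) (λ {i} _ → trans (∑-swap (upTo N) (block (s₀ + i)) _)
             (∑-cong (block (s₀ + i)) (λ {p} _ → ∑-*ʳ (upTo N) (λ n → ⟦ p ∣? suc n ⟧) (badness (s₀ + i) p)))))) ⟩
      h * (∑[ i ∈ upTo N ] ∑[ p ∈ block (s₀ + i) ] multiples N p * badness (s₀ + i) p)
        ≤⟨ *-monoʳ-≤ h (∑-mono (upTo N) (λ {i} _ → single i)) ⟩
      h * (∑[ i ∈ upTo N ] suc H * ((N /2^ s₀) /2^ i))
        ≡⟨ cong (h *_) (∑-*ˡ (upTo N) (suc H) _) ⟩
      h * (suc H * (∑[ i ∈ upTo N ] (N /2^ s₀) /2^ i))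
        ≤⟨ *-monoʳ-≤ h (*-monoʳ-≤ (suc H) (∑-geometric N (N /2^ s₀))) ⟩
      h * (suc H * (2 * (N /2^ s₀)))
        ≡⟨ shuffle h (suc H) (N /2^ s₀) ⟩
      suc H * 2 * (N /2^ s₀ * h)
        ≤⟨ *-monoʳ-≤ (suc H * 2) (≤-trans (*-monoʳ-≤ (N /2^ s₀) (≤-trans h≤ (^-monoʳ-≤ 2 (≤-trans (m≤m*n a 2) a*2≤s₀)))) (m/n*n≤m N (2 ^ s₀) {{m^n≢0 2 s₀}})) ⟩
      suc H * 2 * N ∎
      where
      open ≤-Reasoning
      shuffle : ∀ h c q → h * (c * (2 * q)) ≡ c * 2 * (q * h)
      shuffle = solve-∀
      single : ∀ i → ∑[ p ∈ block (s₀ + i) ] multiples N p * badness (s₀ + i) p ≤ suc H * ((N /2^ s₀) /2^ i)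
      single i = begin
        (∑[ p ∈ block s ] multiples N p * badness s p)  ≤⟨ ∑-mono (block s) (λ {p} p∈ → *-monoˡ-≤ (badness s p) (multiples≤ N {{m^n≢0 2 (s * e)}} (block-≥ s p∈))) ⟩
        (∑[ p ∈ block s ] N /2^ (s * e) * badness s p)  ≡⟨ ∑-*ˡ (block s) (N /2^ (s * e)) (badness s) ⟩
        N /2^ (s * e) * ∑ (block s) (badness s)  ≤⟨ *-monoʳ-≤ (N /2^ (s * e)) (∑-block s) ⟩
        N /2^ (s * e) * (suc H * 2 ^ (s * f))  ≡⟨ cong (_* (suc H * 2 ^ (s * f))) (split s (s * f) (*-suc s f)) ⟩
        (N /2^ s) /2^ (s * f) * (suc H * 2 ^ (s * f))  ≡⟨ swap ((N /2^ s) /2^ (s * f)) (suc H) (2 ^ (s * f)) ⟩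
        suc H * ((N /2^ s) /2^ (s * f) * 2 ^ (s * f))  ≤⟨ *-monoʳ-≤ (suc H) (m/n*n≤m (N /2^ s) (2 ^ (s * f)) {{m^n≢0 2 (s * f)}}) ⟩
        suc H * (N /2^ s)  ≡⟨ cong (suc H *_) (split s₀ i refl) ⟩
        suc H * ((N /2^ s₀) /2^ i)  ∎
        where
        s : ℕ
        s = s₀ + i
        swap : ∀ q c z → q * (c * z) ≡ c * (q * z)
        swap = solve-∀
        split : ∀ x z {w} → w ≡ x + z → N /2^ w ≡ (N /2^ x) /2^ z
        split x z refl = trans (/-congʳ {{m^n≢0 2 (x + z)}} {{nz}} (^-distribˡ-+-* 2 x z))
          (sym (m/n/o≡m/[n*o] N (2 ^ x) (2 ^ z) {{m^n≢0 2 x}} {{m^n≢0 2 z}} {{nz}}))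
          where
          nz : NonZero (2 ^ x * 2 ^ z)
          nz = m*n≢0 (2 ^ x) (2 ^ z) {{m^n≢0 2 x}} {{m^n≢0 2 z}}

    sumM≤ : sumM N ≤ N * (k + 8 * k * (s₀ * e) + (3 + suc H * 2))
    sumM≤ = begin
      (∑[ i ∈ upTo N ] M (suc i))
        ≤⟨ ∑-mono (upTo N) (λ {i} i∈ → M≤smooth+bad (suc i) (∈-upTo⁻ i∈)) ⟩
      (∑[ i ∈ upTo N ] suc (2 * smooth (suc i)) * k + h * bad (suc i))
        ≡⟨ trans (∑-+ (upTo N) (λ i → suc (2 * smooth (suc i)) * k) (λ i → h * bad (suc i))) (cong₂ _+_ smooth-sum bad-sum) ⟩
      (N * 1 + 2 * (∑[ i ∈ upTo N ] smooth (suc i))) * k + h * (Sq + Co + Di + Bl)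
        ≤⟨ +-mono-≤ (*-monoˡ-≤ k (+-monoʳ-≤ (N * 1) (*-monoʳ-≤ 2 ∑-smooth))) bad-bound ⟩
      (N * 1 + 2 * (4 * N * (s₀ * e))) * k + (N + N + N + suc H * 2 * N)
        ≡⟨ shuffle N (s₀ * e) k (suc H) ⟩
      N * (k + 8 * k * (s₀ * e) + (3 + suc H * 2)) ∎
      where
      open ≤-Reasoning
      Sq Co Di Bl : ℕ
      Sq = ∑[ i ∈ upTo N ] squares (suc i)
      Co = ∑[ i ∈ upTo N ] common (suc i)
      Di = ∑[ i ∈ upTo N ] divisorCount (suc i) / K
      Bl = ∑[ i ∈ upTo N ] blocks (suc i)
      smooth-sum : ∑[ i ∈ upTo N ] suc (2 * smooth (suc i)) * k ≡ (N * 1 + 2 * (∑[ i ∈ upTo N ] smooth (suc i))) * k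
      smooth-sum = trans (∑-*ʳ (upTo N) _ k) (cong (_* k) (trans (∑-+ (upTo N) (λ _ → 1) (λ i → 2 * smooth (suc i)))
        (cong₂ _+_ (trans (∑-const (upTo N) 1) (cong (_* 1) (length-upTo N))) (∑-*ˡ (upTo N) 2 _))))
      bad-sum : ∑[ i ∈ upTo N ] h * bad (suc i) ≡ h * (Sq + Co + Di + Bl)
      bad-sum = trans (∑-*ˡ (upTo N) h _) (cong (h *_) (trans (∑-+ (upTo N) (λ i → squares (suc i) + common (suc i) + divisorCount (suc i) / K) (λ i → blocks (suc i)))
        (cong (_+ Bl) (trans (∑-+ (upTo N) (λ i → squares (suc i) + common (suc i)) (λ i → divisorCount (suc i) / K))
          (cong (_+ Di) (∑-+ (upTo N) (λ i → squares (suc i)) (λ i → common (suc i))))))))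
      bad-bound : h * (Sq + Co + Di + Bl) ≤ N + N + N + suc H * 2 * N
      bad-bound = ≤-trans (≤-reflexive (distribute h Sq Co Di Bl)) (+-mono-≤ (+-mono-≤ (+-mono-≤ ∑-squares ∑-common) ∑-divisorCount) ∑-blocks)
        where
        distribute : ∀ h a b c d → h * (a + b + c + d) ≡ h * a + h * b + h * c + h * d
        distribute = solve-∀
      shuffle : ∀ N s k c → (N * 1 + 2 * (4 * N * s)) * k + (N + N + N + c * 2 * N) ≡ N * (k + 8 * k * s + (3 + c * 2))
      shuffle = solve-∀

    sumM≤cubic : sumM N ≤ N * (weightConstant f H * (a * a * a))
    sumM≤cubic = ≤-trans sumM≤ (*-monoʳ-≤ N (quadratic≤cubic k e (3 + suc H * 2) a 1≤a))

  -- With f = 3 + H = 2 + 2 u and e = f + 1, the incidence condition amounts to 12 < u for large s.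
  -- The choice u = 14 gives H = 27 and e = 31, and the condition reads 97 ≤ 2 s, so 49 is enough; u
  -- = 13 would need s ≥ 91, more than the 72 that `s₀` guarantees.
  average-weight : ∃[ C ] ∀ N L l → N < 2 ^ suc L → L < 2 ^ suc l → 2 ≤ l → sumM N ≤ N * (C * (suc l * suc l * suc l))
  average-weight = weightConstant 30 27 , λ N L l N< L< 2≤l →
    sumM≤cubic 30 27 14 (s≤s z≤n) refl refl exponents N (suc L) (suc l) N< (s≤s z≤n) L< (s≤s 2≤l)
    where
    exponents : ∀ s → 49 ≤ s → 4 + suc s * 31 * 3 ≤ s * 14 + s * 27 * 3
    exponents s 49≤s = begin
      4 + suc s * 31 * 3  ≡⟨ cong (4 +_) (trans (*-assoc (suc s) 31 3) (+-comm 93 (s * 93))) ⟩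
      4 + (s * 93 + 93)  ≡⟨ +-comm 4 (s * 93 + 93) ⟩
      s * 93 + 93 + 4  ≡⟨ +-assoc (s * 93) 93 4 ⟩
      s * 93 + 97  ≤⟨ +-monoʳ-≤ (s * 93) (≤-trans (m≤m+n 97 1) (*-monoˡ-≤ 2 49≤s)) ⟩
      s * 93 + s * 2  ≡⟨ *-distribˡ-+ s 93 2 ⟨
      s * 95  ≡⟨ *-distribˡ-+ s 14 81 ⟩
      s * 14 + s * 81  ≡⟨ cong (s * 14 +_) (*-assoc s 27 3) ⟨
      s * 14 + s * 27 * 3  ∎
      where open ≤-Reasoning

-- Lower bounds for real logarithms, and the passage from N to real x.

module Reals where

  open Primes using (binomial; binomial≤2^; absorption)
  open Pointwise using (log; log-bounds; n<2^n)
  open import Data.Integer.Base as ℤ using (+_; -[1+_])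
  import Data.Integer.Properties as ℤ
  open import Data.Nat.Base as ℕ using (ℕ; zero; suc; _!)
  open import Data.Nat.DivMod using (m/n*n≤m; m%n<n; m≡m%n+[m/n]*n; m≥n⇒m/n>0)
  import Data.Nat.Properties as ℕ
  open import Data.Nat.Properties using (_!≢0)
  import Data.Nat.Tactic.RingSolver as ℕ
  open import Data.Product.Base using (_×_; _,_; proj₁; proj₂; ∃-syntax)
  open import Data.Rational
  open import Data.Rational.Properties
  open import Data.Rational.Solver using (module +-*-Solver)
  open import Data.Rational.Unnormalised.Base using (mkℚᵘ)
  import Data.Rational.Unnormalised as ℚᵘ
  import Data.Rational.Unnormalised.Properties as ℚᵘ
  open import Data.Sum.Base using (_⊎_; inj₁; inj₂)
  open import Relation.Binary.PropositionalEquality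
  open import Relation.Nullary using (Dec; yes; no; ¬_; contradiction)
  open +-*-Solver using (solve; _:+_; _:-_; _:*_; :-_; con; _:=_)

  ι : ℕ → ℚ
  ι n = + n / 1

  toℚᵘ-ι : ∀ n → toℚᵘ (ι n) ℚᵘ.≃ mkℚᵘ (+ n) 0
  toℚᵘ-ι n = toℚᵘ-fromℚᵘ (mkℚᵘ (+ n) 0)

  ι-mono : ∀ {m n} → m ℕ.≤ n → ι m ≤ ι n
  ι-mono {m} {n} m≤n = toℚᵘ-cancel-≤ (ℚᵘ.≤-trans (ℚᵘ.≤-reflexive (toℚᵘ-ι m))
    (ℚᵘ.≤-trans (ℚᵘ.*≤* (ℤ.*-monoʳ-≤-nonNeg (+ 1) (ℤ.+≤+ m≤n))) (ℚᵘ.≤-reflexive (ℚᵘ.≃-sym (toℚᵘ-ι n)))))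

  ι-+ : ∀ m n → ι (m ℕ.+ n) ≡ ι m + ι n
  ι-+ m n = toℚᵘ-injective (ℚᵘ.≃-trans (toℚᵘ-ι (m ℕ.+ n)) (ℚᵘ.≃-sym (ℚᵘ.≃-trans (toℚᵘ-homo-+ (ι m) (ι n))
    (ℚᵘ.≃-trans (ℚᵘ.+-cong (toℚᵘ-ι m) (toℚᵘ-ι n))
      (ℚᵘ.*≡* (cong (ℤ._* + 1) (cong₂ ℤ._+_ (ℤ.*-identityʳ (+ m)) (ℤ.*-identityʳ (+ n)))))))))

  ι-* : ∀ m n → ι (m ℕ.* n) ≡ ι m * ι n
  ι-* m n = toℚᵘ-injective (ℚᵘ.≃-trans (toℚᵘ-ι (m ℕ.* n)) (ℚᵘ.≃-sym (ℚᵘ.≃-trans (toℚᵘ-homo-* (ι m) (ι n))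
    (ℚᵘ.≃-trans (ℚᵘ.*-cong (toℚᵘ-ι m) (toℚᵘ-ι n))
      (ℚᵘ.*≡* (cong (ℤ._* + 1) (sym (ℤ.pos-* m n))))))))

  ι*1/ : ∀ n .{{_ : ℕ.NonZero n}} → ι n * (+ 1 / n) ≡ 1ℚ
  ι*1/ (suc n) = toℚᵘ-injective (ℚᵘ.≃-trans (toℚᵘ-homo-* (ι (suc n)) (+ 1 / suc n))
    (ℚᵘ.≃-trans (ℚᵘ.*-cong (toℚᵘ-ι (suc n)) (toℚᵘ-fromℚᵘ (mkℚᵘ (+ 1) n)))
      (ℚᵘ.*≡* (trans (ℤ.*-identityʳ _) (trans (ℤ.*-identityʳ (+ suc n)) (sym (trans (ℤ.*-identityˡ _) (ℤ.*-identityˡ (+ suc n)))))))))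

  0≤ι : ∀ n → 0ℚ ≤ ι n
  0≤ι n = ι-mono {0} {n} ℕ.z≤n

  0≤1 : 0ℚ ≤ 1ℚ
  0≤1 = <⇒≤ (positive⁻¹ 1ℚ)

  ι-archimedean : ∀ q → ∃[ n ] q ≤ ι n
  ι-archimedean q@(mkℚ (+ k) d _) = k , toℚᵘ-cancel-≤ (ℚᵘ.≤-trans
    (ℚᵘ.*≤* (ℤ.*-monoˡ-≤-nonNeg (+ k) (ℤ.+≤+ (ℕ.s≤s ℕ.z≤n)))) (ℚᵘ.≤-reflexive (ℚᵘ.≃-sym (toℚᵘ-ι k))))
  ι-archimedean q@(mkℚ -[1+ k ] d _) = 0 , toℚᵘ-cancel-≤ (ℚᵘ.*≤* ℤ.-≤+)

  *-mono : ∀ {a b c d} → 0ℚ ≤ c → 0ℚ ≤ b → a ≤ b → c ≤ d → a * c ≤ b * d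
  *-mono {a} {b} {c} {d} 0≤c 0≤b a≤b c≤d = ≤-trans
    (*-monoʳ-≤-nonNeg c {{nonNegative 0≤c}} a≤b) (*-monoˡ-≤-nonNeg b {{nonNegative 0≤b}} c≤d)

  0≤* : ∀ {a b} → 0ℚ ≤ a → 0ℚ ≤ b → 0ℚ ≤ a * b
  0≤* {a} {b} 0≤a 0≤b = subst (_≤ a * b) (*-zeroʳ a) (*-monoˡ-≤-nonNeg a {{nonNegative 0≤a}} 0≤b)

  <⇒≱ : ∀ {p q} → p < q → ¬ q ≤ p
  <⇒≱ p<q q≤p = <-irrefl refl (<-≤-trans p<q q≤p)

  p≤∣p∣ : ∀ p → p ≤ ∣ p ∣
  p≤∣p∣ p with ≤-total 0ℚ p
  ... | inj₁ 0≤p = ≤-reflexive (sym (0≤p⇒∣p∣≡p 0≤p))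
  ... | inj₂ p≤0 = ≤-trans p≤0 (0≤∣p∣ p)

  p≤p+q : ∀ p {q} → 0ℚ ≤ q → p ≤ p + q
  p≤p+q p {q} 0≤q = subst (_≤ p + q) (+-identityʳ p) (+-monoʳ-≤ p 0≤q)

  0≤- : ∀ {p q} → p ≤ q → 0ℚ ≤ q - p
  0≤- {p} {q} p≤q = subst (_≤ q - p) (+-inverseʳ p) (+-monoˡ-≤ (- p) p≤q)

  power : ℚ → ℕ → ℚ
  power q zero    = 1ℚ
  power q (suc k) = q * power q k

  1/! : ℕ → ℚ
  1/! k = (+ 1 / k !) {{k !≢0}}

  term : ℚ → ℕ → ℚ
  term q k = power q k * 1/! k

  expPartial : ℚ → ℕ → ℚ
  expPartial q zero    = 0ℚ
  expPartial q (suc k) = expPartial q k + term q k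

  seq-^ : ∀ x k i → seq (x ^ᴿ k) i ≡ power (seq x i) k
  seq-^ x zero    i = refl
  seq-^ x (suc k) i = cong (seq x i *_) (seq-^ x k i)

  seq-exp : ∀ x k i → seq (expSum k x) i ≡ expPartial (seq x i) k
  seq-exp x zero    i = refl
  seq-exp x (suc k) i = cong₂ (λ u v → u + v * 1/! k) (seq-exp x k i) (seq-^ x k i)

  power-ι : ∀ m k → power (ι m) k ≡ ι (m ℕ.^ k)
  power-ι m zero    = refl
  power-ι m (suc k) = trans (cong (ι m *_) (power-ι m k)) (sym (ι-* m (m ℕ.^ k)))

  0≤power : ∀ {q} k → 0ℚ ≤ q → 0ℚ ≤ power q k
  0≤power zero    0≤q = 0≤1
  0≤power (suc k) 0≤q = 0≤* 0≤q (0≤power k 0≤q)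

  power-mono : ∀ {p q} k → 0ℚ ≤ p → p ≤ q → power p k ≤ power q k
  power-mono zero    0≤p p≤q = ≤-refl
  power-mono (suc k) 0≤p p≤q = *-mono (0≤power k 0≤p) (≤-trans 0≤p p≤q) p≤q (power-mono k 0≤p p≤q)

  1/!-suc : ∀ k → ι (suc k) * 1/! (suc k) ≡ 1/! k
  1/!-suc k = begin
    x  ≡⟨ *-identityˡ x ⟨
    1ℚ * x  ≡⟨ cong (_* x) (ι*1/ (k !) {{k !≢0}}) ⟨
    (ι (k !) * 1/! k) * x  ≡⟨ shuffle (ι (k !)) (1/! k) (ι (suc k)) (1/! (suc k)) ⟩
    1/! k * ((ι (suc k) * ι (k !)) * 1/! (suc k)) ≡⟨ cong (λ y → 1/! k * (y * 1/! (suc k))) (ι-* (suc k) (k !)) ⟨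
    1/! k * (ι (suc k !) * 1/! (suc k))  ≡⟨ cong (1/! k *_) (ι*1/ (suc k !) {{suc k !≢0}}) ⟩
    1/! k * 1ℚ  ≡⟨ *-identityʳ (1/! k) ⟩
    1/! k  ∎
    where
    open ≡-Reasoning
    x : ℚ
    x = ι (suc k) * 1/! (suc k)
    shuffle : ∀ a b c d → (a * b) * (c * d) ≡ b * ((c * a) * d)
    shuffle = solve 4 (λ a b c d → (a :* b) :* (c :* d) := b :* ((c :* a) :* d)) refl

  0≤1/! : ∀ k → 0ℚ ≤ 1/! k
  0≤1/! k = nonNegative⁻¹ (1/! k) {{normalize-nonNeg 1 (k !) {{k !≢0}}}}

  term-suc : ∀ q k → ι (suc k) * term q (suc k) ≡ q * term q k
  term-suc q k = trans (shuffle (ι (suc k)) q (power q k) (1/! (suc k))) (cong (λ r → q * (power q k * r)) (1/!-suc k))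
    where
    shuffle : ∀ i q p r → i * (q * p * r) ≡ q * (p * (i * r))
    shuffle = solve 4 (λ i q p r → i :* (q :* p :* r) := q :* (p :* (i :* r))) refl

  0≤term : ∀ {q} k → 0ℚ ≤ q → 0ℚ ≤ term q k
  0≤term k 0≤q = 0≤* (0≤power k 0≤q) (0≤1/! k)

  -- The right side is (a + 1) (a + 2) ... (a + k).
  ^≤!*binomial : ∀ a k → a ℕ.^ k ℕ.≤ k ! ℕ.* binomial (a ℕ.+ k) k
  ^≤!*binomial a zero    = ℕ.≤-refl
  ^≤!*binomial a (suc k) = begin
    a ℕ.* a ℕ.^ k  ≤⟨ ℕ.*-mono-≤ (ℕ.≤-trans (ℕ.m≤m+n a k) (ℕ.n≤1+n _)) (^≤!*binomial a k) ⟩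
    suc (a ℕ.+ k) ℕ.* (k ! ℕ.* binomial (a ℕ.+ k) k)  ≡⟨ swap (suc (a ℕ.+ k)) (k !) _ ⟩
    k ! ℕ.* (suc (a ℕ.+ k) ℕ.* binomial (a ℕ.+ k) k)  ≡⟨ cong (k ! ℕ.*_) (absorption (a ℕ.+ k) k) ⟨
    k ! ℕ.* (suc k ℕ.* binomial (suc (a ℕ.+ k)) (suc k)) ≡⟨ regroup (k !) (suc k) _ ⟩
    suc k ! ℕ.* binomial (suc (a ℕ.+ k)) (suc k)  ≡⟨ cong (λ n → suc k ! ℕ.* binomial n (suc k)) (ℕ.+-suc a k) ⟨
    suc k ! ℕ.* binomial (a ℕ.+ suc k) (suc k)  ∎
    where
    open ℕ.≤-Reasoning
    swap : ∀ a b c → a ℕ.* (b ℕ.* c) ≡ b ℕ.* (a ℕ.* c)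
    swap = ℕ.solve-∀
    regroup : ∀ a b c → a ℕ.* (b ℕ.* c) ≡ b ℕ.* a ℕ.* c
    regroup = ℕ.solve-∀

  -- (4 m) ^ k ≤ k ! · 2 ^ (4 m + k), divided by 2 ^ k.
  2^*^≤! : ∀ m k → 2 ℕ.^ k ℕ.* m ℕ.^ k ℕ.≤ 2 ℕ.^ (4 ℕ.* m) ℕ.* k !
  2^*^≤! m k = ℕ.*-cancelʳ-≤ _ _ (2 ℕ.^ k) {{ℕ.m^n≢0 2 k}} (begin
    2 ℕ.^ k ℕ.* m ℕ.^ k ℕ.* 2 ℕ.^ k  ≡⟨ shuffle (2 ℕ.^ k) (m ℕ.^ k) ⟩
    (2 ℕ.^ k ℕ.* 2 ℕ.^ k) ℕ.* m ℕ.^ k  ≡⟨ [4m]^ k ⟨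
    (4 ℕ.* m) ℕ.^ k  ≤⟨ ^≤!*binomial (4 ℕ.* m) k ⟩
    k ! ℕ.* binomial (4 ℕ.* m ℕ.+ k) k  ≤⟨ ℕ.*-monoʳ-≤ (k !) (binomial≤2^ (4 ℕ.* m ℕ.+ k) k) ⟩
    k ! ℕ.* 2 ℕ.^ (4 ℕ.* m ℕ.+ k)  ≡⟨ cong (k ! ℕ.*_) (ℕ.^-distribˡ-+-* 2 (4 ℕ.* m) k) ⟩
    k ! ℕ.* (2 ℕ.^ (4 ℕ.* m) ℕ.* 2 ℕ.^ k)  ≡⟨ regroup (k !) (2 ℕ.^ (4 ℕ.* m)) (2 ℕ.^ k) ⟩
    2 ℕ.^ (4 ℕ.* m) ℕ.* k ! ℕ.* 2 ℕ.^ k  ∎)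
    where
    open ℕ.≤-Reasoning
    [4m]^ : ∀ k → (4 ℕ.* m) ℕ.^ k ≡ (2 ℕ.^ k ℕ.* 2 ℕ.^ k) ℕ.* m ℕ.^ k
    [4m]^ zero    = refl
    [4m]^ (suc k) = trans (cong (4 ℕ.* m ℕ.*_) ([4m]^ k)) (step m (2 ℕ.^ k) (m ℕ.^ k))
      where
      step : ∀ m a b → 4 ℕ.* m ℕ.* (a ℕ.* a ℕ.* b) ≡ (2 ℕ.* a ℕ.* (2 ℕ.* a)) ℕ.* (m ℕ.* b)
      step = ℕ.solve-∀
    shuffle : ∀ a b → a ℕ.* b ℕ.* a ≡ (a ℕ.* a) ℕ.* b
    shuffle = ℕ.solve-∀
    regroup : ∀ a b c → a ℕ.* (b ℕ.* c) ≡ b ℕ.* a ℕ.* c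
    regroup = ℕ.solve-∀

  ½^ : ℕ → ℚ
  ½^ k = power ½ k

  0≤½^ : ∀ k → 0ℚ ≤ ½^ k
  0≤½^ k = 0≤power k (<⇒≤ (positive⁻¹ ½))

  ½^*2^ : ∀ k → ½^ k * ι (2 ℕ.^ k) ≡ 1ℚ
  ½^*2^ zero    = refl
  ½^*2^ (suc k) = trans (cong (½ * ½^ k *_) (ι-* 2 (2 ℕ.^ k))) (trans (shuffle (½^ k) (ι (2 ℕ.^ k))) (½^*2^ k))
    where
    shuffle : ∀ a b → ½ * a * (ι 2 * b) ≡ a * b
    shuffle = solve 2 (λ a b → con ½ :* a :* (con (ι 2) :* b) := a :* b) refl

  ½^-+ : ∀ j k → ½^ (j ℕ.+ k) ≡ ½^ j * ½^ k
  ½^-+ zero    k = sym (*-identityˡ (½^ k))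
  ½^-+ (suc j) k = trans (cong (½ *_) (½^-+ j k)) (sym (*-assoc ½ (½^ j) (½^ k)))

  -- From this many terms on, the error n · 2 G² / 2 ^ n in `product≤`, where G = 2 ^ (4 m), is at
  -- most 1.
  threshold : ℕ → ℕ
  threshold m = 4 ℕ.+ 16 ℕ.* m

  n*2^≤2^n : ∀ m n → threshold m ℕ.≤ n → n ℕ.* 2 ℕ.^ suc (8 ℕ.* m) ℕ.≤ 2 ℕ.^ n
  n*2^≤2^n m n thr with ℕ.m≤n⇒∃[o]m+o≡n thr
  ... | o , refl = begin
    (4 ℕ.+ 16 ℕ.* m ℕ.+ o) ℕ.* 2 ℕ.^ suc (8 ℕ.* m)  ≤⟨ ℕ.*-monoˡ-≤ _ (ℕ.≤-trans (ℕ.≤-trans (ℕ.m≤m+n _ (2 ℕ.+ o)) (ℕ.≤-reflexive (double m o))) (2w≤2^w (2 ℕ.+ 8 ℕ.* m ℕ.+ o))) ⟩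
    2 ℕ.^ suc (2 ℕ.+ 8 ℕ.* m ℕ.+ o) ℕ.* 2 ℕ.^ suc (8 ℕ.* m)  ≡⟨ ℕ.^-distribˡ-+-* 2 (suc (2 ℕ.+ 8 ℕ.* m ℕ.+ o)) _ ⟨
    2 ℕ.^ (suc (2 ℕ.+ 8 ℕ.* m ℕ.+ o) ℕ.+ suc (8 ℕ.* m))  ≡⟨ cong (2 ℕ.^_) (total m o) ⟩
    2 ℕ.^ (4 ℕ.+ 16 ℕ.* m ℕ.+ o)  ∎
    where
    open ℕ.≤-Reasoning
    2w≤2^w : ∀ w → 2 ℕ.* suc w ℕ.≤ 2 ℕ.^ suc w
    2w≤2^w w = ℕ.*-monoʳ-≤ 2 (n<2^n w)
    double : ∀ m o → 4 ℕ.+ 16 ℕ.* m ℕ.+ o ℕ.+ (2 ℕ.+ o) ≡ 2 ℕ.* suc (2 ℕ.+ 8 ℕ.* m ℕ.+ o)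
    double = ℕ.solve-∀
    total : ∀ m o → suc (2 ℕ.+ 8 ℕ.* m ℕ.+ o) ℕ.+ suc (8 ℕ.* m) ≡ 4 ℕ.+ 16 ℕ.* m ℕ.+ o
    total = ℕ.solve-∀

  -- Partial sums of the exponential series at s and at - s.

  module Bounded (m : ℕ) {s : ℚ} (0≤s : 0ℚ ≤ s) (s≤m : s ≤ ι m) where

    G : ℚ
    G = ι (2 ℕ.^ (4 ℕ.* m))

    0≤G : 0ℚ ≤ G
    0≤G = 0≤ι (2 ℕ.^ (4 ℕ.* m))

    t : ℕ → ℚ
    t = term s

    -- The explicit factor `G` gives geometric decay from the very first term, instead of only once
    -- k exceeds 2 s.
    term≤ : ∀ k → t k ≤ G * ½^ k
    term≤ k = begin
      t k  ≡⟨ trans (sym (*-identityˡ (t k))) (cong (_* t k) (sym (½^*2^ k))) ⟩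
      ½^ k * ι (2 ℕ.^ k) * t k  ≡⟨ *-assoc (½^ k) (ι (2 ℕ.^ k)) (t k) ⟩
      ½^ k * (ι (2 ℕ.^ k) * t k)  ≤⟨ *-monoˡ-≤-nonNeg (½^ k) {{nonNegative (0≤½^ k)}} scaled ⟩
      ½^ k * G  ≡⟨ *-comm (½^ k) G ⟩
      G * ½^ k  ∎
      where
      open ≤-Reasoning
      scaled : ι (2 ℕ.^ k) * t k ≤ G
      scaled = begin
        ι (2 ℕ.^ k) * (power s k * 1/! k)  ≤⟨ *-monoˡ-≤-nonNeg (ι (2 ℕ.^ k)) {{nonNegative (0≤ι (2 ℕ.^ k))}}
                                                            (*-monoʳ-≤-nonNeg (1/! k) {{nonNegative (0≤1/! k)}} (power-mono k 0≤s s≤m)) ⟩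
        ι (2 ℕ.^ k) * (power (ι m) k * 1/! k)  ≡⟨ cong (λ p → ι (2 ℕ.^ k) * (p * 1/! k)) (power-ι m k) ⟩
        ι (2 ℕ.^ k) * (ι (m ℕ.^ k) * 1/! k)  ≡⟨ *-assoc (ι (2 ℕ.^ k)) _ _ ⟨
        ι (2 ℕ.^ k) * ι (m ℕ.^ k) * 1/! k  ≡⟨ cong (_* 1/! k) (ι-* (2 ℕ.^ k) (m ℕ.^ k)) ⟨
        ι (2 ℕ.^ k ℕ.* m ℕ.^ k) * 1/! k  ≤⟨ *-monoʳ-≤-nonNeg (1/! k) {{nonNegative (0≤1/! k)}} (ι-mono (2^*^≤! m k)) ⟩
        ι (2 ℕ.^ (4 ℕ.* m) ℕ.* k !) * 1/! k  ≡⟨ cong (_* 1/! k) (ι-* (2 ℕ.^ (4 ℕ.* m)) (k !)) ⟩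
        G * ι (k !) * 1/! k  ≡⟨ *-assoc G (ι (k !)) (1/! k) ⟩
        G * (ι (k !) * 1/! k)  ≡⟨ cong (G *_) (ι*1/ (k !) {{k !≢0}}) ⟩
        G * 1ℚ  ≡⟨ *-identityʳ G ⟩
        G  ∎

    e : ℕ → ℚ
    e = expPartial s

    -- The sum e k + 2 G / 2 ^ k does not increase with k: the next term is at most G / 2 ^ k,
    -- exactly what the halving of the second summand releases.
    tail : ∀ d n → e (d ℕ.+ n) + (G + G) * ½^ (d ℕ.+ n) ≤ e n + (G + G) * ½^ n
    tail zero    n = ≤-refl
    tail (suc d) n = ≤-trans (begin
      (e k + t k) + (G + G) * (½ * ½^ k)  ≤⟨ +-monoˡ-≤ _ (+-monoʳ-≤ (e k) (term≤ k)) ⟩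
      (e k + G * ½^ k) + (G + G) * (½ * ½^ k) ≡⟨ shuffle (e k) G (½^ k) ⟩
      e k + (G + G) * ½^ k  ∎) (tail d n)
      where
      open ≤-Reasoning
      k : ℕ
      k = d ℕ.+ n
      shuffle : ∀ e g h → (e + g * h) + (g + g) * (½ * h) ≡ e + (g + g) * h
      shuffle = solve 3 (λ e g h → (e :+ g :* h) :+ (g :+ g) :* (con ½ :* h) := e :+ (g :+ g) :* h) refl

    0≤2G½^ : ∀ n → 0ℚ ≤ (G + G) * ½^ n
    0≤2G½^ n = 0≤* (+-mono-≤ 0≤G 0≤G) (0≤½^ n)

    tail≤ : ∀ d n → e (d ℕ.+ n) - e n ≤ (G + G) * ½^ n
    tail≤ d n = begin
      e (d ℕ.+ n) - e n  ≤⟨ +-monoˡ-≤ (- e n) (≤-trans (≤-reflexive (sym (+-identityʳ (e (d ℕ.+ n)))))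
                                                                    (≤-trans (+-monoʳ-≤ (e (d ℕ.+ n)) (0≤2G½^ (d ℕ.+ n))) (tail d n))) ⟩
      (e n + (G + G) * ½^ n) - e n  ≡⟨ cancel (e n) ((G + G) * ½^ n) ⟩
      (G + G) * ½^ n  ∎
      where
      open ≤-Reasoning
      cancel : ∀ a b → (a + b) - a ≡ b
      cancel = solve 2 (λ a b → (a :+ b) :- a := b) refl

    e≤2G : ∀ n → e n ≤ G + G
    e≤2G n = begin
      e n  ≡⟨ trans (cong e (sym (ℕ.+-identityʳ n))) (sym (+-identityʳ _)) ⟩
      e (n ℕ.+ 0) + - 0ℚ  ≤⟨ tail≤ n 0 ⟩
      (G + G) * 1ℚ  ≡⟨ *-identityʳ (G + G) ⟩
      G + G  ∎
      where open ≤-Reasoning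

    e-mono : ∀ d n → e n ≤ e (d ℕ.+ n)
    e-mono zero    n = ≤-refl
    e-mono (suc d) n = ≤-trans (e-mono d n) (≤-trans (≤-reflexive (sym (+-identityʳ (e (d ℕ.+ n))))) (+-monoʳ-≤ (e (d ℕ.+ n)) (0≤term (d ℕ.+ n) 0≤s)))

    1≤e : ∀ n → 1ℚ ≤ e (suc n)
    1≤e n = subst (λ k → 1ℚ ≤ e k) (ℕ.+-comm n 1) (e-mono n 1)

    σ : ℕ → ℚ
    σ = term (- s)

    ∣power∣ : ∀ k → ∣ power (- s) k ∣ ≡ power s k
    ∣power∣ zero    = refl
    ∣power∣ (suc k) = trans (∣p*q∣≡∣p∣*∣q∣ (- s) (power (- s) k))
      (cong₂ _*_ (trans (∣-p∣≡∣p∣ s) (0≤p⇒∣p∣≡p 0≤s)) (∣power∣ k))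

    σ≤t : ∀ k → σ k ≤ t k
    σ≤t k = *-monoʳ-≤-nonNeg (1/! k) {{nonNegative (0≤1/! k)}} (≤-trans (p≤∣p∣ (power (- s) k)) (≤-reflexive (∣power∣ k)))

    -- C j d is the sum of σ i * t (j + d − i) over i < j, a partial sum of the
    -- expansion of (s − s) ^ (j + d); it telescopes.
    C : ℕ → ℕ → ℚ
    C zero    d = 0ℚ
    C (suc j) d = C j (suc d) + σ j * t (suc d)

    -- The factor in front is the degree i + l of each σ i * t l in the sum. Since i σ i = - s σ (i
    -- - 1) and l t l = s t (l - 1), neighbouring terms cancel and only the last survives.
    C-closed : ∀ j d → ι (suc j ℕ.+ d) * C (suc j) d ≡ s * (σ j * t d)
    C-closed zero d = begin
      ι (suc d) * (0ℚ + σ 0 * t (suc d))  ≡⟨ first (ι (suc d)) (σ 0) (t (suc d)) ⟩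
      σ 0 * (ι (suc d) * t (suc d))  ≡⟨ cong (σ 0 *_) (term-suc s d) ⟩
      σ 0 * (s * t d)  ≡⟨ second (σ 0) s (t d) ⟩
      s * (σ 0 * t d)  ∎
      where
      open ≡-Reasoning
      first : ∀ i a b → i * (0ℚ + a * b) ≡ a * (i * b)
      first = solve 3 (λ i a b → i :* (con 0ℚ :+ a :* b) := a :* (i :* b)) refl
      second : ∀ a s b → a * (s * b) ≡ s * (a * b)
      second = solve 3 (λ a s b → a :* (s :* b) := s :* (a :* b)) refl
    C-closed (suc j) d = begin
      ι n * (C (suc j) (suc d) + σ (suc j) * t (suc d))
        ≡⟨ *-distribˡ-+ (ι n) (C (suc j) (suc d)) (σ (suc j) * t (suc d)) ⟩
      ι n * C (suc j) (suc d) + ι n * (σ (suc j) * t (suc d))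
        ≡⟨ cong₂ _+_ (trans (cong (λ k → ι (suc k) * C (suc j) (suc d)) (sym (ℕ.+-suc j d))) (C-closed j (suc d)))
             (cong (_* (σ (suc j) * t (suc d))) (trans (cong ι (sym (ℕ.+-suc (suc j) d))) (ι-+ (suc j) (suc d)))) ⟩
      s * (σ j * t (suc d)) + (ι (suc j) + ι (suc d)) * (σ (suc j) * t (suc d))
        ≡⟨ expand s (σ j) (t (suc d)) (ι (suc j)) (ι (suc d)) (σ (suc j)) ⟩
      s * (σ j * t (suc d)) + (ι (suc j) * σ (suc j)) * t (suc d) + σ (suc j) * (ι (suc d) * t (suc d))
        ≡⟨ cong₂ (λ a b → s * (σ j * t (suc d)) + a * t (suc d) + σ (suc j) * b) (term-suc (- s) j) (term-suc s d) ⟩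
      s * (σ j * t (suc d)) + (- s * σ j) * t (suc d) + σ (suc j) * (s * t d)
        ≡⟨ cancel s (σ j) (t (suc d)) (σ (suc j)) (t d) ⟩
      s * (σ (suc j) * t d) ∎
      where
      open ≡-Reasoning
      n : ℕ
      n = suc (suc j) ℕ.+ d
      expand : ∀ s a b i k c → s * (a * b) + (i + k) * (c * b) ≡ s * (a * b) + (i * c) * b + c * (k * b)
      expand = solve 6 (λ s a b i k c → s :* (a :* b) :+ (i :+ k) :* (c :* b) := s :* (a :* b) :+ (i :* c) :* b :+ c :* (k :* b)) refl
      cancel : ∀ s a b c x → s * (a * b) + (- s * a) * b + c * (s * x) ≡ s * (c * x)
      cancel = solve 5 (λ s a b c x → s :* (a :* b) :+ (:- s :* a) :* b :+ c :* (s :* x) := s :* (c :* x)) refl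

    -- The part of degree j + 1 in the product of the series at s and at - s, which is (s - s) ^ (j
    -- + 1) / (j + 1)!. The telescoped sum shows that j + 1 times it is 0.
    convolution-zero : ∀ j → C (suc j) 0 + σ (suc j) * t 0 ≡ 0ℚ
    convolution-zero j = begin
      X  ≡⟨ *-identityˡ X ⟨
      1ℚ * X  ≡⟨ cong (_* X) (ι*1/ (suc j)) ⟨
      (ι (suc j) * (+ 1 / suc j)) * X  ≡⟨ shuffle (ι (suc j)) (+ 1 / suc j) X ⟩
      (+ 1 / suc j) * (ι (suc j) * X)  ≡⟨ cong ((+ 1 / suc j) *_) vanish ⟩
      (+ 1 / suc j) * 0ℚ  ≡⟨ *-zeroʳ (+ 1 / suc j) ⟩
      0ℚ  ∎
      where
      open ≡-Reasoning
      X : ℚ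
      X = C (suc j) 0 + σ (suc j) * t 0
      shuffle : ∀ a b c → (a * b) * c ≡ b * (a * c)
      shuffle = solve 3 (λ a b c → (a :* b) :* c := b :* (a :* c)) refl
      cancel : ∀ s a b → s * (a * b) + (- s * a) * b ≡ 0ℚ
      cancel = solve 3 (λ s a b → s :* (a :* b) :+ (:- s :* a) :* b := con 0ℚ) refl
      distribute : ∀ i c a b → i * (c + a * b) ≡ i * c + (i * a) * b
      distribute = solve 4 (λ i c a b → i :* (c :+ a :* b) := i :* c :+ (i :* a) :* b) refl
      vanish : ι (suc j) * X ≡ 0ℚ
      vanish = trans (distribute (ι (suc j)) (C (suc j) 0) (σ (suc j)) (t 0))
        (trans (cong₂ (λ a b → a + b * t 0) (trans (cong (λ k → ι (suc k) * C (suc j) 0) (sym (ℕ.+-identityʳ j))) (C-closed j 0)) (term-suc (- s) j))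
          (cancel s (σ j) (t 0)))

    -- B j d is the sum of σ i * e (j + d − i) over i < j.
    B : ℕ → ℕ → ℚ
    B zero    d = 0ℚ
    B (suc j) d = B j (suc d) + σ j * e (suc d)

    B-suc : ∀ j d → B j (suc d) ≡ B j d + C j d
    B-suc zero    d = refl
    B-suc (suc j) d = trans (cong (_+ σ j * e (2 ℕ.+ d)) (B-suc j (suc d)))
      (shuffle (B j (suc d)) (C j (suc d)) (σ j) (e (suc d)) (t (suc d)))
      where
      shuffle : ∀ b c a x y → (b + c) + a * (x + y) ≡ (b + a * x) + (c + a * y)
      shuffle = solve 5 (λ b c a x y → (b :+ c) :+ a :* (x :+ y) := (b :+ a :* x) :+ (c :+ a :* y)) refl

    B≡1 : ∀ n → B (suc n) 0 ≡ 1ℚ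
    B≡1 zero    = refl
    B≡1 (suc n) = begin
      B (suc n) 1 + σ (suc n) * (0ℚ + t 0)  ≡⟨ cong (_+ σ (suc n) * (0ℚ + t 0)) (B-suc (suc n) 0) ⟩
      (B (suc n) 0 + C (suc n) 0) + σ (suc n) * (0ℚ + t 0) ≡⟨ shuffle (B (suc n) 0) (C (suc n) 0) (σ (suc n)) (t 0) ⟩
      B (suc n) 0 + (C (suc n) 0 + σ (suc n) * t 0)  ≡⟨ cong₂ _+_ (B≡1 n) (convolution-zero n) ⟩
      1ℚ + 0ℚ  ≡⟨ +-identityʳ 1ℚ ⟩
      1ℚ  ∎
      where
      open ≡-Reasoning
      shuffle : ∀ b c a x → (b + c) + a * (0ℚ + x) ≡ b + (c + a * x)
      shuffle = solve 4 (λ b c a x → (b :+ c) :+ a :* (con 0ℚ :+ x) := b :+ (c :+ a :* x)) refl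

    -- Row i of the product exceeds the row kept in `B` by σ i times a tail of the series. With σ i
    -- ≤ G / 2 ^ i and the tail at most 2 G / 2 ^ (j + d - i), every row costs the same 2 G² / 2 ^
    -- (j + d).
    product≤ : ∀ j d → expPartial (- s) j * e (j ℕ.+ d) ≤ B j d + ι j * (G * (G + G) * ½^ (j ℕ.+ d))
    product≤ zero    d = ≤-reflexive (trans (*-zeroˡ (e d)) (sym (trans (+-identityˡ _) (*-zeroˡ (G * (G + G) * ½^ d)))))
    product≤ (suc j) d = begin
      (expPartial (- s) j + σ j) * e n
        ≡⟨ split (expPartial (- s) j) (σ j) (e n) (e (suc d)) ⟩
      expPartial (- s) j * e n + (σ j * e (suc d) + σ j * (e n - e (suc d)))
        ≤⟨ +-mono-≤ (subst (λ k → expPartial (- s) j * e k ≤ B j (suc d) + ι j * (G * (G + G) * ½^ k)) (ℕ.+-suc j d) (product≤ j (suc d)))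
             (+-monoʳ-≤ (σ j * e (suc d)) last) ⟩
      (B j (suc d) + ι j * R) + (σ j * e (suc d) + R)
        ≡⟨ join (B j (suc d)) (ι j) R (σ j * e (suc d)) ⟩
      (B j (suc d) + σ j * e (suc d)) + (1ℚ + ι j) * R
        ≡⟨ cong (λ i → (B j (suc d) + σ j * e (suc d)) + i * R) (ι-+ 1 j) ⟨
      B (suc j) d + ι (suc j) * R ∎
      where
      open ≤-Reasoning
      n : ℕ
      n = suc j ℕ.+ d
      R : ℚ
      R = G * (G + G) * ½^ n
      j+sd≡n : j ℕ.+ suc d ≡ n
      j+sd≡n = ℕ.+-suc j d
      split : ∀ p a x y → (p + a) * x ≡ p * x + (a * y + a * (x - y))
      split = solve 4 (λ p a x y → (p :+ a) :* x := p :* x :+ (a :* y :+ a :* (x :- y))) refl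
      join : ∀ b i r x → (b + i * r) + (x + r) ≡ (b + x) + (1ℚ + i) * r
      join = solve 4 (λ b i r x → (b :+ i :* r) :+ (x :+ r) := (b :+ x) :+ (con 1ℚ :+ i) :* r) refl
      0≤gap : 0ℚ ≤ e n - e (suc d)
      0≤gap = 0≤- (subst (λ k → e (suc d) ≤ e k) j+sd≡n (e-mono j (suc d)))
      last : σ j * (e n - e (suc d)) ≤ R
      last = begin
        σ j * (e n - e (suc d))  ≤⟨ *-mono 0≤gap (0≤* 0≤G (0≤½^ j)) (≤-trans (σ≤t j) (term≤ j))
                                                        (subst (λ k → e k - e (suc d) ≤ (G + G) * ½^ (suc d)) j+sd≡n (tail≤ j (suc d))) ⟩
        (G * ½^ j) * ((G + G) * ½^ (suc d))  ≡⟨ regroup G (½^ j) (½^ (suc d)) ⟩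
        G * (G + G) * (½^ j * ½^ (suc d))  ≡⟨ cong (G * (G + G) *_) (trans (sym (½^-+ j (suc d))) (cong ½^ j+sd≡n)) ⟩
        R  ∎
        where
        regroup : ∀ g a b → (g * a) * ((g + g) * b) ≡ g * (g + g) * (a * b)
        regroup = solve 3 (λ g a b → (g :* a) :* ((g :+ g) :* b) := g :* (g :+ g) :* (a :* b)) refl

    -- The partial sum at s is at least 1, and its product with the one at - s is at most 1 plus an
    -- error of at most 1. So no estimate of an alternating series is required.
    negative≤2 : ∀ n → threshold m ℕ.≤ n → expPartial (- s) n ≤ ι 2
    negative≤2 zero    ()
    negative≤2 n@(suc n′) thr with ≤-total 0ℚ (expPartial (- s) n)
    ... | inj₂ ≤0 = ≤-trans ≤0 (0≤ι 2)
    ... | inj₁ 0≤ = begin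
      expPartial (- s) n  ≡⟨ *-identityʳ _ ⟨
      expPartial (- s) n * 1ℚ  ≤⟨ *-monoˡ-≤-nonNeg (expPartial (- s) n) {{nonNegative 0≤}} (1≤e n′) ⟩
      expPartial (- s) n * e n  ≤⟨ subst (λ k → expPartial (- s) n * e k ≤ B n 0 + ι n * (G * (G + G) * ½^ k)) (ℕ.+-identityʳ n) (product≤ n 0) ⟩
      B n 0 + ι n * (G * (G + G) * ½^ n)  ≤⟨ +-mono-≤ (≤-reflexive (B≡1 n′)) error≤1 ⟩
      1ℚ + 1ℚ  ≡⟨⟩
      ι 2  ∎
      where
      open ≤-Reasoning
      shuffle : ∀ i g h → i * (g * (g + g) * h) ≡ h * (i * (ι 2 * (g * g)))
      shuffle = solve 3 (λ i g h → i :* (g :* (g :+ g) :* h) := h :* (i :* (con (ι 2) :* (g :* g)))) refl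
      N : ℕ
      N = 2 ℕ.^ (4 ℕ.* m)
      pow : n ℕ.* (2 ℕ.* (N ℕ.* N)) ≡ n ℕ.* 2 ℕ.^ suc (8 ℕ.* m)
      pow = cong (λ x → n ℕ.* (2 ℕ.* x)) (trans (sym (ℕ.^-distribˡ-+-* 2 (4 ℕ.* m) (4 ℕ.* m))) (cong (2 ℕ.^_) (double m)))
        where
        double : ∀ m → 4 ℕ.* m ℕ.+ 4 ℕ.* m ≡ 8 ℕ.* m
        double = ℕ.solve-∀
      cast : ι n * (ι 2 * (G * G)) ≡ ι (n ℕ.* 2 ℕ.^ suc (8 ℕ.* m))
      cast = trans (cong (λ x → ι n * (ι 2 * x)) (sym (ι-* N N))) (trans (cong (ι n *_) (sym (ι-* 2 (N ℕ.* N))))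
        (trans (sym (ι-* n (2 ℕ.* (N ℕ.* N)))) (cong ι pow)))
      error≤1 : ι n * (G * (G + G) * ½^ n) ≤ 1ℚ
      error≤1 = begin
        ι n * (G * (G + G) * ½^ n)  ≡⟨ shuffle (ι n) G (½^ n) ⟩
        ½^ n * (ι n * (ι 2 * (G * G)))  ≡⟨ cong (½^ n *_) cast ⟩
        ½^ n * ι (n ℕ.* 2 ℕ.^ suc (8 ℕ.* m))  ≤⟨ *-monoˡ-≤-nonNeg (½^ n) {{nonNegative (0≤½^ n)}} (ι-mono (n*2^≤2^n m n thr)) ⟩
        ½^ n * ι (2 ℕ.^ n)  ≡⟨ ½^*2^ n ⟩
        1ℚ  ∎

  -- The bound must not depend on `B`, which controls how negative q can be and enters only through
  -- the number of terms. Negative q do occur: nothing is known about the sign of the approximations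
  -- to a logarithm.
  exp-upper : ∀ B m n q → threshold B ℕ.≤ n → ∣ q ∣ ≤ ι B → q ≤ ι m → expPartial q n ≤ ι (2 ℕ.* 2 ℕ.^ (4 ℕ.* m))
  exp-upper B m n q thr ∣q∣≤B q≤m = by-sign (≤-total 0ℚ q)
    where
    x : ℕ
    x = 2 ℕ.^ (4 ℕ.* m)
    neg-involutive : ∀ q → - (- q) ≡ q
    neg-involutive = solve 1 (λ q → :- (:- q) := q) refl
    by-sign : 0ℚ ≤ q ⊎ q ≤ 0ℚ → expPartial q n ≤ ι (2 ℕ.* x)
    by-sign (inj₁ 0≤q) = ≤-trans (Bounded.e≤2G m 0≤q q≤m n) (≤-reflexive (sym (trans (cong (λ k → ι (x ℕ.+ k)) (ℕ.+-identityʳ x)) (ι-+ x x))))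
    by-sign (inj₂ q≤0) = ≤-trans (subst (λ r → expPartial r n ≤ ι 2) (neg-involutive q) (Bounded.negative≤2 B 0≤-q -q≤B n thr))
      (ι-mono (ℕ.*-monoʳ-≤ 2 {1} (ℕ.m^n>0 2 (4 ℕ.* m))))
      where
      0≤-q : 0ℚ ≤ - q
      0≤-q = neg-antimono-≤ q≤0
      -q≤B : - q ≤ ι B
      -q≤B = ≤-trans (≤-reflexive (trans (sym (0≤p⇒∣p∣≡p 0≤-q)) (∣-p∣≡∣p∣ q))) ∣q∣≤B

  Eventually : (ℕ → Set) → Set
  Eventually P = ∃[ K ] ∀ n → K ℕ.≤ n → P n

  eventually-bounded : ∀ x → ∃[ B ] Eventually (λ n → ∣ seq x n ∣ ≤ ι B)
  eventually-bounded x = B , K , λ n K≤n → begin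
    ∣ seq x n ∣  ≡⟨ cong ∣_∣ (split (seq x n) (seq x K)) ⟩
    ∣ (seq x n - seq x K) + seq x K ∣  ≤⟨ ∣p+q∣≤∣p∣+∣q∣ (seq x n - seq x K) (seq x K) ⟩
    ∣ seq x n - seq x K ∣ + ∣ seq x K ∣  ≤⟨ +-monoˡ-≤ ∣ seq x K ∣ (proj₂ (cauchy x 1ℚ (positive⁻¹ 1ℚ)) n K K≤n ℕ.≤-refl) ⟩
    1ℚ + ∣ seq x K ∣  ≤⟨ proj₂ (ι-archimedean (1ℚ + ∣ seq x K ∣)) ⟩
    ι B  ∎
    where
    open ≤-Reasoning
    K B : ℕ
    K = proj₁ (cauchy x 1ℚ (positive⁻¹ 1ℚ))
    B = proj₁ (ι-archimedean (1ℚ + ∣ seq x K ∣))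
    split : ∀ a b → a ≡ (a - b) + b
    split = solve 2 (λ a b → a := (a :- b) :+ b) refl

  -- Rationals are decidably ordered, so one can argue at a single index: q ≤ m would give z ≤ `U` +
  -- ½, against `U` + 1 ≤ z.
  exp-below : ∀ m {q z E} → (q ≤ ι m → E ≤ ι (2 ℕ.* 2 ℕ.^ (4 ℕ.* m))) → ∣ E - z ∣ ≤ ½ →
              ι (2 ℕ.* 2 ℕ.^ (4 ℕ.* m)) + 1ℚ ≤ z → ι m ≤ q
  exp-below m {q} {z} {E} E≤ close large = by-order (≤-total (ι m) q)
    where
    open ≤-Reasoning
    U : ℚ
    U = ι (2 ℕ.* 2 ℕ.^ (4 ℕ.* m))
    flip : ∀ a b → - (a - b) ≡ b - a
    flip = solve 2 (λ a b → :- (a :- b) := b :- a) refl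
    split : ∀ a b → a ≡ b + (a - b)
    split = solve 2 (λ a b → a := b :+ (a :- b)) refl
    gap : z - E ≤ ½
    gap = ≤-trans (p≤∣p∣ (z - E)) (≤-trans (≤-reflexive (trans (sym (∣-p∣≡∣p∣ (z - E))) (cong ∣_∣ (flip z E)))) close)
    ½<1 : ½ < 1ℚ
    ½<1 = *<* (ℤ.+<+ (ℕ.s≤s (ℕ.s≤s ℕ.z≤n)))
    by-order : ι m ≤ q ⊎ q ≤ ι m → ι m ≤ q
    by-order (inj₁ m≤q) = m≤q
    by-order (inj₂ q≤m) = contradiction (begin
      U + 1ℚ  ≤⟨ large ⟩
      z  ≡⟨ split z E ⟩
      E + (z - E)  ≤⟨ +-mono-≤ (E≤ q≤m) gap ⟩
      U + ½  ∎) (<⇒≱ (+-monoʳ-< U ½<1))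

  -- Since exp m ≤ 2 · 2 ^ (4 m), a number above this bound has a logarithm above m.
  log-lower : ∀ y z m → IsLog z y → Eventually (λ n → ι (2 ℕ.* 2 ℕ.^ (4 ℕ.* m)) + 1ℚ ≤ seq z n) →
              Eventually (λ n → ι m ≤ seq y n)
  log-lower y z m is-log (K₁ , large) = combine (eventually-bounded y) (is-log ½ (positive⁻¹ ½))
    where
    combine : (∃[ B ] Eventually (λ n → ∣ seq y n ∣ ≤ ι B)) → Eventually (λ n → ∣ seq (expSum n y) n - seq z n ∣ ≤ ½) →
              Eventually (λ n → ι m ≤ seq y n)
    combine (B , K₂ , bounded) (K₃ , close) = (K₁ ℕ.⊔ K₂) ℕ.⊔ (K₃ ℕ.⊔ threshold B) , λ n K≤n →
      let K₁₂≤n = ℕ.m⊔n≤o⇒m≤o (K₁ ℕ.⊔ K₂) (K₃ ℕ.⊔ threshold B) K≤n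
          K₃₄≤n = ℕ.m⊔n≤o⇒n≤o (K₁ ℕ.⊔ K₂) (K₃ ℕ.⊔ threshold B) K≤n
      in exp-below m {seq y n} {seq z n} {seq (expSum n y) n}
           (λ y≤m → subst (_≤ ι (2 ℕ.* 2 ℕ.^ (4 ℕ.* m))) (sym (seq-exp y n n))
             (exp-upper B m n (seq y n) (ℕ.m⊔n≤o⇒n≤o K₃ (threshold B) K₃₄≤n) (bounded n (ℕ.m⊔n≤o⇒n≤o K₁ K₂ K₁₂≤n)) y≤m))
           (close n (ℕ.m⊔n≤o⇒m≤o K₃ (threshold B) K₃₄≤n)) (large n (ℕ.m⊔n≤o⇒m≤o K₁ K₂ K₁₂≤n))

  -- `m₁` and `m₂` will be lower bounds for log x and log log x; lower bounds suffice, as the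
  -- iterated logarithm stands only on the larger side of the theorem. The two exponential
  -- inequalities feed `log-lower`. In `exp≤N` the 2 is the 1 required there plus the tolerance 1
  -- with which N ≤ x holds for the approximations.
  record Scales (N : ℕ) : Set where
    field
      L l m₁ m₂    : ℕ
      N<           : N ℕ.< 2 ℕ.^ suc L
      L<           : L ℕ.< 2 ℕ.^ suc l
      2≤l          : 2 ℕ.≤ l
      1+l≤         : suc l ℕ.≤ 13 ℕ.* m₂
      iterated-exp : 2 ℕ.* 2 ℕ.^ (4 ℕ.* m₂) ℕ.+ 1 ℕ.≤ m₁
      exp≤N        : 2 ℕ.* 2 ℕ.^ (4 ℕ.* m₁) ℕ.+ 2 ℕ.≤ N

  2^+-≤ : ∀ x c → c ℕ.≤ 2 ℕ.^ x → 2 ℕ.^ x ℕ.+ c ℕ.≤ 2 ℕ.^ suc x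
  2^+-≤ x c h = ℕ.+-monoʳ-≤ (2 ℕ.^ x) (ℕ.≤-trans h (ℕ.≤-reflexive (sym (ℕ.+-identityʳ _))))

  scales : ∀ N t → 9 ℕ.≤ t → 2 ℕ.^ (2 ℕ.^ t) ℕ.≤ N → Scales N
  scales N t 9≤t N≥ = record
    { L = L ; l = l ; m₁ = m₁ ; m₂ = m₂
    ; N< = proj₂ N-bounds ; L< = proj₂ L-bounds
    ; 2≤l = ℕ.≤-trans (ℕ.m≤m+n 2 7) 9≤l
    ; 1+l≤ = 1+l≤
    ; iterated-exp = ℕ.≤-trans (2^+-≤ (suc (4 ℕ.* m₂)) 1 (ℕ.m^n>0 2 (suc (4 ℕ.* m₂)))) (ℕ.^-monoʳ-≤ 2 (ℕ.+-monoʳ-≤ 2 4m₂≤q))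
    ; exp≤N = ℕ.≤-trans (2^+-≤ (suc (4 ℕ.* m₁)) 2 (ℕ.*-monoʳ-≤ 2 {1} (ℕ.m^n>0 2 (4 ℕ.* m₁)))) (ℕ.≤-trans (ℕ.^-monoʳ-≤ 2 exponent) (proj₁ N-bounds))
    }
    where
    instance
      N≢0 : ℕ.NonZero N
      N≢0 = ℕ.>-nonZero (ℕ.≤-trans (ℕ.m^n>0 2 (2 ℕ.^ t)) N≥)
    L l q m₁ m₂ : ℕ
    L = log N
    l = log L
    N-bounds : 2 ℕ.^ L ℕ.≤ N × N ℕ.< 2 ℕ.^ suc L
    N-bounds = log-bounds N
    below : ∀ {a b} → 2 ℕ.^ a ℕ.< 2 ℕ.^ suc b → a ℕ.≤ b
    below {a} {b} h with a ℕ.≤? b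
    ... | yes a≤b = a≤b
    ... | no  a≰b = contradiction (ℕ.^-monoʳ-≤ 2 (ℕ.≰⇒> a≰b)) (ℕ.<⇒≱ h)
    2^t≤L : 2 ℕ.^ t ℕ.≤ L
    2^t≤L = below (ℕ.≤-<-trans N≥ (proj₂ N-bounds))
    L-bounds : 2 ℕ.^ l ℕ.≤ L × L ℕ.< 2 ℕ.^ suc l
    L-bounds = log-bounds L {{ℕ.>-nonZero (ℕ.≤-trans (ℕ.m^n>0 2 t) 2^t≤L)}}
    9≤l : 9 ℕ.≤ l
    9≤l = ℕ.≤-trans 9≤t (below (ℕ.≤-<-trans 2^t≤L (proj₂ L-bounds)))
    -- With l = 5 + `q`, 4 `m₁` is 2 ^ (4 + `q`), half of 2 ^ l, and the other half absorbs the
    -- additive 2. From 9 ≤ l follows 4 ≤ `q`, so `m₂` is positive and a fixed multiple of it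
    -- exceeds l.
    q = l ℕ.∸ 5
    m₂ = q ℕ./ 4
    m₁ = 2 ℕ.^ (2 ℕ.+ q)
    5+q≡l : 5 ℕ.+ q ≡ l
    5+q≡l = ℕ.m+[n∸m]≡n (ℕ.≤-trans (ℕ.m≤m+n 5 4) 9≤l)
    4m₂≤q : 4 ℕ.* m₂ ℕ.≤ q
    4m₂≤q = ℕ.≤-trans (ℕ.≤-reflexive (ℕ.*-comm 4 m₂)) (m/n*n≤m q 4)
    1≤m₂ : 1 ℕ.≤ m₂
    1≤m₂ = m≥n⇒m/n>0 (ℕ.∸-monoˡ-≤ 5 9≤l)
    1+l≤ : suc l ℕ.≤ 13 ℕ.* m₂
    1+l≤ = begin
      suc l  ≡⟨ cong suc 5+q≡l ⟨
      6 ℕ.+ q  ≡⟨ cong (6 ℕ.+_) (m≡m%n+[m/n]*n q 4) ⟩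
      6 ℕ.+ (q ℕ.% 4 ℕ.+ m₂ ℕ.* 4)  ≤⟨ ℕ.+-monoʳ-≤ 6 (ℕ.+-monoˡ-≤ (m₂ ℕ.* 4) (ℕ.≤-pred (m%n<n q 4))) ⟩
      9 ℕ.+ m₂ ℕ.* 4  ≤⟨ ℕ.+-monoˡ-≤ (m₂ ℕ.* 4) (ℕ.*-monoʳ-≤ 9 1≤m₂) ⟩
      9 ℕ.* m₂ ℕ.+ m₂ ℕ.* 4  ≡⟨ collect m₂ ⟩
      13 ℕ.* m₂  ∎
      where
      open ℕ.≤-Reasoning
      collect : ∀ m → 9 ℕ.* m ℕ.+ m ℕ.* 4 ≡ 13 ℕ.* m
      collect = ℕ.solve-∀
    exponent : 2 ℕ.+ 4 ℕ.* m₁ ℕ.≤ L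
    exponent = begin
      2 ℕ.+ 4 ℕ.* m₁  ≡⟨ ℕ.+-comm 2 _ ⟩
      4 ℕ.* m₁ ℕ.+ 2  ≡⟨ cong (ℕ._+ 2) (quadruple (2 ℕ.^ q)) ⟩
      2 ℕ.^ (4 ℕ.+ q) ℕ.+ 2  ≤⟨ 2^+-≤ (4 ℕ.+ q) 2 (ℕ.*-monoʳ-≤ 2 {1} (ℕ.m^n>0 2 (3 ℕ.+ q))) ⟩
      2 ℕ.^ (5 ℕ.+ q)  ≡⟨ cong (2 ℕ.^_) 5+q≡l ⟩
      2 ℕ.^ l  ≤⟨ proj₁ L-bounds ⟩
      L  ∎
      where
      open ℕ.≤-Reasoning
      quadruple : ∀ x → 4 ℕ.* (2 ℕ.* (2 ℕ.* x)) ≡ 2 ℕ.* (2 ℕ.* (2 ℕ.* (2 ℕ.* x)))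
      quadruple = ℕ.solve-∀

  floor-≥ : ∀ {x N N₀} → fromℕ N₀ ≤ᴿ x → IsFloor x N → N₀ ℕ.≤ N
  floor-≥ {x} {N} {N₀} N₀≤x (_ , δ , 0<δ , K₁ , x<) = by-order (N₀ ℕ.≤? N) (N₀≤x (δ * ½) 0<δ/2)
    where
    open ≤-Reasoning
    0<δ/2 : 0ℚ < δ * ½
    0<δ/2 = positive⁻¹ (δ * ½) {{pos*pos⇒pos δ {{positive 0<δ}} ½}}
    halves : ∀ a d → (a + d * ½) + d * ½ ≡ a + d
    halves = solve 2 (λ a d → (a :+ d :* con ½) :+ d :* con ½ := a :+ d) refl
    by-order : Dec (N₀ ℕ.≤ N) → Eventually (λ n → ι N₀ ≤ seq x n + δ * ½) → N₀ ℕ.≤ N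
    by-order (yes N₀≤N) _ = N₀≤N
    by-order (no N₀≰N) (K₂ , N₀≤) = contradiction (begin
      ι (suc N) + δ * ½  ≤⟨ +-monoˡ-≤ (δ * ½) (ι-mono (ℕ.≰⇒> N₀≰N)) ⟩
      ι N₀ + δ * ½  ≤⟨ +-monoˡ-≤ (δ * ½) (N₀≤ n (ℕ.m≤n⊔m K₁ K₂)) ⟩
      (seq x n + δ * ½) + δ * ½  ≡⟨ halves (seq x n) δ ⟩
      seq x n + δ  ≤⟨ x< n (ℕ.m≤m⊔n K₁ K₂) ⟩
      ι (suc N)  ∎)
      (<⇒≱ (subst (_< ι (suc N) + δ * ½) (+-identityʳ (ι (suc N))) (+-monoʳ-< (ι (suc N)) 0<δ/2)))
      where
      n : ℕ
      n = K₁ ℕ.⊔ K₂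

  -- `b` stands for the maximum of x and δ, the number that `recip` inverts. Rounding costs a factor
  -- 2: since 2 ≤ N, one has N = 2 N - N ≤ 2 (x + 1) - 2 = 2 x.
  quotient≤ : ∀ {S N W C m₂ : ℕ} {x inv b ℓ₂ : ℚ} → b * inv ≡ 1ℚ → 0ℚ < b → x ≤ b → ι N ≤ x + 1ℚ → 2 ℕ.≤ N →
              S ℕ.≤ N ℕ.* W → 2 ℕ.* W ℕ.≤ C ℕ.* (m₂ ℕ.* m₂ ℕ.* m₂) → ι m₂ ≤ ℓ₂ →
              inv * ι S ≤ ι C * (ℓ₂ * (ℓ₂ * (ℓ₂ * 1ℚ)))
  quotient≤ {S} {N} {W} {C} {m₂} {x} {inv} {b} {ℓ₂} b*inv 0<b x≤b N≤x+1 2≤N S≤ 2W≤ m₂≤ℓ₂ = ≤-trans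
    (*-cancelˡ-≤-pos b {{positive 0<b}} (begin
      b * (inv * ι S)  ≡⟨ trans (sym (*-assoc b inv (ι S))) (trans (cong (_* ι S) b*inv) (*-identityˡ (ι S))) ⟩
      ι S  ≤⟨ ι-mono S≤ ⟩
      ι (N ℕ.* W)  ≡⟨ ι-* N W ⟩
      ι N * ι W  ≤⟨ *-monoʳ-≤-nonNeg (ι W) {{nonNegative (0≤ι W)}} N≤2b ⟩
      (b + b) * ι W  ≡⟨ double b (ι W) ⟩
      b * (ι 2 * ι W)  ≡⟨ cong (b *_) (ι-* 2 W) ⟨
      b * ι (2 ℕ.* W)  ∎))
    (≤-trans (ι-mono 2W≤) (≤-trans (≤-reflexive (ι-* C _)) (*-monoˡ-≤-nonNeg (ι C) {{nonNegative (0≤ι C)}} cube≤)))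
    where
    open ≤-Reasoning
    double : ∀ b w → (b + b) * w ≡ b * (ι 2 * w)
    double = solve 2 (λ b w → (b :+ b) :* w := b :* (con (ι 2) :* w)) refl
    N≤2b : ι N ≤ b + b
    N≤2b = begin
      ι N  ≡⟨ split (ι N) ⟩
      (ι N + ι N) - ι N  ≤⟨ +-mono-≤ (+-mono-≤ N≤x+1 N≤x+1) (neg-antimono-≤ (ι-mono 2≤N)) ⟩
      ((x + 1ℚ) + (x + 1ℚ)) - ι 2 ≡⟨ cancel x ⟩
      x + x  ≤⟨ +-mono-≤ x≤b x≤b ⟩
      b + b  ∎
      where
      split : ∀ a → a ≡ (a + a) - a
      split = solve 1 (λ a → a := (a :+ a) :- a) refl
      cancel : ∀ x → ((x + 1ℚ) + (x + 1ℚ)) - ι 2 ≡ x + x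
      cancel = solve 1 (λ x → ((x :+ con 1ℚ) :+ (x :+ con 1ℚ)) :- con (ι 2) := x :+ x) refl
    cube≤ : ι (m₂ ℕ.* m₂ ℕ.* m₂) ≤ ℓ₂ * (ℓ₂ * (ℓ₂ * 1ℚ))
    cube≤ = begin
      ι (m₂ ℕ.* m₂ ℕ.* m₂)  ≡⟨ cong ι (arrange m₂) ⟩
      ι (m₂ ℕ.^ 3)  ≡⟨ power-ι m₂ 3 ⟨
      power (ι m₂) 3  ≤⟨ power-mono 3 (0≤ι m₂) m₂≤ℓ₂ ⟩
      power ℓ₂ 3  ∎
      where
      arrange : ∀ m → m ℕ.* m ℕ.* m ≡ m ℕ.* (m ℕ.* (m ℕ.* 1))
      arrange = ℕ.solve-∀

  module _ (C₁ : ℕ) (average : ∀ N L l → N ℕ.< 2 ℕ.^ suc L → L ℕ.< 2 ℕ.^ suc l → 2 ℕ.≤ l →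
                               sumM N ℕ.≤ N ℕ.* (C₁ ℕ.* (suc l ℕ.* suc l ℕ.* suc l)))
           (t : ℕ) (9≤t : 9 ℕ.≤ t) where

    private
      C : ℕ
      -- The 2 compares N with x, the cube of 13 compares l + 1 with `m₂`, and `suc` makes the
      -- constant positive.
      C = suc (2 ℕ.* C₁ ℕ.* (13 ℕ.* 13 ℕ.* 13))

      constant : ∀ {a m} → a ℕ.≤ 13 ℕ.* m → 2 ℕ.* (C₁ ℕ.* (a ℕ.* a ℕ.* a)) ℕ.≤ C ℕ.* (m ℕ.* m ℕ.* m)
      constant {a} {m} a≤ = begin
        2 ℕ.* (C₁ ℕ.* (a ℕ.* a ℕ.* a))  ≤⟨ ℕ.*-monoʳ-≤ 2 (ℕ.*-monoʳ-≤ C₁ (ℕ.*-mono-≤ (ℕ.*-mono-≤ a≤ a≤) a≤)) ⟩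
        2 ℕ.* (C₁ ℕ.* (13 ℕ.* m ℕ.* (13 ℕ.* m) ℕ.* (13 ℕ.* m))) ≡⟨ arrange C₁ 13 m ⟩
        2 ℕ.* C₁ ℕ.* (13 ℕ.* 13 ℕ.* 13) ℕ.* (m ℕ.* m ℕ.* m)  ≤⟨ ℕ.m≤n+m _ _ ⟩
        C ℕ.* (m ℕ.* m ℕ.* m)  ∎
        where
        open ℕ.≤-Reasoning
        arrange : ∀ c k m → 2 ℕ.* (c ℕ.* (k ℕ.* m ℕ.* (k ℕ.* m) ℕ.* (k ℕ.* m))) ≡ 2 ℕ.* c ℕ.* (k ℕ.* k ℕ.* k) ℕ.* (m ℕ.* m ℕ.* m)
        arrange = ℕ.solve-∀

    real-average : ∃[ C ] ∃[ x₀ ] 0ᴿ <ᴿ C ×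
      (∀ x → x₀ ≤ᴿ x → (x>0 : 0ᴿ <ᴿ x) →
       ∀ N → IsFloor x N →
       ∀ ℓ ℓ₂ → IsLog x ℓ → IsLog ℓ ℓ₂ →
       recip x x>0 *ᴿ fromℕ (sumM N) ≤ᴿ C *ᴿ ℓ₂ ^ᴿ 3)
    real-average = fromℕ C , fromℕ (2 ℕ.^ (2 ℕ.^ t)) ,
      (1ℚ , positive⁻¹ 1ℚ , 0 , λ _ _ → ≤-trans (≤-reflexive (+-identityˡ 1ℚ)) (ι-mono {1} {C} (ℕ.s≤s ℕ.z≤n))) , bound
      where
      bound : ∀ x → fromℕ (2 ℕ.^ (2 ℕ.^ t)) ≤ᴿ x → (x>0 : 0ᴿ <ᴿ x) → ∀ N → IsFloor x N →
              ∀ ℓ ℓ₂ → IsLog x ℓ → IsLog ℓ ℓ₂ → recip x x>0 *ᴿ fromℕ (sumM N) ≤ᴿ fromℕ C *ᴿ ℓ₂ ^ᴿ 3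
      bound x x₀≤x (δ , 0<δ , _) N floor@(N≤x , _) ℓ ℓ₂ logx logℓ ε 0<ε = conclude (N≤x 1ℚ (positive⁻¹ 1ℚ)) ℓ₂-large
        where
        open Scales (scales N t 9≤t (floor-≥ {x} {N} x₀≤x floor))
        cancel-1 : ∀ {a b} → a + 1ℚ ≤ b + 1ℚ → a ≤ b
        cancel-1 {a} {b} h = subst₂ _≤_ (undo a) (undo b) (+-monoˡ-≤ (- 1ℚ) h)
          where
          undo : ∀ a → (a + 1ℚ) - 1ℚ ≡ a
          undo = solve 1 (λ a → (a :+ con 1ℚ) :- con 1ℚ := a) refl
        ℓ-large : Eventually (λ n → ι m₁ ≤ seq ℓ n)
        ℓ-large = log-lower ℓ x m₁ logx (x-large (N≤x 1ℚ (positive⁻¹ 1ℚ)))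
          where
          U : ℕ
          U = 2 ℕ.* 2 ℕ.^ (4 ℕ.* m₁)
          x-large : Eventually (λ n → ι N ≤ seq x n + 1ℚ) → Eventually (λ n → ι U + 1ℚ ≤ seq x n)
          x-large (K , h) = K , λ n K≤n → cancel-1 (≤-trans (≤-reflexive (trans (+-assoc (ι U) 1ℚ 1ℚ) (sym (ι-+ U 2))))
            (≤-trans (ι-mono exp≤N) (h n K≤n)))
        ℓ₂-large : Eventually (λ n → ι m₂ ≤ seq ℓ₂ n)
        ℓ₂-large = log-lower ℓ₂ ℓ m₂ logℓ (proj₁ ℓ-large , λ n K≤n →
          ≤-trans (≤-reflexive (sym (ι-+ (2 ℕ.* 2 ℕ.^ (4 ℕ.* m₂)) 1))) (≤-trans (ι-mono iterated-exp) (proj₂ ℓ-large n K≤n)))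
        2≤N : 2 ℕ.≤ N
        2≤N = ℕ.≤-trans (ℕ.m≤n+m 2 (2 ℕ.* 2 ℕ.^ (4 ℕ.* m₁))) exp≤N
        conclude : Eventually (λ n → ι N ≤ seq x n + 1ℚ) → Eventually (λ n → ι m₂ ≤ seq ℓ₂ n) →
                   ∃[ K ] ∀ n → K ℕ.≤ n → (1/ (seq x n ⊔ δ)) {{>-nonZero (<-≤-trans 0<δ (p≤q⊔p (seq x n) δ))}} * ι (sumM N) ≤
                                           ι C * (seq ℓ₂ n * (seq ℓ₂ n * (seq ℓ₂ n * 1ℚ))) + ε
        conclude (K₁ , large) (K₂ , large₂) = K₁ ℕ.⊔ K₂ , λ n K≤n → let 0<b = <-≤-trans 0<δ (p≤q⊔p (seq x n) δ) in
          ≤-trans (quotient≤ {sumM N} {N} {C₁ ℕ.* (suc l ℕ.* suc l ℕ.* suc l)} {C} {m₂} {seq x n} {_} {seq x n ⊔ δ} {seq ℓ₂ n}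
                    (*-inverseʳ (seq x n ⊔ δ) {{>-nonZero 0<b}}) 0<b (p≤p⊔q (seq x n) δ) (large n (ℕ.m⊔n≤o⇒m≤o K₁ K₂ K≤n)) 2≤N
                    (average N L l N< L< 2≤l) (constant {suc l} {m₂} 1+l≤) (large₂ n (ℕ.m⊔n≤o⇒n≤o K₁ K₂ K≤n)))
            (p≤p+q (ι C * (seq ℓ₂ n * (seq ℓ₂ n * (seq ℓ₂ n * 1ℚ)))) (<⇒≤ 0<ε))

open Average using (average-weight)
open import Data.Nat.Properties using (≤-refl)

theorem1 : ∃[ C ] ∃[ x₀ ] 0ᴿ <ᴿ C ×
    (∀ x → x₀ ≤ᴿ x → (x>0 : 0ᴿ <ᴿ x) →
    ∀ N → IsFloor x N →
    ∀ ℓ ℓ₂ → IsLog x ℓ → IsLog ℓ ℓ₂ →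
    recip x x>0 *ᴿ fromℕ (sumM N) ≤ᴿ C *ᴿ ℓ₂ ^ᴿ 3)
theorem1 = Reals.real-average (proj₁ average-weight) (proj₂ average-weight) 9 ≤-refl
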